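{- (1) $\mathrm{SEL}(\Sigma^0_2,2^{\mathbb N})$ does not hold for $(<\omega,1)$-degrees. (2) $\mathrm{SEL}(\Sigma^0_2,2^{\mathbb N})$ holds for $(1,\omega)$-degrees. (3) $\mathrm{SEL}(\Pi^0_2,2^{\mathbb N})$ does not hold for $(1,\omega)$-degrees. (4) $\mathrm{SEL}(\Pi^0_2,\mathbb N^{\mathbb N})$ holds for $(<\omega,\omega)$-degrees. (5) $\mathrm{SEL}(\Sigma^0_3,2^{\mathbb N})$ does not hold for $(<\omega,\omega)$-degrees.
   Context: For a (lightface) pointclass $\Gamma$ in a space $X\in\{2^{\mathbb N},\mathbb N^{\mathbb N}\}$, $\mathrm{SEL}(\Gamma,X)$ holds for $(\alpha,\beta)$-degrees if, for every $\Gamma$ set $S\subseteq X$ and for every nonempty $\Pi^0_1$ set $Q\subseteq2^{\mathbb N}$, there exists a $\Pi^0_1$ set $P\subseteq2^{\mathbb N}$ such that $P\equiv^\alpha_\beta S\cup Q$. Let $\{\Phi_e\}_{e\in\mathbb N}$ be an effective enumeration of all partial computable functions $\Phi_e:\subseteq\mathbb N^{\mathbb N}\to\mathbb N^{\mathbb N}$. A learner is a total computable function $\Psi:\mathbb N^{<\mathbb N}\to\mathbb N$; let $\{\Psi_e\}_{e\in\mathbb N}$ be an effective enumeration of all learners. A partial function $\Gamma:\subseteq\mathbb N^{\mathbb N}\to\mathbb N^{\mathbb N}$ is identified by $\Psi$ on $g$ if $\lim_n\Psi(g\upharpoonright n)$ exists and $\Phi_{\lim_n\Psi(g\upharpoonright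 n)}(g)=\Gamma(g)$. $\Gamma$ is $(<\omega,1)$-computable if there is $b\in\mathbb N$ such that for every $g\in\mathrm{dom}(\Gamma)$, $\Gamma(g)=\Phi_e(g)$ for some $e<b$. $\Gamma$ is $(1,\omega)$-computable if a single learner identifies it on every $g\in\mathrm{dom}(\Gamma)$. $\Gamma$ is $(<\omega,\omega)$-computable if there is $b\in\mathbb N$ such that for every $g\in\mathrm{dom}(\Gamma)$, $\Gamma$ is identified by $\Psi_e$ on $g$ for some $e<b$. For $A,B\subseteq\mathbb N^{\mathbb N}$, $A\le^\alpha_\beta B$ means there is an $(\alpha,\beta)$-computable $\Gamma$ with $B\subseteq\mathrm{dom}(\Gamma)$ and $\Gamma(g)\in A$ for every $g\in B$; $A\equiv^\alpha_\beta B$ means $A\le^\alpha_\beta B$ and $B\le^\alpha_\beta A$. -}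

module Defs where

open import Level using (0ℓ)
open import Data.List.Base using (List; []; _∷_; applyUpTo)
open import Data.Nat.Base using (ℕ; zero; suc; _+_; _≤_; _<_)
open import Data.Product.Base using (_×_; _,_; proj₁; proj₂; ∃-syntax)
open import Data.Sum.Base using (_⊎_)
open import Data.Vec.Base using (Vec; []; _∷_; toList)
open import Relation.Binary.Core using (REL)
open import Relation.Binary.PropositionalEquality using (_≡_; _≗_)
open import Relation.Unary using (Pred; _∈_; _⊆_; _≐_; _∪_; _∩_; U; Satisfiable)

Baire : Set
Baire = ℕ → ℕ

-- 2^ℕ is treated as the subspace of ℕ^ℕ of {0,1}-valued sequences.
data Space : Set where
  2^ℕ ℕ^ℕ : Space

points : Space → Pred Baire 0ℓ
points 2^ℕ = λ x → ∀ n → x n < 2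
points ℕ^ℕ = U

-- The Cantor pairing function and its inverse; unpair walks along the
-- diagonals (0,0), (1,0), (0,1), (2,0), (1,1), (0,2), …

triangle : ℕ → ℕ
triangle zero    = zero
triangle (suc n) = suc n + triangle n

⟨_,_⟩ : ℕ → ℕ → ℕ
⟨ a , b ⟩ = triangle (a + b) + b

next : ℕ × ℕ → ℕ × ℕ
next (zero  , b) = suc b , zero
next (suc a , b) = a , suc b

unpair : ℕ → ℕ × ℕ
unpair zero    = zero , zero
unpair (suc n) = next (unpair n)

π₁ π₂ : ℕ → ℕ
π₁ n = proj₁ (unpair n)
π₂ n = proj₂ (unpair n)

⌜_⌝ : List ℕ → ℕ
⌜ [] ⌝     = zero
⌜ x ∷ xs ⌝ = suc ⟨ x , ⌜ xs ⌝ ⟩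

-- Programs for the partial recursive functions of one argument relative to an
-- oracle. Several arguments are passed through the pairing function.

data Code : Set where
  const0 succ left right oracle : Code
  pair comp prec                : Code → Code → Code
  mu                            : Code → Code

-- A partial function is represented by its graph.

primRec : REL ℕ ℕ 0ℓ → REL ℕ ℕ 0ℓ → ℕ → REL ℕ ℕ 0ℓ
primRec F G a zero    v = F a v
primRec F G a (suc n) v = ∃[ u ] primRec F G a n u × G ⟨ a , ⟨ n , u ⟩ ⟩ v

least : REL ℕ ℕ 0ℓ → REL ℕ ℕ 0ℓ
least F m v = F ⟨ m , v ⟩ 0 × (∀ k → k < v → ∃[ u ] F ⟨ m , k ⟩ (suc u))

-- ⟦ c ⟧ g m v: with oracle g, program c halts on input m with output v.
⟦_⟧ : Code → Baire → REL ℕ ℕ 0ℓ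
⟦ const0   ⟧ g m v = v ≡ 0
⟦ succ     ⟧ g m v = v ≡ suc m
⟦ left     ⟧ g m v = v ≡ π₁ m
⟦ right    ⟧ g m v = v ≡ π₂ m
⟦ oracle   ⟧ g m v = v ≡ g m
⟦ pair c d ⟧ g m v = ∃[ a ] ∃[ b ] ⟦ c ⟧ g m a × ⟦ d ⟧ g m b × v ≡ ⟨ a , b ⟩
⟦ comp c d ⟧ g m v = ∃[ u ] ⟦ d ⟧ g m u × ⟦ c ⟧ g u v
⟦ prec c d ⟧ g m v = primRec (⟦ c ⟧ g) (⟦ d ⟧ g) (π₁ m) (π₂ m) v
⟦ mu c     ⟧ g m v = least (⟦ c ⟧ g) m v

encode : Code → ℕ
encode const0     = ⟨ 0 , 0 ⟩
encode succ       = ⟨ 1 , 0 ⟩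
encode left       = ⟨ 2 , 0 ⟩
encode right      = ⟨ 3 , 0 ⟩
encode oracle     = ⟨ 4 , 0 ⟩
encode (pair c d) = ⟨ 5 , ⟨ encode c , encode d ⟩ ⟩
encode (comp c d) = ⟨ 6 , ⟨ encode c , encode d ⟩ ⟩
encode (prec c d) = ⟨ 7 , ⟨ encode c , encode d ⟩ ⟩
encode (mu c)     = ⟨ 8 , encode c ⟩

-- The program with index e, relative to the oracle g. A number that does not
-- encode a program is an index of the empty function.
Run : ℕ → Baire → REL ℕ ℕ 0ℓ
Run e g m v = ∃[ c ] encode c ≡ e × ⟦ c ⟧ g m v

-- Φ e g f: the value Φ_e(g) is defined and equals f.
Φ : ℕ → REL Baire Baire 0ℓ
Φ e g f = ∀ n → Run e g n (f n)

record PartialFunction : Set₁ where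
  field
    Graph      : REL Baire Baire 0ℓ
    functional : ∀ {g f f′} → Graph g f → Graph g f′ → f ≗ f′
    respects-≗ : ∀ {g g′ f f′} → g ≗ g′ → f ≗ f′ → Graph g f → Graph g′ f′

  dom : Pred Baire 0ℓ
  dom g = ∃[ f ] Graph g f

open PartialFunction public

-- e is an index of Ψ : ℕ^{<ℕ} → ℕ as an (oracle-free) computable function. The
-- total computable functions have no effective enumeration in the strict
-- sense, so the learner Ψ_e is the e-th partial computable function, for those
-- e for which that function is total.
IsΨ : ℕ → (List ℕ → ℕ) → Set
IsΨ e Ψ = ∀ σ → Run e (λ _ → 0) ⌜ σ ⌝ (Ψ σ)

Learner : (List ℕ → ℕ) → Set
Learner Ψ = ∃[ e ] IsΨ e Ψ

_↾_ : Baire → ℕ → List ℕ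
g ↾ n = applyUpTo g n

Lim : (ℕ → ℕ) → ℕ → Set
Lim s l = ∃[ N ] (∀ n → N ≤ n → s n ≡ l)

-- Ψ identifies on g a function whose value at g is f.
Identifies : (List ℕ → ℕ) → REL Baire Baire 0ℓ
Identifies Ψ g f = ∃[ l ] Lim (λ n → Ψ (g ↾ n)) l × Φ l g f

[<ω,1]-computable : Pred PartialFunction 0ℓ
[<ω,1]-computable Γ =
  ∃[ b ] (∀ g f → Graph Γ g f → ∃[ e ] e < b × Φ e g f)

[1,ω]-computable : Pred PartialFunction 0ℓ
[1,ω]-computable Γ =
  ∃[ Ψ ] Learner Ψ × (∀ g f → Graph Γ g f → Identifies Ψ g f)

[<ω,ω]-computable : Pred PartialFunction 0ℓ
[<ω,ω]-computable Γ =
  ∃[ b ] (∀ g f → Graph Γ g f →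
    ∃[ e ] e < b × (∃[ Ψ ] IsΨ e Ψ × Identifies Ψ g f))

_≤[_]_ : Pred Baire 0ℓ → Pred PartialFunction 0ℓ → Pred Baire 0ℓ → Set₁
A ≤[ αβ ] B =
  ∃[ Γ ] αβ Γ × B ⊆ dom Γ × (∀ g f → g ∈ B → Graph Γ g f → f ∈ A)

_≡[_]_ : Pred Baire 0ℓ → Pred PartialFunction 0ℓ → Pred Baire 0ℓ → Set₁
A ≡[ αβ ] B = A ≤[ αβ ] B × B ≤[ αβ ] A

-- Alternating quantifier prefixes of length n over ℕ.
mutual
  ∃∀ : ∀ n → Pred (Vec ℕ n) 0ℓ → Set
  ∃∀ zero    R = R []
  ∃∀ (suc n) R = ∃[ k ] ∀∃ n (λ ks → R (k ∷ ks))

  ∀∃ : ∀ n → Pred (Vec ℕ n) 0ℓ → Set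
  ∀∃ zero    R = R []
  ∀∃ (suc n) R = ∀ k → ∃∀ n (λ ks → R (k ∷ ks))

-- A computable relation R ⊆ X × ℕ^n is given by an index e of its
-- characteristic function, which must be defined on all of X × ℕ^n.

Decides : ℕ → Space → ℕ → Set
Decides e X n = ∀ x → x ∈ points X → (ks : Vec ℕ n) →
  Run e x ⌜ toList ks ⌝ 0 ⊎ Run e x ⌜ toList ks ⌝ 1

Holds : ℕ → Baire → ∀ {n} → Pred (Vec ℕ n) 0ℓ
Holds e x ks = Run e x ⌜ toList ks ⌝ 1

Pointclass : Set₁
Pointclass = Space → Pred (Pred Baire 0ℓ) 0ℓ

Σ⁰ : ℕ → Pointclass
Σ⁰ n X S = ∃[ e ] Decides e X n ×
  S ≐ (points X ∩ (λ x → ∃∀ n (Holds e x)))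

Π⁰ : ℕ → Pointclass
Π⁰ n X S = ∃[ e ] Decides e X n ×
  S ≐ (points X ∩ (λ x → ∀∃ n (Holds e x)))

SEL : Pointclass → Space → Pred PartialFunction 0ℓ → Set₁
SEL 𝚪 X αβ = ∀ S Q → 𝚪 X S → Π⁰ 1 2^ℕ Q → Satisfiable Q →
  ∃[ P ] Π⁰ 1 2^ℕ P × P ≡[ αβ ] (S ∪ Q)

{-# OPTIONS --safe #-}

-- Programs are run by a universal evaluator whose resource bound also limits the
-- oracle queries, so that its results depend on finite parts of the oracle. All
-- three failures use a nonempty Π⁰₁ set of diagonally noncomputable (DNC)
-- sequences, which has no computable member; a Π⁰₁ set P equivalent to S ∪ Q
-- then has none either.
--
-- If P is Π⁰₁ without computable members, every finite binary string extends to
-- one that forces a given functional out of P: otherwise a chain of extensions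
-- on which the functional converges yields a computable member. So P is not
-- below a dense set S by finitely many functionals. For (1), S consists of the
-- sequences with a DNC tail. For (5), S consists of the finite variants of a
-- limit-computable 1-generic G; a learner that is not forced out of P changes
-- its mind densely, hence infinitely often on a finite variant of G.
--
-- For (3), S = {1⌢G}, which is Π⁰₂ because G is limit computable. G computes no
-- DNC sequence, so from a point of P computed by G some functional leads back to
-- 1⌢G; it is total on a Π⁰₁ subset of P and leads to 1⌢G or into 0⌢DNC there.
-- By compactness G would be computable.
--
-- For (2), let z ∈ P consist of u, v, w, where v looks like a member of Q until
-- the first one of u is seen at some k, and then w belongs to the k-th Π⁰₁ set
-- of S. For (4), z consists of u i and v i for all i; either the positions of the
-- first ones code a member of S with its witnesses, or some u i vanishes and v i
-- belongs to Q. One learner finds the least such i.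

module Submission where

open import Defs
open import Level using (0ℓ; Lift; lift; lower) renaming (suc to lsuc)
open import Axiom.ExcludedMiddle using (ExcludedMiddle)
open import Data.Empty using (⊥)
open import Data.Fin.Base using (Fin; zero; suc)
open import Data.Fin.Patterns using (0F; 1F; 2F; 3F; 4F; 5F)
open import Data.List.Base using (List; []; _∷_; applyUpTo)
open import Data.Nat.Base
open import Data.Nat.Properties
open import Data.Product.Base using (Σ; _×_; _,_; proj₁; proj₂; ∃-syntax; map₂)
open import Data.Sum.Base using (_⊎_; inj₁; inj₂; [_,_]′)
open import Data.Vec.Base using (Vec; []; _∷_; lookup; tabulate; toList)
open import Data.Vec.Properties using (tabulate∘lookup)
open import Function.Base using (_∘_; id; case_of_)
open import Relation.Binary.Definitions using (tri<; tri≈; tri>)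
open import Relation.Binary.PropositionalEquality
open import Relation.Nullary.Decidable.Core using (Dec; yes; no; map′)
open import Relation.Nullary.Negation.Core using (¬_; contradiction)
open import Relation.Unary using (Pred; _∈_; _∉_; _⊆_; _∪_; _∩_; Satisfiable)

-- The obstacle in (2) and (4) is that Q may have no computable member, so a member of S cannot
-- supply a v that lies in Q. But it determines the place k of the first one of u, in (2) after
-- finitely many wrong guesses, and a search then yields a finite string on which the tests of Q up
-- to k have already answered yes. This is why v is released once u shows a one. The way back pays
-- with a limit: no finite part reveals that u has no one at all. By (2), the Σ⁰₂ set that refutes
-- (1) cannot refute (5). A learner may put off its final guess beyond any finite string, so density
-- of S alone does not stop it; the members of S must be generic behind every finite modification,
-- and the finite variants of a limit-computable real form a Σ⁰₃ set. Sets are used through bounded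
-- runs that look for a refutation. These are decidable for every oracle and depend on a finite part
-- of it, whereas `Decides` speaks of completed runs.

-- Inverse laws for the pairing function

next-pair : ∀ a b → ⟨ proj₁ (next (a , b)) , proj₂ (next (a , b)) ⟩ ≡ suc ⟨ a , b ⟩
next-pair zero    b = cong suc (begin
  b + 0 + triangle (b + 0) + 0 ≡⟨ +-identityʳ _ ⟩
  b + 0 + triangle (b + 0)     ≡⟨ cong (λ c → c + triangle c) (+-identityʳ b) ⟩
  b + triangle b               ≡⟨ +-comm b _ ⟩
  triangle b + b               ∎)
  where open ≡-Reasoning
next-pair (suc a) b = trans (+-suc _ b) (cong (λ c → suc (triangle c + b)) (+-suc a b))

pair-unpair : ∀ n → ⟨ π₁ n , π₂ n ⟩ ≡ n
pair-unpair zero    = refl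
pair-unpair (suc n) = trans (next-pair (π₁ n) (π₂ n)) (cong suc (pair-unpair n))

unpair-pair : ∀ a b → unpair ⟨ a , b ⟩ ≡ (a , b)
unpair-pair a b = go _ a b refl
  where
  go : ∀ n a b → ⟨ a , b ⟩ ≡ n → unpair n ≡ (a , b)
  go zero    zero    zero    _ = refl
  go (suc n) zero    zero    ()
  go n       (suc a) zero    eq with n
  ... | zero  = contradiction eq λ ()
  ... | suc n = cong next (go n zero a (suc-injective (trans (sym (next-pair zero a)) eq)))
  go n       a       (suc b) eq with n
  ... | zero  = contradiction (trans (sym (next-pair (suc a) b)) eq) λ ()
  ... | suc n = cong next (go n (suc a) b (suc-injective (trans (sym (next-pair (suc a) b)) eq)))

π₁-pair : ∀ a b → π₁ ⟨ a , b ⟩ ≡ a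
π₁-pair a b = cong proj₁ (unpair-pair a b)

π₂-pair : ∀ a b → π₂ ⟨ a , b ⟩ ≡ b
π₂-pair a b = cong proj₂ (unpair-pair a b)

-- Opaque copies of the pairing functions: pairs with a numeral as first
-- component would otherwise unfold.
opaque
  pr : ℕ → ℕ → ℕ
  pr = ⟨_,_⟩

  fs sn : ℕ → ℕ
  fs = π₁
  sn = π₂

  fs-pr : ∀ a b → fs (pr a b) ≡ a
  fs-pr = π₁-pair

  sn-pr : ∀ a b → sn (pr a b) ≡ b
  sn-pr = π₂-pair

  pr-def : ∀ a b → pr a b ≡ ⟨ a , b ⟩
  pr-def a b = refl

  triangle-mono : ∀ {m n} → m ≤ n → triangle m ≤ triangle n
  triangle-mono z≤n       = z≤n
  triangle-mono (s≤s m≤n) = +-mono-≤ (s≤s m≤n) (triangle-mono m≤n)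

  pr-mono : ∀ {a b c d} → a ≤ c → b ≤ d → pr a b ≤ pr c d
  pr-mono a≤c b≤d = +-mono-≤ (triangle-mono (+-mono-≤ a≤c b≤d)) b≤d

  sn≤pr : ∀ a b → b ≤ pr a b
  sn≤pr a b = m≤n+m b _

-- Big-step semantics of programs

infix 4 _⊢_∶_⇒_

data _⊢_∶_⇒_ (g : Baire) : Code → ℕ → ℕ → Set where
  const0 : ∀ {m} → g ⊢ const0 ∶ m ⇒ 0
  succ   : ∀ {m} → g ⊢ succ ∶ m ⇒ suc m
  left   : ∀ {m} → g ⊢ left ∶ m ⇒ fs m
  right  : ∀ {m} → g ⊢ right ∶ m ⇒ sn m
  oracle : ∀ {m} → g ⊢ oracle ∶ m ⇒ g m
  pair   : ∀ {c d m a b} → g ⊢ c ∶ m ⇒ a → g ⊢ d ∶ m ⇒ b → g ⊢ pair c d ∶ m ⇒ pr a b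
  comp   : ∀ {c d m u v} → g ⊢ d ∶ m ⇒ u → g ⊢ c ∶ u ⇒ v → g ⊢ comp c d ∶ m ⇒ v
  prec-z : ∀ {c d a v} → g ⊢ c ∶ a ⇒ v → g ⊢ prec c d ∶ pr a 0 ⇒ v
  prec-s : ∀ {c d a n u v} → g ⊢ prec c d ∶ pr a n ⇒ u → g ⊢ d ∶ pr a (pr n u) ⇒ v →
           g ⊢ prec c d ∶ pr a (suc n) ⇒ v
  mu     : ∀ {c m v} → g ⊢ c ∶ pr m v ⇒ 0 →
           (∀ k → k < v → ∃[ u ] g ⊢ c ∶ pr m k ⇒ suc u) → g ⊢ mu c ∶ m ⇒ v

opaque
  unfolding pr

  ⟦⟧⇒⊢ : ∀ {g} c {m v} → ⟦ c ⟧ g m v → g ⊢ c ∶ m ⇒ v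
  ⟦⟧⇒⊢ const0     refl = const0
  ⟦⟧⇒⊢ succ       refl = succ
  ⟦⟧⇒⊢ left       refl = left
  ⟦⟧⇒⊢ right      refl = right
  ⟦⟧⇒⊢ oracle     refl = oracle
  ⟦⟧⇒⊢ (pair c d) (a , b , r , s , refl) = pair (⟦⟧⇒⊢ c r) (⟦⟧⇒⊢ d s)
  ⟦⟧⇒⊢ (comp c d) (u , r , s) = comp (⟦⟧⇒⊢ d r) (⟦⟧⇒⊢ c s)
  ⟦⟧⇒⊢ {g} (prec c d) {m} {v} r =
    subst (λ m → g ⊢ prec c d ∶ m ⇒ v) (pair-unpair m) (go (π₁ m) (π₂ m) r)
    where
    go : ∀ a n {v} → primRec (⟦ c ⟧ g) (⟦ d ⟧ g) a n v → g ⊢ prec c d ∶ pr a n ⇒ v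
    go a zero    r           = prec-z {a = a} (⟦⟧⇒⊢ c r)
    go a (suc n) (u , r , s) = prec-s {a = a} (go a n r) (⟦⟧⇒⊢ d s)
  ⟦⟧⇒⊢ (mu c)     (r , s) = mu (⟦⟧⇒⊢ c r) λ k k<v → map₂ (⟦⟧⇒⊢ c) (s k k<v)

  ⊢⇒⟦⟧ : ∀ {g c m v} → g ⊢ c ∶ m ⇒ v → ⟦ c ⟧ g m v
  ⊢⇒⟦⟧ const0     = refl
  ⊢⇒⟦⟧ succ       = refl
  ⊢⇒⟦⟧ left       = refl
  ⊢⇒⟦⟧ right      = refl
  ⊢⇒⟦⟧ oracle     = refl
  ⊢⇒⟦⟧ (pair r s) = _ , _ , ⊢⇒⟦⟧ r , ⊢⇒⟦⟧ s , refl
  ⊢⇒⟦⟧ (comp r s) = _ , ⊢⇒⟦⟧ r , ⊢⇒⟦⟧ s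
  ⊢⇒⟦⟧ {g} (prec-z {c} {d} {a} {v} r) =
    subst (λ q → primRec (⟦ c ⟧ g) (⟦ d ⟧ g) (proj₁ q) (proj₂ q) v) (sym (unpair-pair a 0)) (⊢⇒⟦⟧ r)
  ⊢⇒⟦⟧ {g} (prec-s {c} {d} {a} {n} {u} {v} r s) =
    subst (λ q → primRec (⟦ c ⟧ g) (⟦ d ⟧ g) (proj₁ q) (proj₂ q) v) (sym (unpair-pair a (suc n)))
      (u , subst (λ q → primRec (⟦ c ⟧ g) (⟦ d ⟧ g) (proj₁ q) (proj₂ q) u) (unpair-pair a n) (⊢⇒⟦⟧ r) ,
       ⊢⇒⟦⟧ s)
  ⊢⇒⟦⟧ (mu r s)   = ⊢⇒⟦⟧ r , λ k k<v → map₂ ⊢⇒⟦⟧ (s k k<v)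

  pr-η : ∀ m → pr (fs m) (sn m) ≡ m
  pr-η = pair-unpair

to : ∀ {g c m v v′} → v ≡ v′ → g ⊢ c ∶ m ⇒ v → g ⊢ c ∶ m ⇒ v′
to refl r = r

left-pr : ∀ {g a b} → g ⊢ left ∶ pr a b ⇒ a
left-pr = to (fs-pr _ _) left

right-pr : ∀ {g a b} → g ⊢ right ∶ pr a b ⇒ b
right-pr = to (sn-pr _ _) right

idCode : Code
idCode = pair left right

run-id : ∀ {g m} → g ⊢ idCode ∶ m ⇒ m
run-id {m = m} = to (pr-η m) (pair left right)

assoc : Code
assoc = pair (comp left left) (pair (comp right left) right)

run-assoc : ∀ {g p a q} → g ⊢ assoc ∶ pr (pr p a) q ⇒ pr p (pr a q)
run-assoc = pair (comp left-pr left-pr) (pair (comp left-pr right-pr) right-pr)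

-- sub h c runs c on the second component of its input, with h (applied to the
-- first component and the query) in place of the oracle.
sub : Code → Code → Code
sub h const0     = const0
sub h succ       = comp succ right
sub h left       = comp left right
sub h right      = comp right right
sub h oracle     = h
sub h (pair c d) = pair (sub h c) (sub h d)
sub h (comp c d) = comp (sub h c) (pair left (sub h d))
sub h (prec c d) = comp (prec (sub h c) (comp (sub h d) assoc))
                        (pair (pair left (comp left right)) (comp right right))
sub h (mu c)     = mu (comp (sub h c) assoc)

run-sub : ∀ {g y h p} → (∀ k → g ⊢ h ∶ pr p k ⇒ y k) →
  ∀ {c m v} → y ⊢ c ∶ m ⇒ v → g ⊢ sub h c ∶ pr p m ⇒ v
run-sub {g} {y} {h} {p} run-h = go
  where
  go : ∀ {c m v} → y ⊢ c ∶ m ⇒ v → g ⊢ sub h c ∶ pr p m ⇒ v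

  -- The parameter `p` has to survive the recursion, so it is grouped with the recursion parameter;
  -- `assoc` restores the grouping that `sub h d` expects.
  spread : ∀ {m} → g ⊢ _ ∶ pr p m ⇒ pr (pr p (fs m)) (sn m)
  spread = pair (pair left-pr (comp right-pr left)) (comp right-pr right)

  go-rec : ∀ {c d m v} → y ⊢ prec c d ∶ m ⇒ v →
    g ⊢ prec (sub h c) (comp (sub h d) assoc) ∶ pr (pr p (fs m)) (sn m) ⇒ v
  go-rec (prec-z {a = a} r) rewrite fs-pr a 0 | sn-pr a 0 = prec-z (go r)
  go-rec (prec-s {a = a} {n} {u} r s) rewrite fs-pr a (suc n) | sn-pr a (suc n) =
    prec-s (subst₂ (λ a n → g ⊢ _ ∶ pr (pr p a) n ⇒ u) (fs-pr a n) (sn-pr a n) (go-rec r))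
      (comp run-assoc (go s))

  go const0     = const0
  go succ       = comp right-pr succ
  go left       = comp right-pr left
  go right      = comp right-pr right
  go oracle     = run-h _
  go (pair r s) = pair (go r) (go s)
  go (comp r s) = comp (pair left-pr (go r)) (go s)
  go r@(prec-z _)   = comp spread (go-rec r)
  go r@(prec-s _ _) = comp spread (go-rec r)
  go (mu r s)   = mu (comp run-assoc (go r)) λ k k<v →
                    case s k k<v of λ (u , t) → u , comp run-assoc (go t)

-- Total computable functionals

enc : ∀ {n} → Vec ℕ n → ℕ
enc []      = 0
enc (x ∷ ρ) = pr x (enc ρ)

record Computable {n} (f : Baire → Vec ℕ n → ℕ) : Set where
  constructor computable
  field
    code    : Code
    correct : ∀ {g} ρ → g ⊢ code ∶ enc ρ ⇒ f g ρ

open Computable public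

recur : ℕ → (ℕ → ℕ → ℕ) → ℕ → ℕ
recur b f zero    = b
recur b f (suc n) = f n (recur b f n)

ifz_then_else_ : ℕ → ℕ → ℕ → ℕ
ifz zero  then a else b = a
ifz suc _ then a else b = b

-- Terms denote total functionals only, so a proof of computability amounts to exhibiting a term.
-- `inst` and `withOracle` substitute for the variables and for the oracle without expanding the
-- inner term.
data Term (n : ℕ) : Set where
  var     : Fin n → Term n
  lit     : ℕ → Term n
  sucT    : Term n → Term n
  prT     : Term n → Term n → Term n
  fsT snT : Term n → Term n
  query   : Term n → Term n
  rec     : Term n → Term (2 + n) → Term n → Term n
  ifz     : Term n → Term n → Term n → Term n
  app     : ∀ {k} {f : Baire → Vec ℕ k → ℕ} → Computable f → Vec (Term n) k → Term n
  inst    : ∀ {k} → Term k → Vec (Term n) k → Term n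
  withOracle : Term (suc n) → Term n → Term n

mutual
  eval : ∀ {n} → Term n → Baire → Vec ℕ n → ℕ
  eval (var i)     g ρ = lookup ρ i
  eval (lit k)     g ρ = k
  eval (sucT t)    g ρ = suc (eval t g ρ)
  eval (prT t u)   g ρ = pr (eval t g ρ) (eval u g ρ)
  eval (fsT t)     g ρ = fs (eval t g ρ)
  eval (snT t)     g ρ = sn (eval t g ρ)
  eval (query t)   g ρ = g (eval t g ρ)
  eval (rec b s t) g ρ = recur (eval b g ρ) (λ i u → eval s g (i ∷ u ∷ ρ)) (eval t g ρ)
  eval (ifz t a b) g ρ = ifz eval t g ρ then eval a g ρ else eval b g ρ
  eval (app {f = f} F ts) g ρ = f g (evals ts g ρ)
  eval (inst t ts)  g ρ = eval t g (evals ts g ρ)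
  eval (withOracle q t) g ρ = eval t (λ m → eval q g (m ∷ ρ)) ρ

  evals : ∀ {n k} → Vec (Term n) k → Baire → Vec ℕ n → Vec ℕ k
  evals []       g ρ = []
  evals (t ∷ ts) g ρ = eval t g ρ ∷ evals ts g ρ

litCode : ℕ → Code
litCode zero    = const0
litCode (suc k) = comp succ (litCode k)

run-lit : ∀ k {g m} → g ⊢ litCode k ∶ m ⇒ k
run-lit zero    = const0
run-lit (suc k) = comp (run-lit k) succ

varCode : ∀ {n} → Fin n → Code
varCode zero    = left
varCode (suc i) = comp (varCode i) right

run-var : ∀ {n} (i : Fin n) {g} ρ → g ⊢ varCode i ∶ enc ρ ⇒ lookup ρ i
run-var zero    (x ∷ ρ) = left-pr
run-var (suc i) (x ∷ ρ) = comp right-pr (run-var i ρ)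

mutual
  compile : ∀ {n} → Term n → Code
  compile (var i)     = varCode i
  compile (lit k)     = litCode k
  compile (sucT t)    = comp succ (compile t)
  compile (prT t u)   = pair (compile t) (compile u)
  compile (fsT t)     = comp left (compile t)
  compile (snT t)     = comp right (compile t)
  compile (query t)   = comp oracle (compile t)
  compile (rec b s t) =
    comp (prec (compile b) (comp (compile s) (pair (comp left right) (pair (comp right right) left))))
         (pair idCode (compile t))
  compile (ifz t a b) = comp (prec (compile a) (comp (compile b) left)) (pair idCode (compile t))
  compile (app F ts)  = comp (code F) (compiles ts)
  compile (inst t ts)  = comp (compile t) (compiles ts)
  compile (withOracle q t) =
    comp (sub (comp (compile q) (pair right left)) (compile t)) (pair idCode idCode)

  compiles : ∀ {n k} → Vec (Term n) k → Code
  compiles []       = const0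
  compiles (t ∷ ts) = pair (compile t) (compiles ts)

mutual
  run-compile : ∀ {n} (t : Term n) {g} ρ → g ⊢ compile t ∶ enc ρ ⇒ eval t g ρ
  run-compile (var i)     ρ = run-var i ρ
  run-compile (lit k)     ρ = run-lit k
  run-compile (sucT t)    ρ = comp (run-compile t ρ) succ
  run-compile (prT t u)   ρ = pair (run-compile t ρ) (run-compile u ρ)
  run-compile (fsT t)     ρ = comp (run-compile t ρ) left
  run-compile (snT t)     ρ = comp (run-compile t ρ) right
  run-compile (query t)   ρ = comp (run-compile t ρ) oracle
  run-compile (rec b s t) {g} ρ = comp (pair run-id (run-compile t ρ)) (go (eval t g ρ))
    where
    go : ∀ n → g ⊢ prec (compile b) (comp (compile s) _) ∶ pr (enc ρ) n
                 ⇒ recur (eval b g ρ) (λ i u → eval s g (i ∷ u ∷ ρ)) n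
    go zero    = prec-z (run-compile b ρ)
    go (suc n) = prec-s (go n)
      (comp (pair (comp right-pr left-pr) (pair (comp right-pr right-pr) left-pr))
        (run-compile s (n ∷ _ ∷ ρ)))
  run-compile (ifz t a b) {g} ρ = comp (pair run-id (run-compile t ρ)) (go (eval t g ρ))
    where
    go : ∀ n → g ⊢ prec (compile a) (comp (compile b) left) ∶ pr (enc ρ) n
                 ⇒ (ifz n then eval a g ρ else eval b g ρ)
    go zero    = prec-z (run-compile a ρ)
    go (suc n) = prec-s (go n) (comp left-pr (run-compile b ρ))
  run-compile (app F ts)  {g} ρ = comp (run-compiles ts ρ) (correct F (evals ts g ρ))
  run-compile (inst t ts)  {g} ρ = comp (run-compiles ts ρ) (run-compile t (evals ts g ρ))
  run-compile (withOracle q t) ρ = comp (pair run-id run-id)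
    (run-sub (λ k → comp (pair right-pr left-pr) (run-compile q (k ∷ ρ))) (run-compile t ρ))

  run-compiles : ∀ {n k} (ts : Vec (Term n) k) {g} ρ → g ⊢ compiles ts ∶ enc ρ ⇒ enc (evals ts g ρ)
  run-compiles []       ρ = const0
  run-compiles (t ∷ ts) ρ = pair (run-compile t ρ) (run-compiles ts ρ)

opaque
  -- Opaque because compiled programs are large and only their correctness matters.
  by-term : ∀ {n} {f : Baire → Vec ℕ n → ℕ} (t : Term n) → (∀ g ρ → eval t g ρ ≡ f g ρ) → Computable f
  by-term t eq = computable (compile t) λ {g} ρ → to (eq g ρ) (run-compile t ρ)

predecessor : Baire → Vec ℕ 1 → ℕ
predecessor g (a ∷ []) = pred a

predecessor-computable : Computable predecessor
predecessor-computable = by-term (rec (lit 0) (var 0F) (var 0F))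
  λ { g (zero ∷ []) → refl ; g (suc a ∷ []) → refl }

predT : ∀ {n} → Term n → Term n
predT t = app predecessor-computable (t ∷ [])

plus monus : Baire → Vec ℕ 2 → ℕ
plus  g (a ∷ b ∷ []) = a + b
monus g (a ∷ b ∷ []) = a ∸ b

plus-computable : Computable plus
plus-computable = by-term (rec (var 1F) (sucT (var 1F)) (var 0F)) λ { g (a ∷ b ∷ []) → go a b }
  where
  go : ∀ a b → recur b (λ _ → suc) a ≡ a + b
  go zero    b = refl
  go (suc a) b = cong suc (go a b)

monus-computable : Computable monus
monus-computable = by-term (rec (var 0F) (predT (var 1F)) (var 1F)) λ { g (a ∷ b ∷ []) → go a b }
  where
  go : ∀ a b → recur a (λ _ → pred) b ≡ a ∸ b
  go a zero    = refl
  go a (suc b) = trans (cong pred (go a b)) (pred[m∸n]≡m∸[1+n] a b)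

infixl 26 _+ᵀ_ _∸ᵀ_

_+ᵀ_ _∸ᵀ_ : ∀ {n} → Term n → Term n → Term n
a +ᵀ b = app plus-computable (a ∷ b ∷ [])
a ∸ᵀ b = app monus-computable (a ∷ b ∷ [])

weaken : ∀ {n k} → (Fin n → Fin k) → Term n → Term k
weaken r t = inst t (tabulate (var ∘ r))

evals-vars : ∀ {n k} (r : Fin n → Fin k) g ρ → evals (tabulate (var ∘ r)) g ρ ≡ tabulate (lookup ρ ∘ r)
evals-vars {zero}  r g ρ = refl
evals-vars {suc n} r g ρ = cong (_ ∷_) (evals-vars (r ∘ suc) g ρ)

eval-weaken : ∀ {n k} (r : Fin n → Fin k) t g ρ → eval (weaken r t) g ρ ≡ eval t g (tabulate (lookup ρ ∘ r))
eval-weaken r t g ρ = cong (eval t g) (evals-vars r g ρ)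

-- firstBelow p n is i + 1 for the first i < n with p i ≢ 0, and 0 if there is none.
firstBelow : (ℕ → ℕ) → ℕ → ℕ
firstBelow p = recur 0 λ i u → ifz u then (ifz p i then 0 else suc i) else u

-- In the step of `rec` the accumulator occupies position 1; this renaming moves a predicate that
-- knows nothing of the accumulator past it.
skip : ∀ {n} → Fin (suc n) → Fin (2 + n)
skip zero    = zero
skip (suc i) = suc (suc i)

firstT : ∀ {n} → Term (suc n) → Term n → Term n
firstT p = rec (lit 0) (ifz (var 1F) (ifz (weaken skip p) (lit 0) (sucT (var 0F))) (var 1F))

recur-cong : ∀ b {f f′} → (∀ i u → f i u ≡ f′ i u) → ∀ n → recur b f n ≡ recur b f′ n
recur-cong b eq zero    = refl
recur-cong b {f} eq (suc n) = trans (cong (f n) (recur-cong b eq n)) (eq n _)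

eval-firstT : ∀ {n} p t g (ρ : Vec ℕ n) →
  eval (firstT p t) g ρ ≡ firstBelow (λ i → eval p g (i ∷ ρ)) (eval t g ρ)
eval-firstT p t g ρ = recur-cong 0
  (λ i u → cong (λ v → ifz u then (ifz v then 0 else suc i) else u)
    (trans (eval-weaken skip p g (i ∷ u ∷ ρ))
      (cong (λ ρ → eval p g (i ∷ ρ)) (tabulate∘lookup ρ)))) (eval t g ρ)

firstBelow-none : ∀ p n → firstBelow p n ≡ 0 → ∀ i → i < n → p i ≡ 0
firstBelow-none p (suc n) eq i (s≤s i≤n) with firstBelow p n in eq₁ | p n in eq₂ | m≤n⇒m<n∨m≡n i≤n
... | zero | zero | inj₁ i<n  = firstBelow-none p n eq₁ i i<n
... | zero | zero | inj₂ refl = eq₂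

firstBelow-none⁻¹ : ∀ p n → (∀ i → i < n → p i ≡ 0) → firstBelow p n ≡ 0
firstBelow-none⁻¹ p zero    h = refl
firstBelow-none⁻¹ p (suc n) h rewrite firstBelow-none⁻¹ p n (λ i → h i ∘ m<n⇒m<1+n) | h n ≤-refl = refl

firstBelow-some : ∀ p n {i} → firstBelow p n ≡ suc i → i < n × p i ≢ 0 × (∀ j → j < i → p j ≡ 0)
firstBelow-some p (suc n) eq with firstBelow p n in eq₁ | p n in eq₂
firstBelow-some p (suc n) refl | zero  | suc _ =
  n<1+n n , (λ e → contradiction (trans (sym eq₂) e) λ ()) , firstBelow-none p n eq₁
firstBelow-some p (suc n) refl | suc i | _     =
  let i<n , rest = firstBelow-some p n eq₁ in m<n⇒m<1+n i<n , rest

firstBelow-some⁻¹ : ∀ p n {i} → i < n → p i ≢ 0 → (∀ j → j < i → p j ≡ 0) → firstBelow p n ≡ suc i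
firstBelow-some⁻¹ p (suc n) {i} (s≤s i≤n) pi h with m≤n⇒m<n∨m≡n i≤n
... | inj₁ i<n  rewrite firstBelow-some⁻¹ p n i<n pi h = refl
... | inj₂ refl rewrite firstBelow-none⁻¹ p n h with p n
...   | zero  = contradiction refl pi
...   | suc _ = refl

-- Decidable formulas

infix  5 _≈̇_ _<̇_
infix  4 ¬̇_
infixr 3 _∧̇_
infixr 2 _∨̇_
infixr 1 _⇒̇_

data Form (n : ℕ) : Set where
  _≈̇_ _<̇_      : Term n → Term n → Form n
  ¬̇_           : Form n → Form n
  _∧̇_ _∨̇_ _⇒̇_ : Form n → Form n → Form n
  ∀̇< ∃̇<       : Term n → Form (suc n) → Form n

⊨ : ∀ {n} → Form n → Baire → Vec ℕ n → Set
⊨ (a ≈̇ b)  g ρ = eval a g ρ ≡ eval b g ρ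
⊨ (a <̇ b)  g ρ = eval a g ρ < eval b g ρ
⊨ (¬̇ φ)    g ρ = ¬ ⊨ φ g ρ
⊨ (φ ∧̇ ψ)  g ρ = ⊨ φ g ρ × ⊨ ψ g ρ
⊨ (φ ∨̇ ψ)  g ρ = ⊨ φ g ρ ⊎ ⊨ ψ g ρ
⊨ (φ ⇒̇ ψ)  g ρ = ⊨ φ g ρ → ⊨ ψ g ρ
⊨ (∀̇< t φ) g ρ = ∀ i → i < eval t g ρ → ⊨ φ g (i ∷ ρ)
⊨ (∃̇< t φ) g ρ = ∃[ i ] i < eval t g ρ × ⊨ φ g (i ∷ ρ)

decide : ∀ {n} → Form n → Term n
decide (a ≈̇ b)  = ifz (a ∸ᵀ b) (ifz (b ∸ᵀ a) (lit 1) (lit 0)) (lit 0)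
decide (a <̇ b)  = ifz (b ∸ᵀ a) (lit 0) (lit 1)
decide (¬̇ φ)    = ifz (decide φ) (lit 1) (lit 0)
decide (φ ∧̇ ψ)  = ifz (decide φ) (lit 0) (decide ψ)
decide (φ ∨̇ ψ)  = ifz (decide φ) (decide ψ) (lit 1)
decide (φ ⇒̇ ψ)  = ifz (decide φ) (lit 1) (decide ψ)
decide (∀̇< t φ) = ifz (firstT (ifz (decide φ) (lit 1) (lit 0)) t) (lit 1) (lit 0)
decide (∃̇< t φ) = ifz (firstT (decide φ) t) (lit 0) (lit 1)

-- The value comes with evidence for one side, so formulas are decided constructively, before
-- excluded middle is assumed.
Char : Set → ℕ → Set
Char A v = (A × v ≡ 1) ⊎ (¬ A × v ≡ 0)

char-¬ : ∀ {A v} → Char A v → Char (¬ A) (ifz v then 1 else 0)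
char-¬ (inj₁ (a , refl))  = inj₂ ((λ ¬a → ¬a a) , refl)
char-¬ (inj₂ (¬a , refl)) = inj₁ (¬a , refl)

char-∃ : ∀ {P : ℕ → Set} {p} → (∀ i → Char (P i) (p i)) → ∀ n →
  Char (∃[ i ] i < n × P i) (ifz firstBelow p n then 0 else 1)
char-∃ {P} {p} c n with firstBelow p n in eq
... | zero  = inj₂ ((λ (i , i<n , Pi) → case c i of λ where
    (inj₁ (_ , eq₁)) → contradiction (trans (sym eq₁) (firstBelow-none p n eq i i<n)) λ ()
    (inj₂ (¬Pi , _)) → ¬Pi Pi) , refl)
... | suc i = let i<n , pi≢0 , _ = firstBelow-some p n eq in case c i of λ where
    (inj₁ (Pi , _))   → inj₁ ((i , i<n , Pi) , refl)
    (inj₂ (_ , pi≡0)) → contradiction pi≡0 pi≢0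

decide-char : ∀ {n} (φ : Form n) g ρ → Char (⊨ φ g ρ) (eval (decide φ) g ρ)
decide-char (a ≈̇ b) g ρ with eval a g ρ | eval b g ρ
... | x | y with x ∸ y in eq₁ | y ∸ x in eq₂
...   | zero  | zero  = inj₁ (≤-antisym (m∸n≡0⇒m≤n eq₁) (m∸n≡0⇒m≤n eq₂) , refl)
...   | zero  | suc _ = inj₂ ((λ x≡y → 1+n≢0 (trans (sym eq₂) (m≤n⇒m∸n≡0 (≤-reflexive (sym x≡y))))) , refl)
...   | suc _ | _     = inj₂ ((λ x≡y → 1+n≢0 (trans (sym eq₁) (m≤n⇒m∸n≡0 (≤-reflexive x≡y)))) , refl)
decide-char (a <̇ b) g ρ with eval a g ρ | eval b g ρ
... | x | y with y ∸ x in eq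
...   | zero  = inj₂ (≤⇒≯ (m∸n≡0⇒m≤n eq) , refl)
...   | suc _ = inj₁ (≰⇒> (λ y≤x → contradiction (trans (sym eq) (m≤n⇒m∸n≡0 y≤x)) λ ()) , refl)
decide-char (¬̇ φ)   g ρ = char-¬ (decide-char φ g ρ)
decide-char (φ ∧̇ ψ) g ρ with eval (decide φ) g ρ | decide-char φ g ρ
... | _ | inj₂ (¬a , refl) = inj₂ (¬a ∘ proj₁ , refl)
... | _ | inj₁ (a , refl) with decide-char ψ g ρ
...   | inj₁ (b , eq)  = inj₁ ((a , b) , eq)
...   | inj₂ (¬b , eq) = inj₂ (¬b ∘ proj₂ , eq)
decide-char (φ ∨̇ ψ) g ρ with eval (decide φ) g ρ | decide-char φ g ρ
... | _ | inj₁ (a , refl) = inj₁ (inj₁ a , refl)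
... | _ | inj₂ (¬a , refl) with decide-char ψ g ρ
...   | inj₁ (b , eq)  = inj₁ (inj₂ b , eq)
...   | inj₂ (¬b , eq) = inj₂ ([ ¬a , ¬b ]′ , eq)
decide-char (φ ⇒̇ ψ) g ρ with eval (decide φ) g ρ | decide-char φ g ρ
... | _ | inj₂ (¬a , refl) = inj₁ ((λ a → contradiction a ¬a) , refl)
... | _ | inj₁ (a , refl) with decide-char ψ g ρ
...   | inj₁ (b , eq)  = inj₁ ((λ _ → b) , eq)
...   | inj₂ (¬b , eq) = inj₂ ((λ f → ¬b (f a)) , eq)
decide-char (∀̇< t φ) g ρ
  rewrite eval-firstT (ifz (decide φ) (lit 1) (lit 0)) t g ρ
  with firstBelow (λ i → eval (ifz (decide φ) (lit 1) (lit 0)) g (i ∷ ρ)) (eval t g ρ)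
     | char-∃ {λ i → ¬ ⊨ φ g (i ∷ ρ)} (λ i → char-¬ (decide-char φ g (i ∷ ρ))) (eval t g ρ)
... | suc _ | inj₁ ((i , i<n , ¬φ) , _) = inj₂ ((λ h → ¬φ (h i i<n)) , refl)
... | zero  | inj₂ (¬∃ , _) = inj₁ ((λ i i<n → case decide-char φ g (i ∷ ρ) of λ where
    (inj₁ (a , _))  → a
    (inj₂ (¬a , _)) → contradiction (i , i<n , ¬a) ¬∃) , refl)
decide-char (∃̇< t φ) g ρ rewrite eval-firstT (decide φ) t g ρ =
  char-∃ (λ i → decide-char φ g (i ∷ ρ)) (eval t g ρ)

decide-yes : ∀ {n} (φ : Form n) {g ρ} → ⊨ φ g ρ → eval (decide φ) g ρ ≡ 1
decide-yes φ {g} {ρ} h with decide-char φ g ρ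
... | inj₁ (_ , eq) = eq
... | inj₂ (¬h , _) = contradiction h ¬h

decide-no : ∀ {n} (φ : Form n) {g ρ} → ¬ ⊨ φ g ρ → eval (decide φ) g ρ ≡ 0
decide-no φ {g} {ρ} ¬h with decide-char φ g ρ
... | inj₁ (h , _)  = contradiction h ¬h
... | inj₂ (_ , eq) = eq

decide-yes⁻¹ : ∀ {n} (φ : Form n) {g ρ} → eval (decide φ) g ρ ≢ 0 → ⊨ φ g ρ
decide-yes⁻¹ φ {g} {ρ} ≢0 with decide-char φ g ρ
... | inj₁ (h , _)  = h
... | inj₂ (_ , eq) = contradiction eq ≢0

decide-no⁻¹ : ∀ {n} (φ : Form n) {g ρ} → eval (decide φ) g ρ ≡ 0 → ¬ ⊨ φ g ρ
decide-no⁻¹ φ {g} {ρ} ≡0 h = contradiction (trans (sym (decide-yes φ h)) ≡0) λ ()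

-- Unbounded search

-- `mu` stops at the value 0 and passes the candidate as second component, whereas an environment
-- has it in front; hence the negated test and the swap.
searchCode : ∀ {n} → Form (suc n) → Code
searchCode φ = mu (comp (compile (ifz (decide φ) (lit 1) (lit 0))) (pair right left))

module _ {n} (φ : Form (suc n)) {g : Baire} {ρ : Vec ℕ n} where

  run-test : ∀ k → g ⊢ comp (compile (ifz (decide φ) (lit 1) (lit 0))) (pair right left) ∶ pr (enc ρ) k
               ⇒ (ifz eval (decide φ) g (k ∷ ρ) then 1 else 0)
  run-test k = comp (pair right-pr left-pr) (run-compile (ifz (decide φ) (lit 1) (lit 0)) (k ∷ ρ))

  run-search : ∀ {v} → ⊨ φ g (v ∷ ρ) → (∀ k → k < v → ¬ ⊨ φ g (k ∷ ρ)) → g ⊢ searchCode φ ∶ enc ρ ⇒ v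
  run-search {v} h below = mu (to (cong (λ u → ifz u then 1 else 0) (decide-yes φ h)) (run-test v))
    λ k k<v → 0 , to (cong (λ u → ifz u then 1 else 0) (decide-no φ (below k k<v))) (run-test k)

  run-search⁻¹ : ∀ {v} → ⊨ φ g (v ∷ ρ) → ∃[ u ] ⊨ φ g (u ∷ ρ) × g ⊢ searchCode φ ∶ enc ρ ⇒ u
  run-search⁻¹ {v} h with firstBelow (λ i → eval (decide φ) g (i ∷ ρ)) (suc v) in eq
  ... | zero  = contradiction h (decide-no⁻¹ φ (firstBelow-none _ (suc v) eq v (n<1+n v)))
  ... | suc u = let _ , hit , below = firstBelow-some _ (suc v) eq in
    u , decide-yes⁻¹ φ hit , run-search (decide-yes⁻¹ φ hit) λ k k<u → decide-no⁻¹ φ (below k k<u)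

-- A universal evaluator: a stack machine whose states are coded as numbers

evalState retState : ℕ → ℕ → ℕ
evalState em K = pr 0 (pr em K)
retState v K   = pr 1 (pr v K)

push : ℕ → ℕ → ℕ
push f K = suc (pr f K)

-- Starts the program with tag t and body b (and code e) on input m; a is the
-- oracle's answer to m.
evalTag : (t b e m K a : ℕ) → ℕ
evalTag 0 b e m K a = retState 0 K
evalTag 1 b e m K a = retState (suc m) K
evalTag 2 b e m K a = retState (fs m) K
evalTag 3 b e m K a = retState (sn m) K
evalTag 4 b e m K a = retState a K
evalTag 5 b e m K a = evalState (pr (fs b) m) (push (pr 0 (pr (sn b) m)) K)
evalTag 6 b e m K a = evalState (pr (sn b) m) (push (pr 1 (fs b)) K)
evalTag 7 b e m K a =
  ifz sn m then evalState (pr (fs b) (fs m)) K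
  else evalState (pr e (pr (fs m) (pred (sn m))))
         (push (pr 2 (pr (sn b) (pr (fs m) (pred (sn m))))) K)
evalTag 8 b e m K a = evalState (pr b (pr m 0)) (push (pr 3 (pr b (pr m 0))) K)
evalTag _ b e m K a = evalState (pr e m) K

-- The tag tells what waits for `v`: 0 the right half of a pair, 1 the outer program of a
-- composition, 2 a recursion step, 3 a search, anything else a pair whose left half is done.
retTag : (t b v K : ℕ) → ℕ
retTag 0 b v K = evalState b (push (pr 4 v) K)
retTag 1 b v K = evalState (pr b v) K
retTag 2 b v K = evalState (pr (fs b) (pr (fs (sn b)) (pr (sn (sn b)) v))) K
retTag 3 b v K =
  ifz v then retState (sn (sn b)) K
  else evalState (pr (fs b) (pr (fs (sn b)) (suc (sn (sn b)))))
         (push (pr 3 (pr (fs b) (pr (fs (sn b)) (suc (sn (sn b)))))) K)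
retTag _ b v K = retState (pr b v) K

evalStep : (em K a : ℕ) → ℕ
evalStep em K a = evalTag (fs (fs em)) (sn (fs em)) (fs em) (sn em) K a

retStep : (st v K : ℕ) → ℕ
retStep st v zero    = st
retStep st v (suc f) = retTag (fs (fs f)) (sn (fs f)) v (sn f)

advance : ℕ → ℕ → ℕ
advance st a =
  ifz fs st then evalStep (fs (sn st)) (sn (sn st)) a
  else retStep st (fs (sn st)) (sn (sn st))

queryTag : ℕ → ℕ → ℕ
queryTag 4 m = suc m
queryTag _ m = 0

-- m + 1 if the machine is about to query the oracle at m, and 0 otherwise.
pending : ℕ → ℕ
pending st = ifz fs st then queryTag (fs (fs (fs (sn st)))) (sn (fs (sn st))) else 0

result : ℕ → ℕ
result st = ifz fs st then 0 else (ifz sn (sn st) then suc (fs (sn st)) else 0)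

-- The machine blocks at queries that are not below B.
step : ℕ → Baire → ℕ → ℕ
step B g st =
  ifz pending st ∸ B then advance st (ifz pending st then 0 else g (pred (pending st))) else st

run : ℕ → Baire → ℕ → ℕ → ℕ
run B g n st = recur st (λ _ → step B g) n

-- The result, plus one, of the program with index e within the resource bound
-- s; zero if there is none.
opaque
  E : Baire → ℕ → ℕ → ℕ → ℕ
  E g s e m = result (run s g s (evalState (pr e m) 0))

switch : ∀ {n k} → Term n → Vec (Term n) k → Term n → Term n
switch t []       d = d
switch t (a ∷ as) d = ifz t a (switch (predT t) as d)

evalStateT retStateT pushT : ∀ {n} → Term n → Term n → Term n
evalStateT em K = prT (lit 0) (prT em K)
retStateT v K   = prT (lit 1) (prT v K)
pushT f K       = sucT (prT f K)

evalTag-computable : Computable λ { g (t ∷ b ∷ e ∷ m ∷ K ∷ a ∷ []) → evalTag t b e m K a }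
evalTag-computable = by-term
  (switch (var 0F)
    ( retStateT (lit 0) K
    ∷ retStateT (sucT m) K
    ∷ retStateT (fsT m) K
    ∷ retStateT (snT m) K
    ∷ retStateT (var 5F) K
    ∷ evalStateT (prT (fsT b) m) (pushT (prT (lit 0) (prT (snT b) m)) K)
    ∷ evalStateT (prT (snT b) m) (pushT (prT (lit 1) (fsT b)) K)
    ∷ ifz (snT m) (evalStateT (prT (fsT b) (fsT m)) K)
        (evalStateT (prT e (prT (fsT m) (predT (snT m))))
          (pushT (prT (lit 2) (prT (snT b) (prT (fsT m) (predT (snT m))))) K))
    ∷ evalStateT (prT b (prT m (lit 0))) (pushT (prT (lit 3) (prT b (prT m (lit 0)))) K)
    ∷ [])
    (evalStateT (prT e m) K))
  λ { g (0 ∷ _ ∷ _ ∷ _ ∷ _ ∷ _ ∷ []) → refl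
    ; g (1 ∷ _ ∷ _ ∷ _ ∷ _ ∷ _ ∷ []) → refl
    ; g (2 ∷ _ ∷ _ ∷ _ ∷ _ ∷ _ ∷ []) → refl
    ; g (3 ∷ _ ∷ _ ∷ _ ∷ _ ∷ _ ∷ []) → refl
    ; g (4 ∷ _ ∷ _ ∷ _ ∷ _ ∷ _ ∷ []) → refl
    ; g (5 ∷ _ ∷ _ ∷ _ ∷ _ ∷ _ ∷ []) → refl
    ; g (6 ∷ _ ∷ _ ∷ _ ∷ _ ∷ _ ∷ []) → refl
    ; g (7 ∷ _ ∷ _ ∷ _ ∷ _ ∷ _ ∷ []) → refl
    ; g (8 ∷ _ ∷ _ ∷ _ ∷ _ ∷ _ ∷ []) → refl
    ; g (suc (suc (suc (suc (suc (suc (suc (suc (suc _)))))))) ∷ _ ∷ _ ∷ _ ∷ _ ∷ _ ∷ []) → refl }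
  where
  b e m K : Term 6
  b = var 1F
  e = var 2F
  m = var 3F
  K = var 4F

retTag-computable : Computable λ { g (t ∷ b ∷ v ∷ K ∷ []) → retTag t b v K }
retTag-computable = by-term
  (switch (var 0F)
    ( evalStateT b (pushT (prT (lit 4) v) K)
    ∷ evalStateT (prT b v) K
    ∷ evalStateT (prT (fsT b) (prT (fsT (snT b)) (prT (snT (snT b)) v))) K
    ∷ ifz v (retStateT (snT (snT b)) K)
        (evalStateT (prT (fsT b) (prT (fsT (snT b)) (sucT (snT (snT b)))))
          (pushT (prT (lit 3) (prT (fsT b) (prT (fsT (snT b)) (sucT (snT (snT b)))))) K))
    ∷ [])
    (retStateT (prT b v) K))
  λ { g (0 ∷ _ ∷ _ ∷ _ ∷ []) → refl
    ; g (1 ∷ _ ∷ _ ∷ _ ∷ []) → refl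
    ; g (2 ∷ _ ∷ _ ∷ _ ∷ []) → refl
    ; g (3 ∷ _ ∷ _ ∷ _ ∷ []) → refl
    ; g (suc (suc (suc (suc _))) ∷ _ ∷ _ ∷ _ ∷ []) → refl }
  where
  b v K : Term 4
  b = var 1F
  v = var 2F
  K = var 3F

advance-computable : Computable λ { g (st ∷ a ∷ []) → advance st a }
advance-computable = by-term
  (ifz (fsT st)
    (app evalTag-computable
      (fsT (fsT em) ∷ snT (fsT em) ∷ fsT em ∷ snT em ∷ snT (snT st) ∷ var 1F ∷ []))
    (ifz (snT (snT st)) st
      (app retTag-computable (fsT (fsT f) ∷ snT (fsT f) ∷ fsT (snT st) ∷ snT f ∷ []))))
  λ { g (st ∷ a ∷ []) →
        cong (ifz fs st then evalStep (fs (sn st)) (sn (sn st)) a else_) (lemma st (fs (sn st)) (sn (sn st))) }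
  where
  st em f : Term 2
  st = var 0F
  em = fsT (snT st)
  f  = predT (snT (snT st))
  lemma : ∀ st v K →
    (ifz K then st else retTag (fs (fs (pred K))) (sn (fs (pred K))) v (sn (pred K))) ≡ retStep st v K
  lemma st v zero    = refl
  lemma st v (suc K) = refl

pending-computable : Computable λ { g (st ∷ []) → pending st }
pending-computable = by-term
  (ifz (fsT st)
    (switch (fsT (fsT (fsT (snT st)))) (lit 0 ∷ lit 0 ∷ lit 0 ∷ lit 0 ∷ sucT (snT (fsT (snT st))) ∷ [])
      (lit 0))
    (lit 0))
  λ { g (st ∷ []) → cong (ifz fs st then_else 0) (lemma (fs (fs (fs (sn st)))) (sn (fs (sn st)))) }
  where
  st : Term 1
  st = var 0F
  lemma : ∀ t m → (ifz t then 0 else ifz pred t then 0 else ifz pred (pred t) then 0 else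
    ifz pred (pred (pred t)) then 0 else ifz pred (pred (pred (pred t))) then suc m else 0) ≡ queryTag t m
  lemma 0 m = refl
  lemma 1 m = refl
  lemma 2 m = refl
  lemma 3 m = refl
  lemma 4 m = refl
  lemma (suc (suc (suc (suc (suc _))))) m = refl

step-computable : Computable λ { g (st ∷ B ∷ []) → step B g st }
step-computable = by-term
  (ifz (p ∸ᵀ var 1F)
    (app advance-computable (var 0F ∷ ifz p (lit 0) (query (predT p)) ∷ [])) (var 0F))
  λ { g (st ∷ B ∷ []) → refl }
  where
  p : Term 2
  p = app pending-computable (var 0F ∷ [])

evaluate : Baire → Vec ℕ 3 → ℕ
evaluate g (s ∷ e ∷ m ∷ []) = E g s e m

opaque
  unfolding E

  evaluate-computable : Computable evaluate
  evaluate-computable = by-term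
    (inst final (rec (evalStateT (prT (var 1F) (var 2F)) (lit 0))
                 (app step-computable (var 1F ∷ var 2F ∷ [])) (var 0F) ∷ []))
    λ { g (s ∷ e ∷ m ∷ []) → refl }
    where
    final : Term 1
    final = ifz (fsT (var 0F)) (lit 0) (ifz (snT (snT (var 0F))) (sucT (fsT (snT (var 0F)))) (lit 0))

ET : ∀ {n} → Term n → Term n → Term n → Term n
ET s e m = app evaluate-computable (s ∷ e ∷ m ∷ [])

-- Monotonicity and continuity

Agree : ℕ → Baire → Baire → Set
Agree n x y = ∀ i → i < n → x i ≡ y i

agree-refl : ∀ {n x} → Agree n x x
agree-refl i i<n = refl

agree-sym : ∀ {n x y} → Agree n x y → Agree n y x
agree-sym a i i<n = sym (a i i<n)

agree-trans : ∀ {n x y z} → Agree n x y → Agree n y z → Agree n x z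
agree-trans a b i i<n = trans (a i i<n) (b i i<n)

agree-≤ : ∀ {m n x y} → m ≤ n → Agree n x y → Agree m x y
agree-≤ m≤n a i i<m = a i (<-≤-trans i<m m≤n)

step-agree : ∀ {B x y} → Agree B x y → ∀ st → step B x st ≡ step B y st
step-agree {B} a st with pending st
... | zero rewrite 0∸n≡0 B = refl
... | suc q with suc q ∸ B in eq
...   | zero  = cong (advance st) (a q (m∸n≡0⇒m≤n eq))
...   | suc _ = refl

final-fixed : ∀ st {v} → result st ≡ suc v → pending st ≡ 0 × (∀ B g → step B g st ≡ st)
final-fixed st eq = no-query , fixed
  where
  shape : ∃[ n ] fs st ≡ suc n × sn (sn st) ≡ 0
  shape with fs st | sn (sn st)
  ... | suc n | zero = n , refl , refl

  no-query : pending st ≡ 0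
  no-query rewrite proj₁ (proj₂ shape) = refl

  fixed : ∀ B g → step B g st ≡ st
  fixed B g rewrite no-query | 0∸n≡0 B | proj₁ (proj₂ shape) | proj₂ (proj₂ shape) = refl

-- The runs part only where the smaller bound blocks a query, and a blocked run keeps its state. A
-- final state has no pending query, so a result under the smaller bound persists under the larger
-- one.
run-stable : ∀ {B B′} g st → B ≤ B′ → ∀ n →
  run B′ g n st ≡ run B g n st ⊎ B < pending (run B g n st)
run-stable g st B≤B′ zero = inj₁ refl
run-stable {B} {B′} g st B≤B′ (suc n) with run B g n st | run-stable g st B≤B′ n
... | st′ | inj₂ blocked with pending st′ in eq
...   | q with q ∸ B in eq₁
...     | zero  = contradiction (m∸n≡0⇒m≤n eq₁) (<⇒≱ blocked)
...     | suc _ = inj₂ (subst (B <_) (sym eq) blocked)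
run-stable {B} {B′} g st B≤B′ (suc n) | st′ | inj₁ refl with pending st′ in eq
... | q with q ∸ B in eq₁
...   | zero  rewrite m≤n⇒m∸n≡0 (≤-trans (m∸n≡0⇒m≤n eq₁) B≤B′) = inj₁ refl
...   | suc _ = inj₂ (subst (B <_) (sym eq) (m<n+o⇒m∸n<o⁻¹ eq₁))
  where
  m<n+o⇒m∸n<o⁻¹ : ∀ {q B k} → q ∸ B ≡ suc k → B < q
  m<n+o⇒m∸n<o⁻¹ {q} {B} e = m∸n≢0⇒n<m {q} {B} λ e′ → contradiction (trans (sym e) e′) λ ()

run-final : ∀ {B g st n n′ v} → n ≤ n′ → result (run B g n st) ≡ suc v → run B g n′ st ≡ run B g n st
run-final {n′ = zero}   z≤n  eq = refl
run-final {B} {g} {st} {n} {suc n′} n≤ eq with m≤n⇒m<n∨m≡n n≤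
... | inj₂ refl = refl
... | inj₁ (s≤s n≤n′) rewrite run-final {B} {g} {st} n≤n′ eq = proj₂ (final-fixed _ eq) B g

result-mono : ∀ {g s s′ v} st → s ≤ s′ → result (run s g s st) ≡ suc v → result (run s′ g s′ st) ≡ suc v
result-mono {g} {s} {s′} {v} st s≤s′ eq with run-stable g st s≤s′ s
... | inj₂ blocked = contradiction (subst (s <_) (proj₁ (final-fixed (run s g s st) eq)) blocked) λ ()
... | inj₁ same    = trans (cong result (trans (run-final {s′} {g} {st} s≤s′ eq′) same)) eq
  where
  eq′ : result (run s′ g s st) ≡ suc v
  eq′ = trans (cong result same) eq

opaque
  unfolding E

  E-agree : ∀ {s x y} → Agree s x y → ∀ e m → E x s e m ≡ E y s e m
  E-agree {s} a e m = cong result (recur-cong _ (λ _ → step-agree a) s)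

  E-mono : ∀ {g s s′ e m v} → s ≤ s′ → E g s e m ≡ suc v → E g s′ e m ≡ suc v
  E-mono {g} {e = e} {m} = result-mono {g} (evalState (pr e m) 0)

E-unique : ∀ {g s s′ e m v v′} → E g s e m ≡ suc v → E g s′ e m ≡ suc v′ → v ≡ v′
E-unique {g} {s} {s′} {e} {m} eq eq′ =
  suc-injective (trans (sym (E-mono (m≤m⊔n s s′) eq)) (E-mono (m≤n⊔m s s′) eq′))

-- Adequacy of the evaluator

data Frame : Set where
  pairᵣ : Code → ℕ → Frame
  pairₗ : ℕ → Frame
  compᶠ : Code → Frame
  precᶠ : Code → ℕ → ℕ → Frame
  muᶠ   : Code → ℕ → ℕ → Frame

Stack : Set
Stack = List Frame

data Config : Set where
  ev  : Code → ℕ → Stack → Config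
  ret : ℕ → Stack → Config

frame# : Frame → ℕ
frame# (pairᵣ d m)   = pr 0 (pr (encode d) m)
frame# (pairₗ a)     = pr 4 a
frame# (compᶠ c)     = pr 1 (encode c)
frame# (precᶠ d a n) = pr 2 (pr (encode d) (pr a n))
frame# (muᶠ c m k)   = pr 3 (pr (encode c) (pr m k))

stack# : Stack → ℕ
stack# []      = 0
stack# (f ∷ K) = push (frame# f) (stack# K)

config# : Config → ℕ
config# (ev c m K) = evalState (pr (encode c) m) (stack# K)
config# (ret v K)  = retState v (stack# K)

prec-step : Code → Code → ℕ → ℕ → Stack → Config
prec-step c d a zero    K = ev c a K
prec-step c d a (suc n) K = ev (prec c d) (pr a n) (precᶠ d a n ∷ K)

mu-step : Code → ℕ → ℕ → ℕ → Stack → Config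
mu-step c m k zero    K = ret k K
mu-step c m k (suc _) K = ev c (pr m (suc k)) (muᶠ c m (suc k) ∷ K)

next-config : Baire → Config → Config
next-config g (ev const0 m K)     = ret 0 K
next-config g (ev succ m K)       = ret (suc m) K
next-config g (ev left m K)       = ret (fs m) K
next-config g (ev right m K)      = ret (sn m) K
next-config g (ev oracle m K)     = ret (g m) K
next-config g (ev (pair c d) m K) = ev c m (pairᵣ d m ∷ K)
next-config g (ev (comp c d) m K) = ev d m (compᶠ c ∷ K)
next-config g (ev (prec c d) m K) = prec-step c d (fs m) (sn m) K
next-config g (ev (mu c) m K)     = ev c (pr m 0) (muᶠ c m 0 ∷ K)
next-config g (ret v [])                = ret v []
next-config g (ret v (pairᵣ d m ∷ K))   = ev d m (pairₗ v ∷ K)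
next-config g (ret v (pairₗ a ∷ K))     = ret (pr a v) K
next-config g (ret v (compᶠ c ∷ K))     = ev c v K
next-config g (ret v (precᶠ d a n ∷ K)) = ev d (pr a (pr n v)) K
next-config g (ret v (muᶠ c m k ∷ K))   = mu-step c m k v K

encode-pair : ∀ c d → encode (pair c d) ≡ pr 5 (pr (encode c) (encode d))
encode-pair c d = sym (trans (pr-def 5 _) (cong ⟨ 5 ,_⟩ (pr-def _ _)))

encode-comp : ∀ c d → encode (comp c d) ≡ pr 6 (pr (encode c) (encode d))
encode-comp c d = sym (trans (pr-def 6 _) (cong ⟨ 6 ,_⟩ (pr-def _ _)))

encode-prec : ∀ c d → encode (prec c d) ≡ pr 7 (pr (encode c) (encode d))
encode-prec c d = sym (trans (pr-def 7 _) (cong ⟨ 7 ,_⟩ (pr-def _ _)))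

encode-mu : ∀ c → encode (mu c) ≡ pr 8 (encode c)
encode-mu c = sym (pr-def 8 _)

eval-step : ∀ B g {e t b m} K → e ≡ pr t b → queryTag t m ≡ 0 →
  step B g (evalState (pr e m) K) ≡ evalTag t b e m K 0
eval-step B g {e} {t} {b} {m} K refl q
  rewrite fs-pr 0 (pr (pr e m) K) | sn-pr 0 (pr (pr e m) K) | fs-pr (pr e m) K | sn-pr (pr e m) K
        | fs-pr e m | sn-pr e m | fs-pr t b | sn-pr t b | q | 0∸n≡0 B = refl

ret-step : ∀ {B g v} K → step B g (retState v K) ≡ retStep (retState v K) v K
ret-step {B} {v = v} K
  rewrite fs-pr 1 (pr v K) | sn-pr 1 (pr v K) | fs-pr v K | sn-pr v K | 0∸n≡0 B = refl

frame-step : ∀ B g {v t b} K → step B g (retState v (push (pr t b) K)) ≡ retTag t b v K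
frame-step B g {v} {t} {b} K = trans (ret-step {B} {g} (push (pr t b) K)) (lemma (pr (pr t b) K) refl)
  where
  lemma : ∀ f → f ≡ pr (pr t b) K → retTag (fs (fs f)) (sn (fs f)) v (sn f) ≡ retTag t b v K
  lemma f refl rewrite fs-pr (pr t b) K | sn-pr (pr t b) K | fs-pr t b | sn-pr t b = refl

query-step : ∀ {B g m} K →
  (suc m ∸ B ≡ 0 × step B g (evalState (pr (encode oracle) m) K) ≡ retState (g m) K) ⊎
  (B < suc m × step B g (evalState (pr (encode oracle) m) K) ≡ evalState (pr (encode oracle) m) K)
query-step {B} {m = m} K
  rewrite sym (pr-def 4 0) | fs-pr 0 (pr (pr (pr 4 0) m) K) | sn-pr 0 (pr (pr (pr 4 0) m) K)
        | fs-pr (pr (pr 4 0) m) K | sn-pr (pr (pr 4 0) m) K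
        | fs-pr (pr 4 0) m | sn-pr (pr 4 0) m | fs-pr 4 0
  with suc m ∸ B in eq
... | zero  = inj₁ (refl , refl)
... | suc _ = inj₂ (m∸n≢0⇒n<m {suc m} {B} (λ e → contradiction (trans (sym eq) e) λ ()) , refl)

needs : Config → ℕ
needs (ev oracle m K) = suc m
needs _               = 0

config-step : ∀ B g cfg → step B g (config# cfg) ≡ config# (next-config g cfg) ⊎
  (B < needs cfg × step B g (config# cfg) ≡ config# cfg)
config-step B g (ev const0 m K) = inj₁ (eval-step B g (stack# K) (sym (pr-def 0 0)) refl)
config-step B g (ev succ m K)   = inj₁ (eval-step B g (stack# K) (sym (pr-def 1 0)) refl)
config-step B g (ev left m K)   = inj₁ (eval-step B g (stack# K) (sym (pr-def 2 0)) refl)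
config-step B g (ev right m K)  = inj₁ (eval-step B g (stack# K) (sym (pr-def 3 0)) refl)
config-step B g (ev oracle m K) with query-step {B} {g} {m} (stack# K)
... | inj₁ (_ , eq) = inj₁ eq
... | inj₂ blocked  = inj₂ blocked
config-step B g (ev (pair c d) m K) = inj₁ (trans (eval-step B g (stack# K) (encode-pair c d) refl)
  (cong₂ (λ c d → evalState (pr c m) (push (pr 0 (pr d m)) (stack# K))) (fs-pr _ _) (sn-pr _ _)))
config-step B g (ev (comp c d) m K) = inj₁ (trans (eval-step B g (stack# K) (encode-comp c d) refl)
  (cong₂ (λ c d → evalState (pr d m) (push (pr 1 c) (stack# K))) (fs-pr _ _) (sn-pr _ _)))
config-step B g (ev (prec c d) m K) = inj₁ (trans (eval-step B g (stack# K) (encode-prec c d) refl) lemma)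
  where
  lemma : evalTag 7 (pr (encode c) (encode d)) (encode (prec c d)) m (stack# K) 0
            ≡ config# (prec-step c d (fs m) (sn m) K)
  lemma with sn m
  ... | zero  = cong (λ c → evalState (pr c (fs m)) (stack# K)) (fs-pr _ _)
  ... | suc n = cong (λ d → evalState (pr (encode (prec c d′)) (pr (fs m) n))
                              (push (pr 2 (pr d (pr (fs m) n))) (stack# K))) (sn-pr _ _)
    where d′ = d
config-step B g (ev (mu c) m K) = inj₁ (eval-step B g (stack# K) (encode-mu c) refl)
config-step B g (ret v [])                = inj₁ (ret-step {B} {g} 0)
config-step B g (ret v (pairᵣ d m ∷ K))   = inj₁ (frame-step B g (stack# K))
config-step B g (ret v (pairₗ a ∷ K))     = inj₁ (frame-step B g (stack# K))
config-step B g (ret v (compᶠ c ∷ K))     = inj₁ (frame-step B g (stack# K))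
config-step B g (ret v (precᶠ d a n ∷ K)) = inj₁ (trans (frame-step B g (stack# K)) lemma)
  where
  lemma : retTag 2 (pr (encode d) (pr a n)) v (stack# K) ≡ _
  lemma rewrite fs-pr (encode d) (pr a n) | sn-pr (encode d) (pr a n) | fs-pr a n | sn-pr a n = refl
config-step B g (ret v (muᶠ c m k ∷ K))   = inj₁ (trans (frame-step B g (stack# K)) (lemma v))
  where
  lemma : ∀ v → retTag 3 (pr (encode c) (pr m k)) v (stack# K) ≡ config# (mu-step c m k v K)
  lemma zero    rewrite sn-pr (encode c) (pr m k) | sn-pr m k = refl
  lemma (suc _) rewrite fs-pr (encode c) (pr m k) | sn-pr (encode c) (pr m k) | fs-pr m k | sn-pr m k = refl

run-+ : ∀ {B g} n m st → run B g (m + n) st ≡ run B g m (run B g n st)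
run-+ n zero    st = refl
run-+ {B} {g} n (suc m) st = cong (step B g) (run-+ {B} {g} n m st)

-- All sufficiently large bounds are covered because `E` uses a single number both as running time
-- and as oracle bound.
record Reach (g : Baire) (cfg cfg′ : Config) : Set where
  constructor reach
  field
    time  : ℕ
    bound : ℕ
    path  : ∀ B → bound ≤ B → run B g time (config# cfg) ≡ config# cfg′

reach-trans : ∀ {g a b c} → Reach g a b → Reach g b c → Reach g a c
reach-trans {g} {a} (reach n B p) (reach m C q) = reach (m + n) (B ⊔ C) λ D ≤D →
  trans (run-+ {D} {g} n m (config# a))
    (trans (cong (run D g m) (p D (≤-trans (m≤m⊔n B C) ≤D))) (q D (≤-trans (m≤n⊔m B C) ≤D)))

reach-step : ∀ {g b} a → Reach g (next-config g a) b → Reach g a b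
reach-step {g} a = reach-trans (reach 1 (needs a) λ B ≤B → case config-step B g a of λ where
  (inj₁ eq)      → eq
  (inj₂ (B< , _)) → contradiction B< (≤⇒≯ ≤B))

reach-refl : ∀ {g a} → Reach g a a
reach-refl = reach 0 0 λ _ _ → refl

reaches : ∀ {g c m v} → g ⊢ c ∶ m ⇒ v → ∀ K → Reach g (ev c m K) (ret v K)
reaches {m = m} const0 K = reach-step (ev const0 m K) reach-refl
reaches {m = m} succ K   = reach-step (ev succ m K) reach-refl
reaches {m = m} left K   = reach-step (ev left m K) reach-refl
reaches {m = m} right K  = reach-step (ev right m K) reach-refl
reaches {m = m} oracle K = reach-step (ev oracle m K) reach-refl
reaches {m = m} (pair {c} {d} {a = a} {b} r s) K =
  reach-step (ev (pair c d) m K) (reach-trans (reaches r (pairᵣ d m ∷ K))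
    (reach-step (ret a (pairᵣ d m ∷ K)) (reach-trans (reaches s (pairₗ a ∷ K))
      (reach-step (ret b (pairₗ a ∷ K)) reach-refl))))
reaches {m = m} (comp {c} {d} {u = u} r s) K =
  reach-step (ev (comp c d) m K) (reach-trans (reaches r (compᶠ c ∷ K))
    (reach-step (ret u (compᶠ c ∷ K)) (reaches s K)))
reaches {g} (prec-z {c} {d} {a} {v} r) K =
  reach-step (ev (prec c d) (pr a 0) K)
    (subst₂ (λ b n → Reach g (prec-step c d b n K) (ret v K)) (sym (fs-pr a 0)) (sym (sn-pr a 0)) (reaches r K))
reaches {g} (prec-s {c} {d} {a} {n} {u} {v} r s) K =
  reach-step (ev (prec c d) (pr a (suc n)) K)
    (subst₂ (λ b n → Reach g (prec-step c d b n K) (ret v K)) (sym (fs-pr a (suc n))) (sym (sn-pr a (suc n)))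
      (reach-trans (reaches r (precᶠ d a n ∷ K)) (reach-step (ret u (precᶠ d a n ∷ K)) (reaches s K))))
reaches {g} {m = m} (mu {c} {v = v} r s) K =
  reach-step (ev (mu c) m K) (reach-trans (search v 0 (+-identityʳ v))
    (reach-step (ret 0 (muᶠ c m v ∷ K)) reach-refl))
  where
  search : ∀ d k → d + k ≡ v → Reach g (ev c (pr m k) (muᶠ c m k ∷ K)) (ret 0 (muᶠ c m v ∷ K))
  search zero    k refl = reaches r (muᶠ c m k ∷ K)
  search (suc d) k eq   = let u , t = s k (subst (k <_) eq (s≤s (m≤n+m k d))) in
    reach-trans (reaches t (muᶠ c m k ∷ K))
      (reach-step (ret (suc u) (muᶠ c m k ∷ K)) (search d (suc k) (trans (+-suc d k) eq)))

result-ret : ∀ v → result (retState v 0) ≡ suc v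
result-ret v rewrite fs-pr 1 (pr v 0) | sn-pr 1 (pr v 0) | fs-pr v 0 | sn-pr v 0 = refl

result-config : ∀ cfg {v} → result (config# cfg) ≡ suc v → cfg ≡ ret v []
result-config (ev c m K) eq rewrite fs-pr 0 (pr (pr (encode c) m) (stack# K)) = contradiction eq λ ()
result-config (ret v K) eq rewrite fs-pr 1 (pr v (stack# K)) | sn-pr 1 (pr v (stack# K))
  | fs-pr v (stack# K) | sn-pr v (stack# K) with K
... | []    = cong (λ v → ret v []) (suc-injective eq)
... | _ ∷ _ = contradiction eq λ ()

opaque
  unfolding E

  E-complete : ∀ {g c m v} → g ⊢ c ∶ m ⇒ v → ∃[ s ] E g s (encode c) m ≡ suc v
  E-complete {g} {c} {m} {v} r = let reach n B h = reaches r [] in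
    n ⊔ B , trans (cong result (run-final {n ⊔ B} {g} {evalState (pr (encode c) m) 0} (m≤m⊔n n B)
                    (halts (n ⊔ B) n (h _ (m≤n⊔m n B)))))
                  (halts (n ⊔ B) n (h _ (m≤n⊔m n B)))
    where
    halts : ∀ B n → run B g n (config# (ev c m [])) ≡ config# (ret v []) →
      result (run B g n (evalState (pr (encode c) m) 0)) ≡ suc v
    halts B n eq = trans (cong result eq) (result-ret v)

-- Soundness is proved backwards along a run: Leads cfg w survives undoing a
-- step of the machine.

module _ (g : Baire) where

  FoundFrom : Code → ℕ → ℕ → ℕ → Set
  FoundFrom c m k u = k ≤ u × g ⊢ c ∶ pr m u ⇒ 0 × (∀ j → k ≤ j → j < u → ∃[ w ] g ⊢ c ∶ pr m j ⇒ suc w)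

  Found : Code → ℕ → ℕ → ℕ → ℕ → Set
  Found c m k zero    u = u ≡ k
  Found c m k (suc _) u = FoundFrom c m (suc k) u

  Continues : Stack → ℕ → ℕ → Set
  Continues []                v w = v ≡ w
  Continues (pairᵣ d m ∷ K)   v w = ∃[ b ] g ⊢ d ∶ m ⇒ b × Continues K (pr v b) w
  Continues (pairₗ a ∷ K)     v w = Continues K (pr a v) w
  Continues (compᶠ c ∷ K)     v w = ∃[ u ] g ⊢ c ∶ v ⇒ u × Continues K u w
  Continues (precᶠ d a n ∷ K) v w = ∃[ u ] g ⊢ d ∶ pr a (pr n v) ⇒ u × Continues K u w
  Continues (muᶠ c m k ∷ K)   v w = ∃[ u ] Found c m k v u × Continues K u w

  Leads : Config → ℕ → Set
  Leads (ev c m K) w = ∃[ v ] g ⊢ c ∶ m ⇒ v × Continues K v w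
  Leads (ret v K)  w = Continues K v w

  found : ∀ {c m k u} v → g ⊢ c ∶ pr m k ⇒ v → Found c m k v u → FoundFrom c m k u
  found zero    r refl = ≤-refl , r , λ j k≤j j<k → contradiction k≤j (<⇒≱ j<k)
  found {k = k} (suc v) r (k<u , s , below) = <⇒≤ k<u , s , λ j k≤j j<u → case m≤n⇒m<n∨m≡n k≤j of λ where
    (inj₁ k<j)  → below j k<j j<u
    (inj₂ refl) → v , r

  leads-back : ∀ cfg {w} → Leads (next-config g cfg) w → Leads cfg w
  leads-back (ev const0 m K)     l = _ , const0 , l
  leads-back (ev succ m K)       l = _ , succ , l
  leads-back (ev left m K)       l = _ , left , l
  leads-back (ev right m K)      l = _ , right , l
  leads-back (ev oracle m K)     l = _ , oracle , l
  leads-back (ev (pair c d) m K) (a , r , b , s , l) = pr a b , pair r s , l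
  leads-back (ev (comp c d) m K) (u , r , v , s , l) = v , comp r s , l
  leads-back (ev (prec c d) m K) {w} l = subst (λ m → Leads (ev (prec c d) m K) w) (pr-η m) (go (fs m) (sn m) l)
    where
    go : ∀ a n → Leads (prec-step c d a n K) w → Leads (ev (prec c d) (pr a n) K) w
    go a zero    (v , r , l)         = v , prec-z r , l
    go a (suc n) (u , r , v , s , l) = v , prec-s r s , l
  leads-back (ev (mu c) m K)     (v , r , u , f , l) =
    let _ , s , below = found v r f in u , mu s (λ k → below k z≤n) , l
  leads-back (ret v [])                l = l
  leads-back (ret v (pairᵣ d m ∷ K))   l = l
  leads-back (ret v (pairₗ a ∷ K))     l = l
  leads-back (ret v (compᶠ c ∷ K))     l = l
  leads-back (ret v (precᶠ d a n ∷ K)) l = l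
  leads-back (ret zero (muᶠ c m k ∷ K))    l = k , refl , l
  leads-back (ret (suc v) (muᶠ c m k ∷ K)) (v′ , r , u , f , l) = u , found v′ r f , l

  leads-run : ∀ B cfg n → ∃[ cfg′ ] run B g n (config# cfg) ≡ config# cfg′ × (∀ {w} → Leads cfg′ w → Leads cfg w)
  leads-run B cfg zero    = cfg , refl , id
  leads-run B cfg (suc n) with leads-run B cfg n
  ... | cfg′ , eq , back with config-step B g cfg′
  ...   | inj₁ eq′       = next-config g cfg′ , trans (cong (step B g) eq) eq′ , back ∘ leads-back cfg′
  ...   | inj₂ (_ , eq′) = cfg′ , trans (cong (step B g) eq) eq′ , back

opaque
  unfolding E

  E-sound : ∀ {g s m v} c → E g s (encode c) m ≡ suc v → g ⊢ c ∶ m ⇒ v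
  E-sound {g} {s} {m} {v} c eq with leads-run g s (ev c m []) s
  ... | cfg , eq′ , back with result-config cfg (trans (cong result (sym eq′)) eq)
  ...   | refl = case back {v} refl of λ { (_ , r , refl) → r }

-- Indices, uses and composition of computations

IsCode : ℕ → Set
IsCode e = ∃[ c ] encode c ≡ e

run-code : ∀ {e g m v} → Run e g m v → IsCode e
run-code (c , eq , _) = c , eq

run-complete : ∀ {e g m v} → Run e g m v → ∃[ s ] E g s e m ≡ suc v
run-complete (c , refl , r) = E-complete (⟦⟧⇒⊢ c r)

-- The hypothesis on `e` matters: for a program such as `const0` the machine reads only the tag, so
-- it also returns a result for `⟨ 0 , 1 ⟩`, where `Run` is empty.
run-sound : ∀ {e g s m v} → IsCode e → E g s e m ≡ suc v → Run e g m v
run-sound (c , refl) eq = c , refl , ⊢⇒⟦⟧ (E-sound c eq)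

run-⊢ : ∀ {g c m v} → g ⊢ c ∶ m ⇒ v → Run (encode c) g m v
run-⊢ {c = c} r = c , refl , ⊢⇒⟦⟧ r

run-unique : ∀ {e g m v v′} → Run e g m v → Run e g m v′ → v ≡ v′
run-unique r r′ = let s , eq = run-complete r; s′ , eq′ = run-complete r′ in E-unique eq eq′

-- The resource bound of a halting run also bounds its oracle queries.
run-use : ∀ {e g m v} → Run e g m v → ∃[ N ] ∀ g′ → Agree N g g′ → Run e g′ m v
run-use {e} {m = m} r = let s , eq = run-complete r in
  s , λ g′ a → run-sound (run-code r) (trans (sym (E-agree a e m)) eq)

run-≗ : ∀ {e g g′ m v} → g ≗ g′ → Run e g m v → Run e g′ m v
run-≗ g≗g′ r = proj₂ (run-use r) _ λ i _ → g≗g′ i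

-- The code of a sealed program does not unfold to a numeral.
opaque
  sealed : Code → Code
  sealed c = c

  run-sealed : ∀ {g c m v} → g ⊢ c ∶ m ⇒ v → g ⊢ sealed c ∶ m ⇒ v
  run-sealed r = r

Φ-code : ∀ {e g f} → Φ e g f → IsCode e
Φ-code Φgf = run-code (Φgf 0)

Φ-unique : ∀ {e g f f′} → Φ e g f → Φ e g f′ → f ≗ f′
Φ-unique p q n = run-unique (p n) (q n)

Φ-≗ : ∀ {e g g′ f f′} → g ≗ g′ → f ≗ f′ → Φ e g f → Φ e g′ f′
Φ-≗ {e} {g′ = g′} g≗g′ f≗f′ p n = subst (Run e g′ n) (f≗f′ n) (run-≗ g≗g′ (p n))

Φ-use : ∀ {e g f} → Φ e g f → ∀ M → ∃[ N ] ∀ g′ → Agree N g g′ → ∀ i → i < M → Run e g′ i (f i)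
Φ-use p zero    = 0 , λ _ _ _ ()
Φ-use {e} {f = f} p (suc M) with Φ-use p M | run-use (p M)
... | N , h | K , k = N ⊔ K , λ g′ a i i<1+M → case m≤n⇒m<n∨m≡n i<1+M of λ where
  (inj₁ (s≤s i<M)) → h g′ (agree-≤ (m≤m⊔n N K) a) i i<M
  (inj₂ refl)      → k g′ (agree-≤ (m≤n⊔m N K) a)

compose : Code → Code → Code
compose h c = comp (sub (comp h right) c) (pair const0 idCode)

run-compose : ∀ {g x h c m v} → (∀ k → g ⊢ h ∶ k ⇒ x k) → x ⊢ c ∶ m ⇒ v → g ⊢ compose h c ∶ m ⇒ v
run-compose run-h r = comp (pair const0 run-id) (run-sub (λ k → comp right-pr (run-h k)) r)

-- Since the program ignores its oracle, it can be inserted into a computation relative to any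
-- oracle.
ComputableReal : Pred Baire 0ℓ
ComputableReal x = ∃[ c ] ∀ g m → g ⊢ c ∶ m ⇒ x m

computable-Φ : ∀ {e x f} → ComputableReal x → Φ e x f → ComputableReal f
computable-Φ {e} {x} {f} (h , run-h) p with Φ-code p
... | c , refl = compose h c , λ g m → run-compose (run-h g)
  (let s , eq = run-complete (p m) in E-sound c eq)

-- Finite binary strings, coded by lists

opaque
  -- Nonzero entries count as 1 and the list is continued by zeros. Thus every number gives a point
  -- of Cantor space, and searches need not check that a code is well formed.
  bits : ℕ → Baire
  bits w i = ifz fs (pred (recur w (λ _ u → sn (pred u)) i)) then 0 else 1

  bits-binary : ∀ w → bits w ∈ points 2^ℕ
  bits-binary w i with fs (pred (recur w (λ _ u → sn (pred u)) i))
  ... | zero  = s≤s z≤n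
  ... | suc _ = s≤s (s≤s z≤n)

bitAt : Baire → Vec ℕ 2 → ℕ
bitAt g (w ∷ i ∷ []) = bits w i

opaque
  unfolding bits

  bitAt-computable : Computable bitAt
  bitAt-computable = by-term
    (ifz (fsT (predT (rec (var 0F) (snT (predT (var 1F))) (var 1F)))) (lit 0) (lit 1))
    λ { g (w ∷ i ∷ []) → refl }

  bits-head : ∀ a r → bits (suc ⟨ a , r ⟩) 0 ≡ (ifz a then 0 else 1)
  bits-head a r rewrite sym (pr-def a r) | fs-pr a r = refl

  bits-tail : ∀ a r i → bits (suc ⟨ a , r ⟩) (suc i) ≡ bits r i
  bits-tail a r i = cong (λ q → ifz fs (pred q) then 0 else 1) (lemma i)
    where
    lemma : ∀ i → recur (suc ⟨ a , r ⟩) (λ _ u → sn (pred u)) (suc i) ≡ recur r (λ _ u → sn (pred u)) i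
    lemma zero    = trans (cong sn (sym (pr-def a r))) (sn-pr a r)
    lemma (suc i) = cong (sn ∘ pred) (lemma i)

bits-prefix : ∀ {x} → x ∈ points 2^ℕ → ∀ n → Agree n (bits ⌜ x ↾ n ⌝) x
bits-prefix {x} x₂ (suc n) zero    _         = trans (bits-head (x 0) _) (lemma (x₂ 0))
  where
  lemma : ∀ {a} → a < 2 → (ifz a then 0 else 1) ≡ a
  lemma {zero}        _                  = refl
  lemma {suc zero}    _                  = refl
  lemma {suc (suc _)} (s≤s (s≤s ()))
bits-prefix {x} x₂ (suc n) (suc i) (s≤s i<n) = trans (bits-tail (x 0) _ i) (bits-prefix (x₂ ∘ suc) n i i<n)

≤⌜↾⌝ : ∀ x n → n ≤ ⌜ x ↾ n ⌝
≤⌜↾⌝ x zero    = z≤n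
≤⌜↾⌝ x (suc n) = s≤s (≤-trans (≤⌜↾⌝ (x ∘ suc) n) (subst (⌜ (x ∘ suc) ↾ n ⌝ ≤_) (pr-def (x 0) _) (sn≤pr (x 0) _)))

-- Every binary string of length n has a code below strings n.
strings : ℕ → ℕ
strings = recur 1 λ _ u → suc (suc (pr 1 u))

⌜↾⌝<strings : ∀ {x} → x ∈ points 2^ℕ → ∀ n → ⌜ x ↾ n ⌝ < strings n
⌜↾⌝<strings x₂ zero    = s≤s z≤n
⌜↾⌝<strings {x} x₂ (suc n) = s≤s (s≤s (subst (_≤ pr 1 (strings n)) (pr-def (x 0) _)
  (pr-mono (s≤s⁻¹ (x₂ 0)) (<⇒≤ (⌜↾⌝<strings (x₂ ∘ suc) n)))))

prefix : Baire → Vec ℕ 1 → ℕ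
prefix g (n ∷ []) = ⌜ g ↾ n ⌝

prefix-computable : Computable prefix
prefix-computable = by-term
  -- A list code has the head outermost, so the prefix is built from its last entry backwards.
  (rec (lit 0) (sucT (prT (query (var 2F ∸ᵀ sucT (var 0F))) (var 1F))) (var 0F))
  λ { g (n ∷ []) → trans (go g n n ≤-refl) (cong (λ k → ⌜ applyUpTo (λ i → g (k + i)) n ⌝) (n∸n≡0 n)) }
  where
  go : ∀ g n j → j ≤ n → recur 0 (λ i u → suc (pr (g (n ∸ suc i)) u)) j ≡ ⌜ applyUpTo (λ i → g (n ∸ j + i)) j ⌝
  go g n zero    j≤n = refl
  go g n (suc j) j<n = cong suc (trans (pr-def _ _) (cong₂ ⟨_,_⟩ (cong g (sym (+-identityʳ _)))
    (trans (go g n j (<⇒≤ j<n)) (cong ⌜_⌝ (applyUpTo-cong (λ i → cong g (shift i)) j)))))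
    where
    shift : ∀ i → n ∸ j + i ≡ n ∸ suc j + suc i
    shift i = trans (cong (_+ i) (+-∸-assoc 1 j<n)) (sym (+-suc (n ∸ suc j) i))
    applyUpTo-cong : ∀ {f h : Baire} → f ≗ h → ∀ k → applyUpTo f k ≡ applyUpTo h k
    applyUpTo-cong eq zero    = refl
    applyUpTo-cong eq (suc k) = cong₂ _∷_ (eq 0) (applyUpTo-cong (eq ∘ suc) k)

evaluateBits : Baire → Vec ℕ 4 → ℕ
evaluateBits g (w ∷ s ∷ e ∷ m ∷ []) = E (bits w) s e m

evaluateBits-computable : Computable evaluateBits
evaluateBits-computable = by-term
  (withOracle (app bitAt-computable (var 1F ∷ var 0F ∷ [])) (ET (var 1F) (var 2F) (var 3F)))
  λ { g (w ∷ s ∷ e ∷ m ∷ []) → refl }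

bitT : ∀ {n} → Term n → Term n → Term n
bitT w i = app bitAt-computable (w ∷ i ∷ [])

EBitsT : ∀ {n} → Term n → Term n → Term n → Term n → Term n
EBitsT w s e m = app evaluateBits-computable (w ∷ s ∷ e ∷ m ∷ [])

-- Arithmetical sets

lst : ∀ {n} → Vec ℕ n → ℕ
lst []       = 0
lst (k ∷ ks) = suc (pr k (lst ks))

lst-def : ∀ {n} (ks : Vec ℕ n) → lst ks ≡ ⌜ toList ks ⌝
lst-def []       = refl
lst-def (k ∷ ks) = cong suc (trans (pr-def k _) (cong ⟨ k ,_⟩ (lst-def ks)))

lstT : ∀ {n k} → Vec (Term n) k → Term n
lstT []       = lit 0
lstT (t ∷ ts) = sucT (prT t (lstT ts))

-- Translates the argument format of `Decides` into the environments of compiled terms, which carry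
-- no successors.
unlst : ℕ → Code
unlst zero    = const0
unlst (suc n) = comp (pair left (comp (unlst n) right)) (comp (code predecessor-computable) (pair idCode const0))

run-unlst : ∀ {n g} (ks : Vec ℕ n) → g ⊢ unlst n ∶ lst ks ⇒ enc ks
run-unlst []       = const0
run-unlst {suc n} {g} (k ∷ ks) =
  comp (comp (pair run-id const0) (correct predecessor-computable (lst (k ∷ ks) ∷ [])))
    (pair left-pr (comp right-pr (run-unlst ks)))

-- E adds one to the result, so that 1 stands for the answer 0 (false).
Unrefuted : ℕ → Baire → ∀ {n} → Vec ℕ n → Set
Unrefuted e x ks = ∀ s → E x s e (lst ks) ≢ 1

decides-code : ∀ {X e n} → Decides e X n → IsCode e
decides-code {2^ℕ} {n = n} d with d (λ _ → 0) (λ _ → s≤s z≤n) (zeros n)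
  where
  zeros : ∀ n → Vec ℕ n
  zeros zero    = []
  zeros (suc n) = 0 ∷ zeros n
... | inj₁ r = run-code r
... | inj₂ r = run-code r
decides-code {ℕ^ℕ} {n = n} d with d (λ _ → 0) _ (zeros n)
  where
  zeros : ∀ n → Vec ℕ n
  zeros zero    = []
  zeros (suc n) = 0 ∷ zeros n
... | inj₁ r = run-code r
... | inj₂ r = run-code r

holds⇒unrefuted : ∀ {e x n} {ks : Vec ℕ n} → Holds e x ks → Unrefuted e x ks
holds⇒unrefuted {e} {ks = ks} h s eq rewrite lst-def ks with run-complete h
... | s′ , eq′ = contradiction (E-unique eq eq′) λ ()

unrefuted⇒holds : ∀ {e X n x} {ks : Vec ℕ n} → Decides e X n → x ∈ points X → Unrefuted e x ks → Holds e x ks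
unrefuted⇒holds {e} {x = x} {ks} d x∈X u with d x x∈X ks
... | inj₂ r = r
... | inj₁ r = let s , eq = run-complete r in contradiction (subst (λ l → E x s e l ≡ 1) (sym (lst-def ks)) eq) (u s)

mutual
  ∃∀-map : ∀ n {R R′ : Pred (Vec ℕ n) 0ℓ} → R ⊆ R′ → ∃∀ n R → ∃∀ n R′
  ∃∀-map zero    f r       = f r
  ∃∀-map (suc n) f (k , r) = k , ∀∃-map n f r

  ∀∃-map : ∀ n {R R′ : Pred (Vec ℕ n) 0ℓ} → R ⊆ R′ → ∀∃ n R → ∀∃ n R′
  ∀∃-map zero    f r   = f r
  ∀∃-map (suc n) f r k = ∃∀-map n f (r k)

points-≗ : ∀ X {x y} → x ≗ y → x ∈ points X → y ∈ points X
points-≗ 2^ℕ x≗y x∈ n = subst (_< 2) (x≗y n) (x∈ n)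
points-≗ ℕ^ℕ x≗y x∈   = _

Extensional : Pred Baire 0ℓ → Set
Extensional A = ∀ {x y} → x ≗ y → x ∈ A → y ∈ A

Σ⁰-ext : ∀ {n X S} → Σ⁰ n X S → Extensional S
Σ⁰-ext {n} {X} (e , _ , S⊆ , ⊆S) x≗y x∈S = let x∈X , h = S⊆ x∈S in
  ⊆S (points-≗ X x≗y x∈X , ∃∀-map n (run-≗ x≗y) h)

Π⁰-ext : ∀ {n X S} → Π⁰ n X S → Extensional S
Π⁰-ext {n} {X} (e , _ , S⊆ , ⊆S) x≗y x∈S = let x∈X , h = S⊆ x∈S in
  ⊆S (points-≗ X x≗y x∈X , ∀∃-map n (run-≗ x≗y) h)

-- The form in which hypotheses about sets are used: instead of a completed decision, no bounded run
-- may refute the matrix. The way back to membership still needs a point of X, where an answer is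
-- guaranteed.
record Index (Q : ∀ n → Pred (Vec ℕ n) 0ℓ → Set) n X (S : Pred Baire 0ℓ) : Set where
  field
    index      : ℕ
    index-code : IsCode index
    S⊆points   : ∀ {x} → x ∈ S → x ∈ points X
    unrefuted  : ∀ {x} → x ∈ S → Q n (Unrefuted index x)
    member     : ∀ {x} → x ∈ points X → Q n (Unrefuted index x) → x ∈ S

open Index public

Σ-index : ∀ {n X S} → Σ⁰ n X S → Index ∃∀ n X S
Σ-index {n} {X} (e , d , S⊆ , ⊆S) = record
  { index      = e
  ; index-code = decides-code {X} d
  ; S⊆points   = λ x∈S → proj₁ (S⊆ x∈S)
  ; unrefuted  = λ x∈S → ∃∀-map n holds⇒unrefuted (proj₂ (S⊆ x∈S))
  ; member     = λ x∈X u → ⊆S (x∈X , ∃∀-map n (unrefuted⇒holds {X = X} d x∈X) u)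
  }

Π-index : ∀ {n X S} → Π⁰ n X S → Index ∀∃ n X S
Π-index {n} {X} (e , d , S⊆ , ⊆S) = record
  { index      = e
  ; index-code = decides-code {X} d
  ; S⊆points   = λ x∈S → proj₁ (S⊆ x∈S)
  ; unrefuted  = λ x∈S → ∀∃-map n holds⇒unrefuted (proj₂ (S⊆ x∈S))
  ; member     = λ x∈X u → ⊆S (x∈X , ∀∃-map n (unrefuted⇒holds {X = X} d x∈X) u)
  }

opaque
  decider : ∀ {n} → Form n → Code
  decider {n} φ = comp (compile (decide φ)) (unlst n)

  run-decider : ∀ {n} (φ : Form n) {g} ks → g ⊢ decider φ ∶ ⌜ toList ks ⌝ ⇒ eval (decide φ) g ks
  run-decider φ {g} ks rewrite sym (lst-def ks) = comp (run-unlst ks) (run-compile (decide φ) ks)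

decider-decides : ∀ {n} (φ : Form n) X → Decides (encode (decider φ)) X n
decider-decides φ X x _ ks with decide-char φ x ks
... | inj₁ (_ , eq) = inj₂ (run-⊢ (to eq (run-decider φ ks)))
... | inj₂ (_ , eq) = inj₁ (run-⊢ (to eq (run-decider φ ks)))

holds⇒⊨ : ∀ {n} (φ : Form n) {x ks} → Holds (encode (decider φ)) x ks → ⊨ φ x ks
holds⇒⊨ φ {x} {ks} h = decide-yes⁻¹ φ λ eq →
  contradiction (run-unique h (run-⊢ (to eq (run-decider φ ks)))) λ ()

⊨⇒holds : ∀ {n} (φ : Form n) {x ks} → ⊨ φ x ks → Holds (encode (decider φ)) x ks
⊨⇒holds φ {x} {ks} h = run-⊢ (to (decide-yes φ h) (run-decider φ ks))

Σ-intro : ∀ {n} X (φ : Form n) → Σ⁰ n X (points X ∩ λ x → ∃∀ n (⊨ φ x))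
Σ-intro {n} X φ = encode (decider φ) , decider-decides φ X ,
  map₂ (∃∀-map n (⊨⇒holds φ)) , map₂ (∃∀-map n (holds⇒⊨ φ))

Π-intro : ∀ {n} X (φ : Form n) → Π⁰ n X (points X ∩ λ x → ∀∃ n (⊨ φ x))
Π-intro {n} X φ = encode (decider φ) , decider-decides φ X ,
  map₂ (∀∃-map n (⊨⇒holds φ)) , map₂ (∀∃-map n (holds⇒⊨ φ))

module _ (em : ExcludedMiddle (lsuc 0ℓ)) where

  dec : ∀ (A : Set) → Dec A
  dec A = map′ lower lift (em {Lift _ A})

  dne : ∀ {A : Set} → ¬ ¬ A → A
  dne {A} ¬¬a with dec A
  ... | yes a = a
  ... | no ¬a = contradiction ¬a ¬¬a

  ¬∀⇒∃¬ : ∀ {A : Set} {P : A → Set} → ¬ (∀ a → P a) → ∃[ a ] ¬ P a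
  ¬∀⇒∃¬ ¬∀ = dne λ ¬∃ → ¬∀ λ a → dne λ ¬Pa → ¬∃ (a , ¬Pa)

  𝟎 : Baire
  𝟎 _ = 0

  -- Diagonally noncomputable functions

  DNC : Pred Baire 0ℓ
  DNC y = ∀ k s → E 𝟎 s k k ≢ suc (y k)

  DNC₂ : Pred Baire 0ℓ
  DNC₂ = points 2^ℕ ∩ DNC

  dnc-not-computable : ∀ {y} → ComputableReal y → y ∉ DNC
  dnc-not-computable (c , run-c) dnc = let s , eq = E-complete (run-c 𝟎 (encode c)) in dnc (encode c) s eq

  dnc-satisfiable : Satisfiable DNC₂
  dnc-satisfiable = (λ k → choose (halts-0 k)) , (λ k → binary (halts-0 k)) , λ k s → dnc k s (halts-0 k)
    where
    halts-0 : ∀ k → Dec (∃[ s ] E 𝟎 s k k ≡ 1)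
    -- The value 1 of `E` stands for the output 0; the sequence answers 1 exactly in this case.
    halts-0 k = dec _

    choose : ∀ {A : Set} → Dec A → ℕ
    choose (yes _) = 1
    choose (no _)  = 0

    binary : ∀ {A : Set} (d : Dec A) → choose d < 2
    binary (yes _) = s≤s (s≤s z≤n)
    binary (no _)  = s≤s z≤n

    dnc : ∀ k s (d : Dec (∃[ s ] E 𝟎 s k k ≡ 1)) → E 𝟎 s k k ≢ suc (choose d)
    dnc k s (yes (s′ , eq)) eq′ = contradiction (E-unique eq eq′) λ ()
    dnc k s (no ¬halts)     eq′ = ¬halts (s , eq′)

  -- Forcing conditions: p stands for the first fs p values of bits (sn p)

  Extends : ℕ → ℕ → Set
  Extends p q = fs p < fs q × Agree (fs p) (bits (sn p)) (bits (sn q))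

  extendsF : ∀ {n} → Fin n → Fin n → Form n
  extendsF p q = fsT (var p) <̇ fsT (var q) ∧̇
    ∀̇< (fsT (var p)) (bitT (snT (var (suc p))) (var 0F) ≈̇ bitT (snT (var (suc q))) (var 0F))

  condition : Baire → ℕ → ℕ
  condition x n = pr n ⌜ x ↾ n ⌝

  length-condition : ∀ x n → fs (condition x n) ≡ n
  length-condition x n = fs-pr n _

  agree-condition : ∀ {x} → x ∈ points 2^ℕ → ∀ n → Agree n (bits (sn (condition x n))) x
  agree-condition {x} x₂ n rewrite sn-pr n ⌜ x ↾ n ⌝ = bits-prefix x₂ n

  extends-condition : ∀ {p x n} → x ∈ points 2^ℕ → fs p < n → Agree (fs p) (bits (sn p)) x → Extends p (condition x n)
  extends-condition {p} {x} {n} x₂ p<n a =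
    subst (fs p <_) (sym (length-condition x n)) p<n ,
    agree-trans a (agree-sym (agree-≤ (<⇒≤ p<n) (agree-condition x₂ n)))

  module Chain (p : ℕ → ℕ) (extends : ∀ n → Extends (p n) (p (suc n))) where

    limit : Baire
    -- Lengths grow strictly, so condition `suc i` is the first one that is sure to fix bit `i`.
    limit i = bits (sn (p (suc i))) i

    limit-binary : limit ∈ points 2^ℕ
    limit-binary i = bits-binary _ i

    n≤length : ∀ n → n ≤ fs (p n)
    n≤length zero    = z≤n
    n≤length (suc n) = <-≤-trans (s≤s (n≤length n)) (proj₁ (extends n))

    mono : ∀ m k → fs (p m) ≤ fs (p (k + m)) × Agree (fs (p m)) (bits (sn (p m))) (bits (sn (p (k + m))))
    mono m zero    = ≤-refl , agree-refl
    mono m (suc k) = let le , a = mono m k; lt , b = extends (k + m) in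
      ≤-trans le (<⇒≤ lt) , agree-trans a (agree-≤ le b)

    mono-≤ : ∀ {m n} → m ≤ n → Agree (fs (p m)) (bits (sn (p m))) (bits (sn (p n)))
    mono-≤ {m} {n} m≤n = subst (λ n → Agree (fs (p m)) (bits (sn (p m))) (bits (sn (p n)))) (m∸n+n≡m m≤n)
      (proj₂ (mono m (n ∸ m)))

    limit-agree : ∀ n → Agree (fs (p n)) (bits (sn (p n))) limit
    limit-agree n i i<l with ≤-total n (suc i)
    ... | inj₁ n≤i = mono-≤ n≤i i i<l
    ... | inj₂ i<n = sym (mono-≤ i<n i (n≤length (suc i)))

  -- Forcing a functional out of a closed set

  Special : Pred Baire 0ℓ → Set
  Special P = ∀ {x} → ComputableReal x → x ∉ P

  -- Either some value is no bit or a bounded run refutes some instance, and both involve only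
  -- finitely many values of `x`.
  closed : ∀ {P} → Π⁰ 1 2^ℕ P → ∀ {x} → x ∉ P → ∃[ n ] ∀ y → Agree n x y → y ∉ P
  closed {P} Π {x} x∉P with dec (x ∈ points 2^ℕ)
  ... | no x∉2^ℕ = let i , xi≮2 = ¬∀⇒∃¬ x∉2^ℕ in
    suc i , λ y a y∈P → xi≮2 (subst (_< 2) (sym (a i (n<1+n i))) (S⊆points (Π-index {X = 2^ℕ} Π) y∈P i))
  ... | yes x₂ with ¬∀⇒∃¬ (λ u → x∉P (member (Π-index {X = 2^ℕ} Π) x₂ u))
  ...   | k , refuted with ¬∀⇒∃¬ refuted
  ...     | s , eq = s , λ y a y∈P → unrefuted (Π-index {X = 2^ℕ} Π) y∈P k s
    (trans (sym (E-agree a _ _)) (dne {E x s (index (Π-index {X = 2^ℕ} Π)) (lst (k ∷ [])) ≡ 1} eq))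

  Forces : ℕ → Pred Baire 0ℓ → Baire → ℕ → Set
  Forces l P x s = ∀ y → y ∈ points 2^ℕ → Agree s x y → ∀ f → Φ l y f → f ∉ P

  minimal : ∀ {P : ℕ → Set} {n} → P n → ∃[ m ] P m × (∀ k → k < m → ¬ P k)
  minimal {P} {n} Pn = go n zero (λ _ ()) (+-identityʳ n)
    where
    go : ∀ d m → (∀ k → k < m → ¬ P k) → d + m ≡ n → ∃[ m ] P m × (∀ k → k < m → ¬ P k)
    go d m below eq with dec (P m)
    ... | yes Pm = m , Pm , below
    go zero    m below refl | no ¬Pm = contradiction Pn ¬Pm
    go (suc d) m below eq   | no ¬Pm = go d (suc m) (λ k k<1+m → case m≤n⇒m<n∨m≡n k<1+m of λ where
      (inj₁ (s≤s k<m)) → below k k<m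
      (inj₂ refl)      → ¬Pm) (trans (+-suc d m) eq)

  module _ {P : Pred Baire 0ℓ} (Π : Π⁰ 1 2^ℕ P) (special : Special P)
    (l : ℕ) {x : Baire} (x₂ : x ∈ points 2^ℕ) (s : ℕ) where

    private
      Attained : Set
      Attained = ∀ y n → y ∈ points 2^ℕ → s ≤ n → Agree s x y →
        ∃[ z ] ∃[ f ] z ∈ points 2^ℕ × Agree n y z × Φ l z f × f ∈ P

      nextF : Form 3
      nextF = extendsF 1F 0F ∧̇ ¬̇ (EBitsT (snT (var 0F)) (fsT (var 0F)) (lit l) (var 2F) ≈̇ lit 0)

      chainCode : Code
      chainCode = prec (litCode (condition x s))
        (comp (searchCode nextF) (pair (comp right right) (pair (comp left right) const0)))

      module _ (attained : Attained) where

        -- The length of a condition doubles as resource bound, so the run sees only bits that the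
        -- condition fixes and every sequence through it gives the same result.
        Link : ℕ → ℕ → ℕ → Set
        Link p n q = Extends p q × E (bits (sn q)) (fs q) l n ≢ 0

        AboveX : ℕ → Set
        AboveX p = s ≤ fs p × Agree s x (bits (sn p))

        link : ∀ {p} n → AboveX p → ∃[ q ] Link p n q
        link {p} n (s≤p , a) with attained (bits (sn p)) (fs p) (bits-binary _) s≤p a
        ... | z , f , z₂ , b , Φzf , _ with run-complete (Φzf n)
        ...   | t , eq = condition z m , extends-condition z₂ (m≤m⊔n _ t) b , λ eq₀ →
          contradiction (trans (sym (E-mono (m≤n⊔m (suc (fs p)) t) eq)) (trans
            (trans (sym (E-agree (agree-condition z₂ m) l n)) (cong (λ k → E (bits (sn (condition z m))) k l n)
              (sym (length-condition z m)))) eq₀)) λ ()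
          where m = suc (fs p) ⊔ t

        chain : ∀ n → ∃[ p ] (∀ g → g ⊢ chainCode ∶ pr 0 n ⇒ p) × AboveX p
        linked : ∀ n → ∃[ q ] Link (proj₁ (chain n)) n q × (∀ k → k < q → ¬ Link (proj₁ (chain n)) n k)

        -- The least link is the one that `searchCode` finds, which makes the chain computable.
        linked n = minimal (proj₂ (link n (proj₂ (proj₂ (chain n)))))

        chain zero    = condition x s , (λ g → prec-z (run-lit _)) ,
          ≤-reflexive (sym (length-condition x s)) , agree-sym (agree-condition x₂ s)
        chain (suc n) = let p , run-p , s≤p , a = chain n
                            q , (e@(p<q , b) , ≢0) , below = linked n in
          q ,
          (λ g → prec-s (run-p g) (comp
            (pair (comp right-pr right-pr) (pair (comp right-pr left-pr) const0))
            (run-search nextF {ρ = p ∷ n ∷ []} (e , ≢0) below))) ,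
          ≤-trans s≤p (<⇒≤ p<q) , agree-trans a (agree-≤ s≤p b)

        p : ℕ → ℕ
        p n = proj₁ (chain n)

        p-linked : ∀ n → Link (p n) n (p (suc n))
        p-linked n = proj₁ (proj₂ (linked n))

        open Chain p (proj₁ ∘ p-linked)

        limit-computable : ComputableReal limit
        limit-computable =
          comp (compile (bitT {2} (snT (var 0F)) (var 1F)))
            (pair (comp chainCode (pair const0 succ)) (pair idCode const0)) ,
          λ g i → comp (pair (comp (pair const0 succ) (proj₁ (proj₂ (chain (suc i))) g)) (pair run-id const0))
            (run-compile (bitT (snT (var 0F)) (var 1F)) (p (suc i) ∷ i ∷ []))

        value : Baire
        value n = pred (E limit (fs (p (suc n))) l n)

        value-correct : IsCode l → Φ l limit value
        value-correct c n with E limit (fs (p (suc n))) l n in eq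
        ... | zero  = contradiction (trans (E-agree (limit-agree (suc n)) l n) eq) (proj₂ (p-linked n))
        ... | suc v = run-sound c eq

        x-limit : Agree s x limit
        x-limit = let s≤p , a = proj₂ (proj₂ (chain 0)) in agree-trans a (agree-≤ s≤p (limit-agree 0))

        -- If the value lay outside the closed set, finitely many of its entries would show it, and
        -- these depend on a finite part of `limit`. But that part has an extension that is mapped
        -- into `P`.
        value∈P : IsCode l → value ∈ P
        value∈P c = dne λ value∉P →
          let M , away = closed Π value∉P
              N , use = Φ-use (value-correct c) M
              z , f , z₂ , a , Φzf , f∈P = attained limit (s ⊔ N) limit-binary (m≤m⊔n s N) x-limit
          in away f (λ i i<M → run-unique (use z (agree-≤ (m≤n⊔m s N) a) i i<M) (Φzf i)) f∈P

        impossible : IsCode l → ⊥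
        impossible c = special (computable-Φ limit-computable (value-correct c)) (value∈P c)

    force : ∃[ x′ ] ∃[ s′ ] x′ ∈ points 2^ℕ × s ≤ s′ × Agree s x x′ × Forces l P x′ s′
    force = dne λ ¬forced →
      let attained : Attained
          attained y n y₂ s≤n a = dne λ ¬attained → ¬forced
            (y , n , y₂ , s≤n , a , λ z z₂ b f Φzf f∈P → ¬attained (z , f , z₂ , b , Φzf , f∈P))
          _ , _ , _ , _ , Φzf , _ = attained x s x₂ ≤-refl agree-refl
      in impossible attained (Φ-code Φzf)

  -- A closed set of DNC sequences; splicing and dense conditions

  dncF : ∀ {n} → Term n → Term n → Form n
  dncF y n = ¬̇ (withOracle (lit 0) (ET (snT n) (fsT n) (fsT n)) ≈̇ sucT y)

  dnc-form : ∀ {y} → (∀ n → ⊨ (dncF (query (fsT (var 0F))) (var 0F)) y (n ∷ [])) → DNC y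
  dnc-form {y} h k s eq = h (pr k s) (subst₂ (λ k s → E 𝟎 s k k ≡ suc (y k)) (sym (fs-pr k s)) (sym (sn-pr k s)) eq)

  dnc₂-closed : Π⁰ 1 2^ℕ DNC₂
  dnc₂-closed = let e , d , ⊆φ , φ⊆ = Π-intro 2^ℕ (dncF (query (fsT (var 0F))) (var 0F)) in
    e , d , (λ (y₂ , dnc) → ⊆φ (y₂ , λ n → dnc (fs n) (sn n))) , λ h → let y₂ , h′ = φ⊆ h in y₂ , dnc-form h′

  splice : Baire → ℕ → Baire → Baire
  splice x s z i with i <? s
  ... | yes _ = x i
  ... | no _  = z i

  splice-agree : ∀ x s z → Agree s x (splice x s z)
  splice-agree x s z i i<s with i <? s
  ... | yes _  = refl
  ... | no i≮s = contradiction i<s i≮s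

  splice-beyond : ∀ x s z i → s ≤ i → splice x s z i ≡ z i
  splice-beyond x s z i s≤i with i <? s
  ... | yes i<s = contradiction s≤i (<⇒≱ i<s)
  ... | no _    = refl

  splice-binary : ∀ {x z} s → x ∈ points 2^ℕ → z ∈ points 2^ℕ → splice x s z ∈ points 2^ℕ
  splice-binary s x₂ z₂ i with i <? s
  ... | yes _ = x₂ i
  ... | no _  = z₂ i

  Condition : Set₁
  Condition = Baire → ℕ → Set

  Dense Persistent : Condition → Set
  Dense K      = ∀ {x} s → x ∈ points 2^ℕ → ∃[ x′ ] ∃[ s′ ] x′ ∈ points 2^ℕ × s ≤ s′ × Agree s x x′ × K x′ s′
  Persistent K = ∀ {x s x′ s′} → s ≤ s′ → Agree s x x′ → K x s → K x′ s′

  -- The conditions are met one after another, and persistence keeps those already met.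
  dense-all : ∀ {K : ℕ → Condition} → (∀ e → Dense (K e)) → (∀ e → Persistent (K e)) →
    ∀ b → Dense (λ x s → ∀ e → e < b → K e x s)
  dense-all dense persist zero    {x} s x₂ = x , s , x₂ , ≤-refl , agree-refl , λ _ ()
  dense-all dense persist (suc b) {x} s x₂ =
    let x′ , s′ , x′₂ , s≤s′ , a , all-K = dense-all dense persist b s x₂
        x″ , s″ , x″₂ , s′≤s″ , a′ , Kb  = dense b s′ x′₂
    in x″ , s″ , x″₂ , ≤-trans s≤s′ s′≤s″ , agree-trans a (agree-≤ s≤s′ a′) ,
       λ e e<1+b → case m≤n⇒m<n∨m≡n e<1+b of λ where
         (inj₁ (s≤s e<b)) → persist e s′≤s″ a′ (all-K e e<b)
         (inj₂ refl)      → Kb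

  forces-dense : ∀ {P} → Π⁰ 1 2^ℕ P → Special P → ∀ l → Dense (Forces l P)
  forces-dense Π special l s x₂ = force Π special l x₂ s

  forces-persistent : ∀ {P} l → Persistent (Forces l P)
  forces-persistent l s≤s′ a F y y₂ b = F y y₂ (agree-trans a (agree-≤ s≤s′ b))

  computable-shift : ∀ {x} j → ComputableReal x → ComputableReal (λ n → x (j + n))
  computable-shift j (c , run-c) =
    comp c (comp (compile {1} (lit j +ᵀ var 0F)) (pair idCode const0)) ,
    λ g n → comp (comp (pair run-id const0) (run-compile (lit j +ᵀ var 0F) (n ∷ []))) (run-c g (j + n))

  -- What bounded nonuniformity and learning have in common: on each single input some functional
  -- gives the value.
  Pointwise : Pred PartialFunction 0ℓ → Set₁
  Pointwise αβ = ∀ Γ → αβ Γ → ∀ {g f} → Graph Γ g f → ∃[ e ] Φ e g f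

  -- Computable reals are closed under single functionals, so a computable member of `B` would be
  -- sent to one of `A`.
  special-above : ∀ {αβ A B} → Pointwise αβ → A ≤[ αβ ] B → Special A → Special B
  special-above pointwise (Γ , αβΓ , B⊆dom , maps) special comp-x x∈B =
    let f , Γxf = B⊆dom x∈B
        e , Φxf = pointwise Γ αβΓ Γxf
    in special (computable-Φ comp-x Φxf) (maps _ f x∈B Γxf)

  -- Σ⁰₂ sets and (<ω,1)-degrees

  pointwise-[<ω,1] : Pointwise [<ω,1]-computable
  pointwise-[<ω,1] Γ (b , h) Γgf = let e , _ , Φgf = h _ _ Γgf in e , Φgf

  tailF : Form 2
  tailF = dncF (query (var 0F +ᵀ fsT (var 1F))) (var 1F)

  EventuallyDNC : Pred Baire 0ℓ
  EventuallyDNC = points 2^ℕ ∩ λ x → ∃∀ 2 (⊨ tailF x)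

  eventuallyDNC-special : Special EventuallyDNC
  eventuallyDNC-special comp-x (_ , j , h) =
    dnc-not-computable (computable-shift j comp-x) (dnc-form h)

  eventuallyDNC-dense : ∀ {x} s → x ∈ points 2^ℕ → ∃[ y ] Agree s x y × y ∈ EventuallyDNC
  eventuallyDNC-dense {x} s x₂ =
    let q , q₂ , dnc = dnc-satisfiable in
    splice x s (λ i → q (i ∸ s)) , splice-agree x s _ , splice-binary s x₂ (λ i → q₂ (i ∸ s)) , s ,
    λ n eq → dnc (fs n) (sn n) (trans eq (cong suc
      (trans (splice-beyond x s _ (s + fs n) (m≤m+n s _)) (cong q (m+n∸m≡n s (fs n))))))

  special-not-below-eventuallyDNC : ∀ {P} → Π⁰ 1 2^ℕ P → Special P →
    ¬ (P ≤[ [<ω,1]-computable ] (EventuallyDNC ∪ DNC₂))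
  special-not-below-eventuallyDNC {P} Π special (Γ , (b , h) , ⊆dom , maps) =
    let x , s , x₂ , _ , _ , forced = dense-all {λ e → Forces e P}
          (forces-dense Π special) forces-persistent b {𝟎} 0 (λ _ → s≤s z≤n)
        y , a , y∈S   = eventuallyDNC-dense s x₂
        f , Γyf       = ⊆dom (inj₁ y∈S)
        e , e<b , Φyf = h y f Γyf
    in forced e e<b y (proj₁ y∈S) a f Φyf (maps y f (inj₁ y∈S) Γyf)

  not-SEL-Σ₂ : ¬ SEL (Σ⁰ 2) 2^ℕ [<ω,1]-computable
  not-SEL-Σ₂ sel =
    let P , Π , P≤S∪Q , S∪Q≤P = sel EventuallyDNC DNC₂ (Σ-intro 2^ℕ tailF) dnc₂-closed dnc-satisfiable
    in special-not-below-eventuallyDNC Π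
         (special-above pointwise-[<ω,1] S∪Q≤P λ where
           comp-x (inj₁ x∈S)       → eventuallyDNC-special comp-x x∈S
           comp-x (inj₂ (_ , dnc)) → dnc-not-computable comp-x dnc)
         P≤S∪Q

  -- A limit-computable 1-generic real

  meetsF : Form 4
  meetsF = extendsF 3F 0F ∧̇ ¬̇ (EBitsT (snT (var 0F)) (fsT (var 0F)) (var 2F) (lit 0) ≈̇ lit 0)

  Meets : ℕ → ℕ → ℕ → Set
  Meets e p q = Extends p q × E (bits (sn q)) (fs q) e 0 ≢ 0

  meets : ℕ → ℕ → ℕ → ℕ
  -- The entry 0 fills the place of the search bound `t` of `nextCondition`, which `meetsF` does not
  -- mention.
  meets e p q = eval (decide meetsF) 𝟎 (q ∷ 0 ∷ e ∷ p ∷ [])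

  ¬meets : ∀ {e p q} → ¬ Meets e p q → meets e p q ≡ 0
  ¬meets {e} {p} {q} = decide-no meetsF {𝟎} {q ∷ 0 ∷ e ∷ p ∷ []}

  ¬meets⁻¹ : ∀ {e p q} → meets e p q ≡ 0 → ¬ Meets e p q
  ¬meets⁻¹ {e} {p} {q} = decide-no⁻¹ meetsF {𝟎} {q ∷ 0 ∷ e ∷ p ∷ []}

  -- A step of the finite-extension construction of a 1-generic: let program `e` halt on input 0 if
  -- some extension of `p` allows it, otherwise just lengthen `p`. The search is cut off at `t`;
  -- only the limit over `t` shows whether it fails.
  nextCondition : Baire → Vec ℕ 3 → ℕ
  nextCondition g (t ∷ e ∷ p ∷ []) =
    ifz firstBelow (meets e p) t then pr (suc (fs p)) (sn p) else pred (firstBelow (meets e p) t)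

  nextCondition-computable : Computable nextCondition
  nextCondition-computable = by-term
    (ifz first (prT (sucT (fsT (var 2F))) (snT (var 2F))) (predT first))
    λ { g (t ∷ e ∷ p ∷ []) → cong (λ q → ifz q then pr (suc (fs p)) (sn p) else pred q)
          (eval-firstT (decide meetsF) (var 0F) g (t ∷ e ∷ p ∷ [])) }
    where
    first : Term 3
    first = firstT (decide meetsF) (var 0F)

  stage : Baire → Vec ℕ 2 → ℕ
  stage g (t ∷ e ∷ []) = recur (pr 0 0) (λ i p → nextCondition g (t ∷ i ∷ p ∷ [])) e

  stage-computable : Computable stage
  stage-computable = by-term
    (rec (prT (lit 0) (lit 0)) (app nextCondition-computable (var 2F ∷ var 0F ∷ var 1F ∷ [])) (var 1F))
    λ { g (t ∷ e ∷ []) → refl }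

  Decided : ℕ → ℕ → ℕ → Set
  Decided e p q = Meets e p q ⊎ (∀ q′ → ¬ Meets e p q′)

  Settles : (ℕ → ℕ) → ℕ → Set
  Settles f v = ∃[ t₀ ] ∀ t → t₀ ≤ t → f t ≡ v

  next-settles : ∀ e p → ∃[ q ] Extends p q × Decided e p q × Settles (λ t → nextCondition 𝟎 (t ∷ e ∷ p ∷ [])) q
  next-settles e p with dec (∃[ q ] Meets e p q)
  ... | yes (_ , m) with minimal {Meets e p} m
  ...   | q , m@(ext , _) , below = q , ext , inj₁ m , suc q , λ t q<t →
    cong (λ r → ifz r then pr (suc (fs p)) (sn p) else pred r)
      (firstBelow-some⁻¹ (meets e p) t q<t (λ eq → ¬meets⁻¹ eq m) λ k k<q → ¬meets (below k k<q))
  next-settles e p | no ¬m = pr (suc (fs p)) (sn p) ,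
    (subst (fs p <_) (sym (fs-pr _ _)) ≤-refl , λ i _ → cong (λ w → bits w i) (sym (sn-pr _ _))) ,
    inj₂ (λ q m → ¬m (q , m)) , 0 , λ t _ →
    cong (λ r → ifz r then pr (suc (fs p)) (sn p) else pred r)
      (firstBelow-none⁻¹ (meets e p) t λ q _ → ¬meets λ m → ¬m (q , m))

  settled : ∀ e → ∃[ p ] Settles (λ t → stage 𝟎 (t ∷ e ∷ [])) p
  settled zero    = pr 0 0 , 0 , λ _ _ → refl
  settled (suc e) with settled e
  ... | p , t₀ , h with next-settles e p
  ...   | q , _ , _ , t₁ , k = q , t₀ ⊔ t₁ , λ t ≤t →
    trans (cong (λ p → nextCondition 𝟎 (t ∷ e ∷ p ∷ [])) (h t (≤-trans (m≤m⊔n t₀ t₁) ≤t)))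
      (k t (≤-trans (m≤n⊔m t₀ t₁) ≤t))

  opaque
    σ : ℕ → ℕ
    σ e = proj₁ (settled e)

    σ-next : ∀ e → Extends (σ e) (σ (suc e)) × Decided e (σ e) (σ (suc e))
    σ-next e = let _ , ext , d , _ = next-settles e (σ e) in ext , d

    σ-settles : ∀ e → Settles (λ t → stage 𝟎 (t ∷ e ∷ [])) (σ e)
    σ-settles e = proj₂ (settled e)

  module Generic = Chain σ (proj₁ ∘ σ-next)

  opaque
    G : Baire
    G = Generic.limit

    G-binary : G ∈ points 2^ℕ
    G-binary = Generic.limit-binary

    G-agree : ∀ n → Agree (fs (σ n)) (bits (sn (σ n))) G
    G-agree = Generic.limit-agree

    G-def : ∀ n → G n ≡ bits (sn (σ (suc n))) n
    G-def n = refl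

  approximation : Baire → Vec ℕ 2 → ℕ
  approximation g (t ∷ n ∷ []) = bits (sn (stage 𝟎 (t ∷ suc n ∷ []))) n

  approximation-computable : Computable approximation
  approximation-computable = by-term
    (bitT (snT (withOracle (lit 0) (app stage-computable (var 0F ∷ sucT (var 1F) ∷ [])))) (var 1F))
    λ { g (t ∷ n ∷ []) → refl }

  G-limit : ∀ g n → Settles (λ t → approximation g (t ∷ n ∷ [])) (G n)
  G-limit g n = let t₀ , h = σ-settles (suc n) in
    t₀ , λ t t₀≤t → trans (cong (λ p → bits (sn p) n) (h t t₀≤t)) (sym (G-def n))

  Avoids : Code → Baire → ℕ → Set
  Avoids c x s = ∀ y → y ∈ points 2^ℕ → Agree s x y → ∀ v → ¬ y ⊢ c ∶ 0 ⇒ v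

  halted : ∀ {x s e m} → E x s e m ≢ 0 → ∃[ v ] E x s e m ≡ suc v
  halted {x} {s} {e} {m} ≢0 = go (E x s e m) ≢0
    where
    go : ∀ n → n ≢ 0 → ∃[ v ] n ≡ suc v
    go zero    ≢0 = contradiction refl ≢0
    go (suc v) _  = v , refl

  condition-halts : ∀ {y m e k t v} → y ∈ points 2^ℕ → t ≤ m → E y t e k ≡ suc v →
    E (bits (sn (condition y m))) (fs (condition y m)) e k ≢ 0
  condition-halts {y} {m} {e} {k} {v = v} y₂ t≤m eq eq₀ = contradiction (trans (sym eq₀) eq₁) λ ()
    where
    eq₁ : E (bits (sn (condition y m))) (fs (condition y m)) e k ≡ suc v
    eq₁ = trans (cong (λ n → E (bits (sn (condition y m))) n e k) (length-condition y m))
      (trans (E-agree (agree-condition y₂ m) e k) (E-mono t≤m eq))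

  G-generic : ∀ c → (∃[ v ] G ⊢ c ∶ 0 ⇒ v) ⊎ (∃[ s ] Avoids c G s)
  G-generic c = go (proj₂ (σ-next e))
    where
    e : ℕ
    e = encode c

    go : Decided e (σ e) (σ (suc e)) → _
    go (inj₁ (_ , ≢0)) = let v , eq = halted ≢0 in
      inj₁ (v , E-sound c (trans (sym (E-agree (G-agree (suc e)) e 0)) eq))
    go (inj₂ none)     = inj₂ (fs (σ e) , λ y y₂ a v r →
      let t , eq = E-complete r in
      none (condition y (suc (fs (σ e)) ⊔ t))
        (extends-condition y₂ (m≤m⊔n _ t) (agree-trans (G-agree e) a) , condition-halts y₂ (m≤n⊔m _ t) eq))

  ⊢-unique : ∀ {g c m v v′} → g ⊢ c ∶ m ⇒ v → g ⊢ c ∶ m ⇒ v′ → v ≡ v′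
  ⊢-unique r r′ = run-unique (run-⊢ r) (run-⊢ r′)

  search-sound : ∀ {n} (φ : Form (suc n)) {g ρ v} → g ⊢ searchCode φ ∶ enc ρ ⇒ v → ⊨ φ g (v ∷ ρ)
  search-sound φ {g} {ρ} {v} (mu r _) = decide-yes⁻¹ φ λ eq →
    1+n≢0 {0} (⊢-unique (to {v′ = 1} (cong (ifz_then 1 else 0) eq) (run-test φ {g} {ρ} v)) r)

  -- 1-genericity for an open set given by a formula: the program to which `G-generic` is applied
  -- searches for a witness `v`.
  G-meets : ∀ (φ : Form 1) → (∃[ v ] ⊨ φ G (v ∷ [])) ⊎
    (∃[ s ] ∀ y → y ∈ points 2^ℕ → Agree s G y → ∀ v → ¬ ⊨ φ y (v ∷ []))
  G-meets φ = go (G-generic (searchCode φ))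
    where
    go : (∃[ v ] G ⊢ searchCode φ ∶ 0 ⇒ v) ⊎ (∃[ s ] Avoids (searchCode φ) G s) → _
    go (inj₁ (v , r))      = inj₁ (v , search-sound φ {G} {[]} {v} r)
    go (inj₂ (s , avoids)) = inj₂ (s , λ y y₂ a v h →
      let u , _ , r = run-search⁻¹ φ {y} {[]} {v} h in avoids y y₂ a u r)

  -- If `G` were computable, differing from it would be an open condition. Every prefix of `G` has
  -- an extension that satisfies it, but `G` itself does not.
  G-not-computable : ¬ ComputableReal G
  G-not-computable (c , run-c) = go (G-meets differsF)
    where
    value : Baire → Vec ℕ 1 → ℕ
    value g (n ∷ []) = G n

    value-computable : Computable value
    value-computable = computable (comp c left) λ { (n ∷ []) → comp left-pr (run-c _ n) }

    differsF : Form 1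
    differsF = ¬̇ (query (var 0F) ≈̇ app value-computable (var 0F ∷ []))

    flipped : Baire
    flipped i = 1 ∸ G i

    flipped-binary : flipped ∈ points 2^ℕ
    flipped-binary i = s≤s (m∸n≤m 1 (G i))

    1∸n≢n : ∀ n → 1 ∸ n ≢ n
    1∸n≢n zero    ()
    1∸n≢n (suc n) eq = 1+n≢0 (trans (sym eq) (0∸n≡0 n))

    go : (∃[ v ] G v ≢ G v) ⊎ (∃[ s ] ∀ y → y ∈ points 2^ℕ → Agree s G y → ∀ v → ¬ y v ≢ G v) → ⊥
    go (inj₁ (v , ≢))      = ≢ refl
    go (inj₂ (s , avoids)) =
      avoids (splice G s flipped) (splice-binary s G-binary flipped-binary) (splice-agree G s flipped) s
        λ eq → 1∸n≢n (G s) (trans (sym (splice-beyond G s flipped s ≤-refl)) eq)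

  -- The generic real computes no DNC sequence

  module _ {c : Code} {f : Baire} (run-c : ∀ n → G ⊢ c ∶ n ⇒ f n) where

    private
      e : ℕ
      e = encode c

      Hits : Baire → ℕ → ℕ → Set
      Hits x k s = E x s e k ≢ 0 × E x s e k ≡ E 𝟎 s k k

      hitsF : Form 1
      hitsF = ¬̇ (ET (snT (var 0F)) (lit e) (fsT (var 0F)) ≈̇ lit 0) ∧̇
        ET (snT (var 0F)) (lit e) (fsT (var 0F)) ≈̇
          withOracle (lit 0) (ET (snT (var 0F)) (fsT (var 0F)) (fsT (var 0F)))

      G-hits : ∀ {k s} → Hits G k s → f ∉ DNC
      G-hits {k} {s} (≢0 , eq) dnc =
        let v , eq₁ = halted ≢0
            _ , eq₂ = E-complete (run-c k)
        in dnc k s (trans (sym eq) (trans eq₁ (cong suc (E-unique eq₁ eq₂))))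

      module _ (N : ℕ) (avoids : ∀ y → y ∈ points 2^ℕ → Agree N G y → ∀ k s → ¬ Hits y k s) where

        p : ℕ
        p = condition G N

        Finds : ℕ → ℕ → Set
        Finds k q = Extends p q × E (bits (sn q)) (fs q) e k ≢ 0

        findsF : Form 3
        findsF = extendsF 1F 0F ∧̇ ¬̇ (EBitsT (snT (var 0F)) (fsT (var 0F)) (lit e) (var 2F) ≈̇ lit 0)

        p-agree : Agree (fs p) (bits (sn p)) G
        p-agree = subst (λ n → Agree n (bits (sn p)) G) (sym (length-condition G N)) (agree-condition G-binary N)

        exists : ∀ k → ∃[ q ] Finds k q
        exists k = let t , eq = E-complete (run-c k) in
          condition G (suc (fs p) ⊔ t) ,
          extends-condition G-binary (m≤m⊔n _ t) p-agree , condition-halts G-binary (m≤n⊔m _ t) eq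

        finds : ∀ k → ∃[ q ] Finds k q × (∀ r → r < q → ¬ Finds k r)
        finds k = minimal {Finds k} (proj₂ (exists k))

        q : ℕ → ℕ
        q k = proj₁ (finds k)

        valueT : Term 2
        valueT = predT (EBitsT (snT (var 0F)) (fsT (var 0F)) (lit e) (var 1F))

        y : Baire
        y k = pred (E (bits (sn (q k))) (fs (q k)) e k)

        y-computable : ComputableReal y
        y-computable =
          comp (compile valueT)
            (pair (comp (searchCode findsF) (pair (litCode p) (pair idCode const0))) (pair idCode const0)) ,
          λ g k → let h , below = proj₂ (finds k) in
            comp (pair (comp (pair (run-lit p) (pair run-id const0)) (run-search findsF {g} {p ∷ k ∷ []} h below))
                   (pair run-id const0))
              (run-compile valueT (q k ∷ k ∷ []))

        y-dnc : y ∈ DNC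
        y-dnc k s eq =
          let (_ , a) , ≢0 = proj₁ (proj₂ (finds k))
              v , eq₁ = halted ≢0
              t = fs (q k)
              left-eq  = E-mono (m≤n⊔m s t) eq₁
              right-eq = trans (E-mono (m≤m⊔n s t) eq) (cong (λ n → suc (pred n)) eq₁)
          in avoids (bits (sn (q k))) (bits-binary _)
               (subst (λ n → Agree n G (bits (sn (q k)))) (length-condition G N)
                 (agree-trans (agree-sym p-agree) a)) k (s ⊔ t)
               ((λ eq₀ → contradiction (trans (sym left-eq) eq₀) λ ()) , trans left-eq (sym right-eq))

    -- Either `G` makes program `c` take a diagonal value, so `f` is not DNC, or no extension of
    -- some prefix of `G` does. In the latter case, the first extension found on which `c` halts at
    -- `k` supplies the k-th value of a computable DNC sequence.
    G-computes-no-DNC : f ∉ DNC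
    G-computes-no-DNC dnc = go (G-meets hitsF)
      where
      go : (∃[ v ] Hits G (fs v) (sn v)) ⊎
           (∃[ N ] ∀ y → y ∈ points 2^ℕ → Agree N G y → ∀ v → ¬ Hits y (fs v) (sn v)) → ⊥
      go (inj₁ (v , hits))   = G-hits hits dnc
      go (inj₂ (N , avoids)) = dnc-not-computable (y-computable N avoids′) (y-dnc N avoids′)
        where
        avoids′ : ∀ y → y ∈ points 2^ℕ → Agree N G y → ∀ k s → ¬ Hits y k s
        avoids′ y y₂ a k s hits = avoids y y₂ a (pr k s)
          (subst₂ (Hits y) (sym (fs-pr k s)) (sym (sn-pr k s)) hits)

  -- Learners

  ↾-agree : ∀ {n x y} → Agree n x y → x ↾ n ≡ y ↾ n
  ↾-agree {zero}  a = refl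
  ↾-agree {suc n} a = cong₂ _∷_ (a 0 (s≤s z≤n)) (↾-agree λ i i<n → a (suc i) (s≤s i<n))

  IsΨ-unique : ∀ {e Ψ Ψ′} → IsΨ e Ψ → IsΨ e Ψ′ → ∀ τ → Ψ τ ≡ Ψ′ τ
  IsΨ-unique p q τ = run-unique (p τ) (q τ)

  guess : (List ℕ → ℕ) → Baire → Vec ℕ 1 → ℕ
  guess Ψ g (n ∷ []) = Ψ (g ↾ n)

  -- The learner's program is run with the zero oracle; the actual oracle enters only through the
  -- prefix.
  guess-computable : ∀ {e Ψ} → IsΨ e Ψ → Computable (guess Ψ)
  guess-computable {e} {Ψ} isΨ = go (run-code (isΨ []))
    where
    go : IsCode e → Computable (guess Ψ)
    go (c , eq) = computable (comp (compose const0 c) (code prefix-computable)) λ { {g} (n ∷ []) →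
      comp (correct prefix-computable {g} (n ∷ []))
        (run-compose (λ _ → const0) (let s , halts = run-complete (isΨ (g ↾ n)) in
          E-sound c (subst (λ e → E 𝟎 s e ⌜ g ↾ n ⌝ ≡ _) (sym eq) halts))) }

  lim-unique : ∀ {f l l′} → Lim f l → Lim f l′ → l ≡ l′
  lim-unique (N , h) (M , k) = trans (sym (h (N ⊔ M) (m≤m⊔n N M))) (k (N ⊔ M) (m≤n⊔m N M))

  pointwise-[1,ω] : Pointwise [1,ω]-computable
  pointwise-[1,ω] Γ (Ψ , _ , h) Γgf = let l , _ , Φgf = h _ _ Γgf in l , Φgf

  pointwise-[<ω,ω] : Pointwise [<ω,ω]-computable
  pointwise-[<ω,ω] Γ (b , h) Γgf = let _ , _ , _ , _ , l , _ , Φgf = h _ _ Γgf in l , Φgf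

  -- Σ⁰₃ sets and (<ω,ω)-degrees

  -- As the approximation converges, it agrees with `x i` at arbitrarily late stages only if `x i`
  -- is the value of `G`. This is Π⁰₂, and the leading quantifier over `j` makes it Σ⁰₃.
  approachesF : Form 3
  approachesF = fsT (var 1F) <̇ var 0F ∨̇ (snT (var 1F) <̇ sucT (var 2F) ∧̇
    app approximation-computable (var 2F ∷ fsT (var 1F) ∷ []) ≈̇ query (fsT (var 1F)))

  EventuallyG : Pred Baire 0ℓ
  EventuallyG = points 2^ℕ ∩ λ x → ∃∀ 3 (⊨ approachesF x)

  approached : ∀ g {n v} → (∀ s → ∃[ t ] s < suc t × approximation g (t ∷ n ∷ []) ≡ v) → v ≡ G n
  approached g {n} h =
    let s , settles  = G-limit g n
        t , s<t , eq = h s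
    in trans (sym eq) (settles t (s≤s⁻¹ s<t))

  eventuallyG-agree : ∀ {x} → x ∈ EventuallyG → ∃[ j ] ∀ i → j ≤ i → x i ≡ G i
  eventuallyG-agree {x} (_ , j , h) = j , λ i j≤i → approached x λ s → case h (pr i s) of λ where
    (t , inj₁ i<j) → contradiction j≤i (<⇒≱ (subst (_< j) (fs-pr i s) i<j))
    (t , inj₂ (s<t , eq)) → t , subst (_< suc t) (sn-pr i s) s<t ,
      subst (λ i → approximation x (t ∷ i ∷ []) ≡ x i) (fs-pr i s) eq

  eventuallyG-intro : ∀ {x} j → x ∈ points 2^ℕ → (∀ i → j ≤ i → x i ≡ G i) → x ∈ EventuallyG
  eventuallyG-intro {x} j x₂ h = x₂ , j , λ n → case fs n <? j of λ where
    (yes n<j) → 0 , inj₁ n<j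
    (no n≮j)  → let t₀ , settles = G-limit x (fs n); t = t₀ ⊔ sn n in
      t , inj₂ (s≤s (m≤n⊔m t₀ (sn n)) , trans (settles t (m≤m⊔n t₀ (sn n))) (sym (h (fs n) (≮⇒≥ n≮j))))

  constant : Baire → Baire → Vec ℕ 1 → ℕ
  constant x g (n ∷ []) = x n

  constant-computable : ∀ {x} → ComputableReal x → Computable (constant x)
  constant-computable (c , run-c) = computable (comp c left) λ { (n ∷ []) → comp left-pr (run-c _ n) }

  computable-real : ∀ {x} → Computable (constant x) → ComputableReal x
  computable-real F = comp (code F) (pair idCode const0) , λ g n → comp (pair run-id const0) (correct F (n ∷ []))

  -- The finite variant is a term, so that a condition on the variant of `g` becomes a formula about
  -- `g`, to which genericity applies.
  patchT : ℕ → ℕ → Term 1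
  patchT w s = ifz (decide (var 0F <̇ lit s)) (query (var 0F)) (bitT (lit w) (var 0F))

  patch : ℕ → ℕ → Baire → Baire
  patch w s x i = eval (patchT w s) x (i ∷ [])

  patch-below : ∀ w s x → Agree s (bits w) (patch w s x)
  patch-below w s x i i<s = cong (ifz_then x i else bits w i) (sym (decide-yes (var 0F <̇ lit s) {x} {i ∷ []} i<s))

  patch-above : ∀ w s x i → s ≤ i → patch w s x i ≡ x i
  patch-above w s x i s≤i = cong (ifz_then x i else bits w i) (decide-no (var 0F <̇ lit s) {x} {i ∷ []} (≤⇒≯ s≤i))

  patch-binary : ∀ w s {x} → x ∈ points 2^ℕ → patch w s x ∈ points 2^ℕ
  patch-binary w s {x} x₂ i = case i <? s of λ where
    (yes i<s) → subst (_< 2) (patch-below w s x i i<s) (bits-binary w i)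
    (no i≮s)  → subst (_< 2) (sym (patch-above w s x i (≮⇒≥ i≮s))) (x₂ i)

  eventuallyG-special : Special EventuallyG
  eventuallyG-special {x} comp-x x∈S = go (eventuallyG-agree x∈S)
    where
    go : (∃[ j ] ∀ i → j ≤ i → x i ≡ G i) → ⊥
    go (j , h) = G-not-computable (computable-real (by-term
      (withOracle (app (constant-computable comp-x) (var 0F ∷ [])) (patchT ⌜ G ↾ j ⌝ j))
      λ { g (n ∷ []) → patched n }))
      where
      patched : ∀ n → patch ⌜ G ↾ j ⌝ j x n ≡ G n
      patched n = case n <? j of λ where
        (yes n<j) → trans (sym (patch-below ⌜ G ↾ j ⌝ j x n n<j)) (bits-prefix G-binary j n n<j)
        (no n≮j)  → trans (patch-above ⌜ G ↾ j ⌝ j x n (≮⇒≥ n≮j)) (h n (≮⇒≥ n≮j))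

  module _ {P : Pred Baire 0ℓ} (Π : Π⁰ 1 2^ℕ P) (special : Special P) where

    private
      Fails Alternates Defeated : ℕ → Condition
      Fails e x s = ∀ y → y ∈ points 2^ℕ → Agree s x y → ∀ Ψ f → IsΨ e Ψ → Identifies Ψ y f → f ∉ P
      Alternates e x s = ∃[ Ψ ] IsΨ e Ψ × (∀ y n → y ∈ points 2^ℕ → s ≤ n → Agree s x y →
        ∃[ z ] ∃[ m ] z ∈ points 2^ℕ × Agree n y z × n ≤ m × Ψ (z ↾ m) ≢ Ψ (z ↾ n))
      Defeated e x s = Fails e x s ⊎ Alternates e x s

      defeated-persistent : ∀ e → Persistent (Defeated e)
      defeated-persistent e s≤s′ a (inj₁ fails) = inj₁ λ y y₂ b → fails y y₂ (agree-trans a (agree-≤ s≤s′ b))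
      defeated-persistent e s≤s′ a (inj₂ (Ψ , isΨ , alt)) = inj₂ (Ψ , isΨ , λ y n y₂ s′≤n b →
        alt y n y₂ (≤-trans s≤s′ s′≤n) (agree-trans a (agree-≤ s≤s′ b)))

      constant-fails : ∀ {e Ψ x s l} → IsΨ e Ψ →
        (∀ z m → z ∈ points 2^ℕ → Agree s x z → s ≤ m → Ψ (z ↾ m) ≡ l) → Forces l P x s → Fails e x s
      constant-fails {s = s} isΨ const forced y y₂ a Ψ′ f isΨ′ (l′ , lim , Φyf) =
        forced y y₂ a f (subst (λ l → Φ l y f) (sym (lim-unique
          (s , λ m s≤m → trans (IsΨ-unique isΨ′ isΨ (y ↾ m)) (const y m y₂ a s≤m)) lim)) Φyf)

      defeated-dense : ∀ e → Dense (Defeated e)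
      defeated-dense e {x} s x₂ = go (dec (∃[ Ψ ] IsΨ e Ψ))
        where
        Goal : Set
        Goal = ∃[ x′ ] ∃[ s′ ] x′ ∈ points 2^ℕ × s ≤ s′ × Agree s x x′ × Defeated e x′ s′

        settle : ∀ {Ψ} → IsΨ e Ψ → ∀ y n → y ∈ points 2^ℕ → s ≤ n → Agree s x y →
          (∀ z m → z ∈ points 2^ℕ → Agree n y z → n ≤ m → Ψ (z ↾ m) ≡ Ψ (z ↾ n)) → Goal
        settle {Ψ} isΨ y n y₂ s≤n a const =
          -- All extensions of `y ↾ n` keep the guess made there, so on them the learner amounts to
          -- one functional, which can be forced out of `P`.
          let x′ , s′ , x′₂ , n≤s′ , b , forced = force Π special (Ψ (y ↾ n)) y₂ n in
          x′ , s′ , x′₂ , ≤-trans s≤n n≤s′ , agree-trans a (agree-≤ s≤n b) ,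
          inj₁ (constant-fails isΨ (λ z m z₂ c s′≤m →
            let yz = agree-trans b (agree-≤ n≤s′ c) in
            trans (const z m z₂ yz (≤-trans n≤s′ s′≤m)) (cong Ψ (sym (↾-agree yz)))) forced)

        go : Dec (∃[ Ψ ] IsΨ e Ψ) → Goal
        go (no ¬Ψ) = x , s , x₂ , ≤-refl , agree-refl , inj₁ λ _ _ _ Ψ _ isΨ → contradiction (Ψ , isΨ) ¬Ψ
        go (yes (Ψ , isΨ)) = dne λ ¬goal → ¬goal
          (x , s , x₂ , ≤-refl , agree-refl , inj₂ (Ψ , isΨ , λ y n y₂ s≤n a → dne λ ¬alt → ¬goal
            (settle isΨ y n y₂ s≤n a λ z m z₂ b n≤m → dne λ ≢ → ¬alt (z , m , z₂ , b , n≤m , ≢))))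

      -- G is generic enough to follow the mind changes of a learner that
      -- alternates densely.
      alternates-diverges : ∀ {e x s Ψ} → x ∈ points 2^ℕ → Alternates e x s → IsΨ e Ψ → ∀ l →
        ¬ Lim (λ n → Ψ (patch ⌜ x ↾ s ⌝ s G ↾ n)) l
      alternates-diverges {e} {x} {s} {Ψ} x₂ (Ψ′ , isΨ′ , alt) isΨ l (M , lim) = go (G-meets changesF)
        where
        w : ℕ
        w = ⌜ x ↾ s ⌝

        changesF : Form 1
        changesF = lit (s ⊔ M) <̇ sucT (var 0F) ∧̇
          ¬̇ (withOracle (inst (patchT w s) (var 0F ∷ [])) (app (guess-computable isΨ) (var 0F ∷ [])) ≈̇ lit l)

        Changes : Baire → ℕ → Set
        Changes g v = s ⊔ M < suc v × Ψ (patch w s g ↾ v) ≢ l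

        go : (∃[ v ] Changes G v) ⊎
             (∃[ N ] ∀ g → g ∈ points 2^ℕ → Agree N G g → ∀ v → ¬ Changes g v) → ⊥
        go (inj₁ (v , sM≤v , ≢l)) = ≢l (lim v (≤-trans (m≤n⊔m s M) (s≤s⁻¹ sM≤v)))
        go (inj₂ (N , avoids)) =
          let n = N ⊔ (s ⊔ M)
              s≤n = ≤-trans (m≤m⊔n s M) (m≤n⊔m N (s ⊔ M))
              z , m , z₂ , a , n≤m , ≢ = alt (patch w s G) n (patch-binary w s G-binary) s≤n
                (agree-trans (agree-sym (bits-prefix x₂ s)) (patch-below w s G))
              -- Patching `g` gives `z`, while `g` itself extends the prefix `G ↾ N`. So the mind
              -- change on `z` would be a change on `g`, which `avoids` excludes.
              g = splice G s z
              same : ∀ i → patch w s g i ≡ z i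
              same i = case i <? s of λ where
                (yes i<s) → trans (sym (patch-below w s g i i<s))
                  (trans (patch-below w s G i i<s) (a i (<-≤-trans i<s s≤n)))
                (no i≮s)  → trans (patch-above w s g i (≮⇒≥ i≮s)) (splice-beyond G s z i (≮⇒≥ i≮s))
              g-agree : Agree N G g
              g-agree i i<N = case i <? s of λ where
                (yes i<s) → splice-agree G s z i i<s
                (no i≮s)  → trans (sym (patch-above w s G i (≮⇒≥ i≮s)))
                  (trans (a i (<-≤-trans i<N (m≤m⊔n N _))) (sym (splice-beyond G s z i (≮⇒≥ i≮s))))
              settled-at : ∀ k → n ≤ k → Ψ′ (z ↾ k) ≡ l
              settled-at k n≤k = trans (IsΨ-unique isΨ′ isΨ (z ↾ k))
                (trans (cong Ψ (↾-agree {k} λ i _ → sym (same i)))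
                  (dne λ ≢l → avoids g (splice-binary s G-binary z₂) g-agree k
                    (s≤s (≤-trans (m≤n⊔m N (s ⊔ M)) n≤k) , ≢l)))
          in ≢ (trans (settled-at m n≤m) (sym (settled-at n ≤-refl)))

    special-not-below-eventuallyG : ∀ {Q} → ¬ (P ≤[ [<ω,ω]-computable ] (EventuallyG ∪ Q))
    special-not-below-eventuallyG (Γ , (b , h) , ⊆dom , maps) =
      let x , s , x₂ , _ , _ , defeated =
            dense-all {Defeated} defeated-dense defeated-persistent b {𝟎} 0 (λ _ → s≤s z≤n)
          w   = ⌜ x ↾ s ⌝
          y   = patch w s G
          y₂  = patch-binary w s G-binary
          y∈S = eventuallyG-intro s y₂ (patch-above w s G)
          f , Γyf = ⊆dom (inj₁ y∈S)
          e , e<b , Ψ , isΨ , identifies@(l , lim , _) = h y f Γyf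
      in case defeated e e<b of λ where
        (inj₁ fails) → fails y y₂ (agree-trans (agree-sym (bits-prefix x₂ s)) (patch-below w s G)) Ψ f isΨ identifies
          (maps y f (inj₁ y∈S) Γyf)
        (inj₂ alternates) → alternates-diverges x₂ alternates isΨ l lim

  not-SEL-Σ₃ : ¬ SEL (Σ⁰ 3) 2^ℕ [<ω,ω]-computable
  not-SEL-Σ₃ sel =
    let P , Π , P≤S∪Q , S∪Q≤P = sel EventuallyG DNC₂ (Σ-intro 2^ℕ approachesF) dnc₂-closed dnc-satisfiable
    in special-not-below-eventuallyG Π
         (special-above pointwise-[<ω,ω] S∪Q≤P λ where
           comp-x (inj₁ x∈S)       → eventuallyG-special comp-x x∈S
           comp-x (inj₂ (_ , dnc)) → dnc-not-computable comp-x dnc)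
         P≤S∪Q

  -- Π⁰₂ sets and (1,ω)-degrees

  module _ {T : Baire → ℕ → Set}
    (continuous : ∀ {x y s} → Agree s x y → T x s → T y s)
    (monotone   : ∀ {x s s′} → s ≤ s′ → T x s → T x s′)
    (bar        : ∀ x → x ∈ points 2^ℕ → ∃[ s ] T x s)
    where

    private
      Barred : Baire → ℕ → Set
      Barred x n = ∃[ s ] ∀ y → y ∈ points 2^ℕ → Agree n x y → T y s

      extend : Baire → ℕ → ℕ → Baire
      extend x n b = splice x n λ _ → b

      extend-agree : ∀ {x y n b} → Agree n x y → y n ≡ b → Agree (suc n) (extend x n b) y
      extend-agree {x} {y} {n} {b} a yn≡b i i≤n = case m≤n⇒m<n∨m≡n i≤n of λ where
        (inj₁ (s≤s i<n)) → trans (sym (splice-agree x n (λ _ → b) i i<n)) (a i i<n)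
        (inj₂ refl)      → trans (splice-beyond x n (λ _ → b) n ≤-refl) (sym yn≡b)

      barred-join : ∀ {x n} → Barred (extend x n 0) (suc n) → Barred (extend x n 1) (suc n) → Barred x n
      barred-join {x} {n} (s , h) (t , k) = s ⊔ t , λ y y₂ a → go y y₂ a (y n) refl (y₂ n)
        where
        go : ∀ y → y ∈ points 2^ℕ → Agree n x y → ∀ b → y n ≡ b → b < 2 → T y (s ⊔ t)
        go y y₂ a 0 eq _ = monotone (m≤m⊔n s t) (h y y₂ (extend-agree a eq))
        go y y₂ a 1 eq _ = monotone (m≤n⊔m s t) (k y y₂ (extend-agree a eq))
        go y y₂ a (suc (suc _)) eq (s≤s (s≤s ()))

      Unbarred : ℕ → Set
      Unbarred n = ∃[ x ] x ∈ points 2^ℕ × ¬ Barred x n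

      unbarred-next : ∀ {n} (u : Unbarred n) → Σ (Unbarred (suc n)) λ v → Agree n (proj₁ u) (proj₁ v)
      unbarred-next {n} (x , x₂ , ¬b) = case dec (Barred (extend x n 0) (suc n)) of λ where
        (no ¬b₀) → (extend x n 0 , splice-binary n x₂ (λ _ → s≤s z≤n) , ¬b₀) , splice-agree x n _
        (yes b₀) → (extend x n 1 , splice-binary n x₂ (λ _ → s≤s (s≤s z≤n)) , λ b₁ → ¬b (barred-join b₀ b₁)) ,
                   splice-agree x n _

      module _ (¬bar : ¬ Barred 𝟎 0) where

        branch : ∀ n → Unbarred n
        branch zero    = 𝟎 , (λ _ → s≤s z≤n) , ¬bar
        branch (suc n) = proj₁ (unbarred-next (branch n))

        path : Baire
        path i = proj₁ (branch (suc i)) i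

        branch-agree : ∀ n k → Agree n (proj₁ (branch n)) (proj₁ (branch (k + n)))
        branch-agree n zero    = agree-refl
        branch-agree n (suc k) = agree-trans (branch-agree n k)
          (agree-≤ (m≤n+m n k) (proj₂ (unbarred-next (branch (k + n)))))

        path-agree : ∀ n → Agree n (proj₁ (branch n)) path
        path-agree n i i<n = sym (subst (λ n → path i ≡ proj₁ (branch n) i) (m∸n+n≡m i<n)
          (branch-agree (suc i) (n ∸ suc i) i (n<1+n i)))

        path-binary : path ∈ points 2^ℕ
        path-binary i = proj₁ (proj₂ (branch (suc i))) i

        absurd : ⊥
        absurd = let s , t = bar path path-binary in
          proj₂ (proj₂ (branch s)) (s , λ y y₂ a →
            continuous (agree-trans (agree-sym (path-agree s)) a) t)

    -- König's lemma: an unbarred string has an unbarred successor, and along the resulting path `T`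
    -- would hold at no level.
    fan : ∃[ s ] ∀ x → x ∈ points 2^ℕ → T x s
    fan = let s , h = dne absurd in s , λ x x₂ → h x x₂ λ _ ()

  onePrefixedF : Form 2
  onePrefixedF = query (lit 0) ≈̇ lit 1 ∧̇ snT (var 0F) <̇ sucT (var 1F) ∧̇
    app approximation-computable (var 1F ∷ fsT (var 0F) ∷ []) ≈̇ query (sucT (fsT (var 0F)))

  zeroPrefixedF : Form 1
  zeroPrefixedF = query (lit 0) ≈̇ lit 0 ∧̇ dncF (query (sucT (fsT (var 0F)))) (var 0F)

  -- The first bit separates the two sets, so a single value of a functional shows into which of
  -- them it maps.
  OneG ZeroDNC : Pred Baire 0ℓ
  OneG    = points 2^ℕ ∩ λ x → ∀∃ 2 (⊨ onePrefixedF x)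
  ZeroDNC = points 2^ℕ ∩ λ x → ∀∃ 1 (⊨ zeroPrefixedF x)

  cons : ℕ → Baire → Baire
  cons b x zero    = b
  cons b x (suc n) = x n

  cons-binary : ∀ {b x} → b < 2 → x ∈ points 2^ℕ → cons b x ∈ points 2^ℕ
  cons-binary b<2 x₂ zero    = b<2
  cons-binary b<2 x₂ (suc n) = x₂ n

  oneG : cons 1 G ∈ OneG
  oneG = cons-binary (s≤s (s≤s z≤n)) G-binary , λ n →
    let t₀ , settles = G-limit (cons 1 G) (fs n); t = t₀ ⊔ sn n in
    t , refl , s≤s (m≤n⊔m t₀ (sn n)) , settles t (m≤m⊔n t₀ (sn n))

  oneG-elim : ∀ {x} → x ∈ OneG → x 0 ≡ 1 × (∀ i → x (suc i) ≡ G i)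
  oneG-elim {x} (_ , h) = proj₁ (proj₂ (h 0)) , λ i → approached x λ s →
    let t , _ , s<t , eq = h (pr i s) in
    t , subst (_< suc t) (sn-pr i s) s<t , subst (λ i → approximation x (t ∷ i ∷ []) ≡ x (suc i)) (fs-pr i s) eq

  zeroDNC-satisfiable : Satisfiable ZeroDNC
  zeroDNC-satisfiable = let q , q₂ , dnc = dnc-satisfiable in
    cons 0 q , cons-binary (s≤s z≤n) q₂ , λ n → refl , dnc (fs n) (sn n)

  zeroDNC-elim : ∀ {x} → x ∈ ZeroDNC → x 0 ≡ 0 × (x ∘ suc) ∈ DNC
  zeroDNC-elim (_ , h) = proj₁ (h 0) , dnc-form λ n → proj₂ (h n)

  stringsBelow : Baire → Vec ℕ 1 → ℕ
  stringsBelow g (s ∷ []) = strings s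

  stringsBelow-computable : Computable stringsBelow
  stringsBelow-computable = by-term
    (rec (lit 1) (sucT (sucT (prT (lit 1) (var 1F)))) (var 0F)) λ { g (s ∷ []) → refl }

  -- By compactness, G k is the only v for which some level s certifies that every
  -- binary x is refuted as a member of P, makes Ψ leave l after N, or is mapped by
  -- l to a sequence that starts with 0 or takes the value v at k + 1.
  module _ {P : Pred Baire 0ℓ} (Π : Π⁰ 1 2^ℕ P) {e : ℕ} {Ψ : List ℕ → ℕ} (isΨ : IsΨ e Ψ) (l N : ℕ)
    {z : Baire} (z∈P : z ∈ P) (z-settled : ∀ n → N ≤ n → Ψ (z ↾ n) ≡ l)
    {f : Baire} (Φzf : Φ l z f) (f0≡1 : f 0 ≡ 1) (f≡G : ∀ i → f (suc i) ≡ G i)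
    (others : ∀ {x} → x ∈ P → (∀ n → N ≤ n → Ψ (x ↾ n) ≡ l) →
      ∃[ h ] Φ l x h × (h 0 ≡ 0 ⊎ (∀ i → h (suc i) ≡ G i)))
    where

    private
      I : Index ∀∃ 1 2^ℕ P
      I = Π-index {X = 2^ℕ} Π

      z₂ : z ∈ points 2^ℕ
      z₂ = S⊆points I z∈P

      Cert : Baire → ℕ → ℕ → ℕ → Set
      Cert x v k s =
        (∃[ j ] j < s × E x s (index I) (lst (j ∷ [])) ≡ 1) ⊎
        (∃[ m ] m < s × N < suc m × Ψ (x ↾ m) ≢ l) ⊎
        E x s l 0 ≡ 1 ⊎
        E x s l (suc k) ≡ suc v

      certF : Form 3
      certF =
        ∃̇< (var 2F) (ET (var 3F) (lit (index I)) (lstT (var 0F ∷ [])) ≈̇ lit 1) ∨̇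
        ∃̇< (var 2F) (lit N <̇ sucT (var 0F) ∧̇ ¬̇ (app (guess-computable isΨ) (var 0F ∷ []) ≈̇ lit l)) ∨̇
        ET (var 2F) (lit l) (lit 0) ≈̇ lit 1 ∨̇
        ET (var 2F) (lit l) (sucT (var 1F)) ≈̇ sucT (var 0F)

      cert-continuous : ∀ {v k x y s} → Agree s x y → Cert x v k s → Cert y v k s
      cert-continuous a (inj₁ (j , j<s , eq)) = inj₁ (j , j<s , trans (sym (E-agree a _ _)) eq)
      cert-continuous a (inj₂ (inj₁ (m , m<s , N≤m , ≢))) =
        inj₂ (inj₁ (m , m<s , N≤m , λ eq → ≢ (trans (cong Ψ (↾-agree (agree-≤ (<⇒≤ m<s) a))) eq)))
      cert-continuous a (inj₂ (inj₂ (inj₁ eq))) = inj₂ (inj₂ (inj₁ (trans (sym (E-agree a _ _)) eq)))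
      cert-continuous a (inj₂ (inj₂ (inj₂ eq))) = inj₂ (inj₂ (inj₂ (trans (sym (E-agree a _ _)) eq)))

      cert-monotone : ∀ {v k x s s′} → s ≤ s′ → Cert x v k s → Cert x v k s′
      cert-monotone s≤s′ (inj₁ (j , j<s , eq)) = inj₁ (j , <-≤-trans j<s s≤s′ , E-mono s≤s′ eq)
      cert-monotone s≤s′ (inj₂ (inj₁ (m , m<s , rest))) = inj₂ (inj₁ (m , <-≤-trans m<s s≤s′ , rest))
      cert-monotone s≤s′ (inj₂ (inj₂ (inj₁ eq))) = inj₂ (inj₂ (inj₁ (E-mono s≤s′ eq)))
      cert-monotone s≤s′ (inj₂ (inj₂ (inj₂ eq))) = inj₂ (inj₂ (inj₂ (E-mono s≤s′ eq)))

      cert-bar : ∀ k x → x ∈ points 2^ℕ → ∃[ s ] Cert x (G k) k s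
      cert-bar k x x₂ = dne λ ¬cert →
        let x∈P : x ∈ P
            x∈P = member I x₂ λ j s eq → ¬cert (s ⊔ suc j , inj₁ (j , m≤n⊔m s (suc j) , E-mono (m≤m⊔n s (suc j)) eq))
            settled-on-l : ∀ n → N ≤ n → Ψ (x ↾ n) ≡ l
            settled-on-l n N≤n = dne λ ≢ → ¬cert (suc n , inj₂ (inj₁ (n , ≤-refl , s≤s N≤n , ≢)))
            h , Φxh , either = others x∈P settled-on-l
        in case either of λ where
          (inj₁ h0≡0) → let s , eq = run-complete (Φxh 0) in
            ¬cert (s , inj₂ (inj₂ (inj₁ (trans eq (cong suc h0≡0)))))
          (inj₂ h≡G)  → let s , eq = run-complete (Φxh (suc k)) in
            ¬cert (s , inj₂ (inj₂ (inj₂ (trans eq (cong suc (h≡G k))))))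

      cert-correct : ∀ {v k s} → Cert z v k s → v ≡ G k
      cert-correct (inj₁ (j , _ , eq)) = contradiction eq (unrefuted I z∈P j _)
      cert-correct (inj₂ (inj₁ (m , _ , N≤m , ≢))) = contradiction (z-settled m (s≤s⁻¹ N≤m)) ≢
      cert-correct {s = s} (inj₂ (inj₂ (inj₁ eq))) =
        contradiction (trans (sym f0≡1) (run-unique (Φzf 0) (run-sound (Φ-code Φzf) eq))) 1+n≢0
      cert-correct {k = k} (inj₂ (inj₂ (inj₂ eq))) =
        trans (run-unique (run-sound (Φ-code Φzf) eq) (Φzf (suc k))) (f≡G k)

      -- `q` pairs a value with a level. The numbers below `strings` include codes of all binary
      -- strings of that length, so a finite check covers every binary sequence.
      Certified : ℕ → ℕ → Set
      Certified k q = ∀ w → w < strings (sn q) → eval (decide certF) (bits w) (fs q ∷ k ∷ sn q ∷ []) ≡ 1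

      certifiedF : Form 2
      certifiedF = ∀̇< (app stringsBelow-computable (snT (var 0F) ∷ []))
        (withOracle (bitT (var 1F) (var 0F))
          (inst (decide certF) (fsT (var 1F) ∷ var 2F ∷ snT (var 1F) ∷ [])) ≈̇ lit 1)

      certified : ∀ k → ∃[ q ] Certified k q
      certified k = let s , h = fan (cert-continuous {G k} {k}) cert-monotone (cert-bar k) in
        pr (G k) s , λ w _ → decide-yes certF {bits w} {fs (pr (G k) s) ∷ k ∷ sn (pr (G k) s) ∷ []}
          (subst₂ (λ v s → Cert (bits w) v k s) (sym (fs-pr _ _)) (sym (sn-pr _ _)) (h (bits w) (bits-binary w)))

      -- The point `z` admits none of the excuses: it lies in `P`, keeps the learner at `l` and is
      -- mapped to a sequence starting with 1. So the certificate on its prefix must show the true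
      -- value.
      certified-correct : ∀ {k q} → Certified k q → fs q ≡ G k
      certified-correct {k} {q} h = cert-correct {s = sn q} (cert-continuous (bits-prefix z₂ (sn q))
        (decide-yes⁻¹ certF {bits w} {fs q ∷ k ∷ sn q ∷ []}
          (λ eq → 1+n≢0 (trans (sym (h w (⌜↾⌝<strings z₂ (sn q)))) eq))))
        where
        w : ℕ
        w = ⌜ z ↾ sn q ⌝

    G-would-be-computable : ComputableReal G
    G-would-be-computable = comp left (comp (searchCode certifiedF) (pair idCode const0)) , λ g k →
      let q , h , below = minimal {Certified k} (proj₂ (certified k)) in
      comp (comp (pair run-id const0) (run-search certifiedF {g} {k ∷ []} h below))
        (to (certified-correct {k} {q} h) left)

  relative-Φ : ∀ {h g x e f} → (∀ n → g ⊢ h ∶ n ⇒ x n) → Φ e x f → ∃[ c ] ∀ n → g ⊢ c ∶ n ⇒ f n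
  relative-Φ {h} {g} {x} {e} {f} run-h p = go (Φ-code p)
    where
    go : IsCode e → ∃[ c ] ∀ n → g ⊢ c ∶ n ⇒ f n
    go (c , eq) = compose h c , λ n → run-compose run-h
      (let s , halts = run-complete (p n) in E-sound c (subst (λ e → E x s e n ≡ suc (f n)) (sym eq) halts))

  consT : Term 1
  consT = ifz (var 0F) (lit 1) (query (predT (var 0F)))

  consCode : Code
  consCode = comp (compile consT) (pair idCode const0)

  run-cons : ∀ g n → g ⊢ consCode ∶ n ⇒ cons 1 g n
  run-cons g zero    = comp (pair run-id const0) (run-compile consT (0 ∷ []))
  run-cons g (suc n) = comp (pair run-id const0) (run-compile consT (suc n ∷ []))

  no-closed-equivalent : ∀ {P} → Π⁰ 1 2^ℕ P → ¬ (P ≡[ [1,ω]-computable ] (OneG ∪ ZeroDNC))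
  no-closed-equivalent {P} Π (P≤S∪Q , (Γ , (Ψ , (e , isΨ) , h) , ⊆dom , maps)) =
    let Δ , Δ-comp , ⊆domΔ , mapsΔ = P≤S∪Q
        z , Δz = ⊆domΔ (inj₁ oneG)
        z∈P    = mapsΔ (cons 1 G) z (inj₁ oneG) Δz
        _ , Φz = pointwise-[1,ω] Δ Δ-comp Δz
        c , run-z = relative-Φ (run-cons G) Φz
        f , Γzf = ⊆dom z∈P
        l , (N , settles) , Φzf = h z f Γzf
    in case maps z f z∈P Γzf of λ where
      (inj₁ f∈S) → let f0≡1 , f≡G = oneG-elim f∈S in
        G-not-computable (G-would-be-computable Π isΨ l N z∈P settles Φzf f0≡1 f≡G λ {x} x∈P x-settles →
          let k , Γxk = ⊆dom x∈P
              _ , lim , Φxk = h x k Γxk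
          in k , subst (λ l → Φ l x k) (lim-unique lim (N , x-settles)) Φxk ,
             (case maps x k x∈P Γxk of λ where
               (inj₁ k∈S) → inj₂ (proj₂ (oneG-elim k∈S))
               (inj₂ k∈Q) → inj₁ (proj₁ (zeroDNC-elim k∈Q))))
      (inj₂ f∈Q) → let d , run-f = relative-Φ run-z Φzf in
        G-computes-no-DNC {comp d succ} (λ n → comp succ (run-f (suc n))) (proj₂ (zeroDNC-elim f∈Q))

  not-SEL-Π₂ : ¬ SEL (Π⁰ 2) 2^ℕ [1,ω]-computable
  not-SEL-Π₂ sel =
    let P , Π , equivalent =
          sel OneG ZeroDNC (Π-intro 2^ℕ onePrefixedF) (Π-intro 2^ℕ zeroPrefixedF) zeroDNC-satisfiable
    in no-closed-equivalent Π equivalent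

  -- Building reductions

  identifies-≗ : ∀ Ψ {g g′ f f′} → g ≗ g′ → f ≗ f′ → Identifies Ψ g f → Identifies Ψ g′ f′
  identifies-≗ Ψ g≗g′ f≗f′ (l , (N , lim) , Φgf) =
    l , (N , λ n N≤n → trans (cong Ψ (↾-agree {n} λ i _ → sym (g≗g′ i))) (lim n N≤n)) , Φ-≗ g≗g′ f≗f′ Φgf

  identifies-functional : ∀ Ψ {g f f′} → Identifies Ψ g f → Identifies Ψ g f′ → f ≗ f′
  identifies-functional Ψ {g} {f} (l , lim , Φgf) (l′ , lim′ , Φgf′) =
    Φ-unique (subst (λ l → Φ l g f) (lim-unique lim lim′) Φgf) Φgf′

  -- The graph consists of everything that the learner identifies, also outside `B`, so that
  -- computability is immediate. Values are unique only up to `≗`, hence the extensionality of `A`.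
  reduce-by-learner : ∀ {A B Ψ} → Extensional A → Learner Ψ →
    (∀ {g} → g ∈ B → ∃[ f ] f ∈ A × Identifies Ψ g f) → A ≤[ [1,ω]-computable ] B
  reduce-by-learner {A} {B} {Ψ} A-ext learner works =
    Γ , (Ψ , learner , λ _ _ → id) , (λ g∈B → let f , _ , i = works g∈B in f , i) ,
    λ g f g∈B i → let f′ , f′∈A , i′ = works g∈B in A-ext (identifies-functional Ψ i′ i) f′∈A
    where
    Γ : PartialFunction
    Γ = record { Graph = Identifies Ψ ; functional = identifies-functional Ψ ; respects-≗ = identifies-≗ Ψ }

  IdentifiedBy : ℕ → Baire → Baire → Set
  IdentifiedBy e g f = ∃[ Ψ ] IsΨ e Ψ × Identifies Ψ g f

  module _ {A B : Pred Baire 0ℓ} (A-ext : Extensional A) (b : ℕ) where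

    private
      identifiedBy-functional : ∀ {e g f f′} → IdentifiedBy e g f → IdentifiedBy e g f′ → f ≗ f′
      identifiedBy-functional {g = g} {f} (Ψ , isΨ , l , (N , lim) , Φgf) (Ψ′ , isΨ′ , i′) = identifies-functional Ψ′
        (l , (N , λ n N≤n → trans (IsΨ-unique isΨ′ isΨ (g ↾ n)) (lim n N≤n)) , Φgf) i′

      Works : ℕ → Baire → Set
      Works e g = ∃[ f ] f ∈ A × IdentifiedBy e g f

      works-≗ : ∀ {e g g′} → g ≗ g′ → Works e g → Works e g′
      works-≗ eq (f , f∈A , Ψ , isΨ , i) = f , f∈A , Ψ , isΨ , identifies-≗ Ψ eq (λ _ → refl) i

      -- The first index that works is used, which makes the graph functional.
      Chosen : Baire → Baire → Set
      Chosen g f = ∃[ e ] e < b × Works e g × (∀ d → d < e → ¬ Works d g) × IdentifiedBy e g f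

      chosen-functional : ∀ {g f f′} → Chosen g f → Chosen g f′ → f ≗ f′
      chosen-functional (e , _ , w , below , i) (e′ , _ , w′ , below′ , i′) with <-cmp e e′
      ... | tri< e<e′ _ _ = contradiction w (below′ e e<e′)
      ... | tri≈ _ refl _ = identifiedBy-functional i i′
      ... | tri> _ _ e′<e = contradiction w′ (below e′ e′<e)

      Γ : PartialFunction
      Γ = record
        { Graph      = Chosen
        ; functional = chosen-functional
        ; respects-≗ = λ g≗g′ f≗f′ (e , e<b , w , below , Ψ , isΨ , i) →
            e , e<b , works-≗ g≗g′ w , (λ d d<e w′ → below d d<e (works-≗ (λ n → sym (g≗g′ n)) w′)) ,
            Ψ , isΨ , identifies-≗ Ψ g≗g′ f≗f′ i
        }

    reduce-by-learners : (∀ {g} → g ∈ B → ∃[ e ] e < b × (∃[ f ] f ∈ A × IdentifiedBy e g f)) →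
      A ≤[ [<ω,ω]-computable ] B
    reduce-by-learners works =
      Γ , (b , λ g f (e , e<b , _ , _ , i) → e , e<b , i) , (λ {g} → total {g}) ,
      λ { g f g∈B (e , _ , (f′ , f′∈A , i′) , _ , i) → A-ext (identifiedBy-functional i′ i) f′∈A }
      where
      total : ∀ {g} → g ∈ B → ∃[ f ] Chosen g f
      total {g} g∈B =
        let e , e<b , w = works g∈B
            d , v@(f , _ , i) , below = minimal {λ e → Works e g} w
        in f , d , ≤-<-trans (≮⇒≥ λ e<d → below e e<d w) e<b , v , below , i

  ∪-ext : ∀ {A B} → Extensional A → Extensional B → Extensional (A ∪ B)
  ∪-ext A-ext B-ext eq (inj₁ x∈A) = inj₁ (A-ext eq x∈A)
  ∪-ext A-ext B-ext eq (inj₂ x∈B) = inj₂ (B-ext eq x∈B)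

  -- Learners from local functionals, and computable indices

  dropped : ℕ → ℕ → ℕ
  dropped w = recur w λ _ u → sn (pred u)

  -- The length of the coded list, found as the number of tails taken before the code becomes 0. A
  -- list code is at least its length, so `suc w` bounds the search; `pred` undoes the offset of
  -- `firstBelow`.
  size : ℕ → ℕ
  size w = pred (firstBelow (λ i → ifz dropped w i then 1 else 0) (suc w))

  size-prefix : ∀ x n → size ⌜ x ↾ n ⌝ ≡ n
  size-prefix x n = cong pred (firstBelow-some⁻¹ _ (suc ⌜ x ↾ n ⌝) (s≤s (≤⌜↾⌝ x n))
    (λ eq → 1+n≢0 (trans (cong (ifz_then 1 else 0) (sym (end x n))) eq))
    λ j j<n → lemma (inside x n j j<n))
    where
    drop-cons : ∀ a r i → dropped (suc ⟨ a , r ⟩) (suc i) ≡ dropped r i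
    drop-cons a r zero    = trans (cong sn (sym (pr-def a r))) (sn-pr a r)
    drop-cons a r (suc i) = cong (λ u → sn (pred u)) (drop-cons a r i)

    end : ∀ x n → dropped ⌜ x ↾ n ⌝ n ≡ 0
    end x zero    = refl
    end x (suc n) = trans (drop-cons (x 0) _ n) (end (x ∘ suc) n)

    inside : ∀ x n j → j < n → ∃[ u ] dropped ⌜ x ↾ n ⌝ j ≡ suc u
    inside x (suc n) zero    _         = _ , refl
    inside x (suc n) (suc j) (s≤s j<n) = let u , eq = inside (x ∘ suc) n j j<n in
      u , trans (drop-cons (x 0) _ j) eq

    lemma : ∀ {d} → ∃[ u ] d ≡ suc u → (ifz d then 1 else 0) ≡ 0
    lemma (_ , refl) = refl

  sizeOf : Baire → Vec ℕ 1 → ℕ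
  sizeOf g (w ∷ []) = size w

  sizeOf-computable : Computable sizeOf
  sizeOf-computable = by-term
    (predT (firstT emptyT (sucT (var 0F))))
    λ { g (w ∷ []) → cong pred (eval-firstT emptyT (sucT (var 0F)) g (w ∷ [])) }
    where
    emptyT : Term 2
    emptyT = ifz (rec (var 1F) (snT (predT (var 1F))) (var 0F)) (lit 1) (lit 0)

  Local : (Baire → Vec ℕ 1 → ℕ) → Set
  Local f = ∀ {x y n} → Agree n x y → f x (n ∷ []) ≡ f y (n ∷ [])

  module _ {f : Baire → Vec ℕ 1 → ℕ} (F : Computable f) where

    private
      onString : Baire → Vec ℕ 1 → ℕ
      onString g (w ∷ []) = f (bits w) (size w ∷ [])

      onString-computable : Computable onString
      onString-computable = by-term
        (withOracle (bitT (var 1F) (var 0F)) (app F (app sizeOf-computable (var 0F ∷ []) ∷ [])))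
        λ { g (w ∷ []) → refl }

    learner : List ℕ → ℕ
    learner τ = f (bits ⌜ τ ⌝) (size ⌜ τ ⌝ ∷ [])

    opaque
      learnerIndex : ℕ
      learnerIndex = encode (comp (code onString-computable) (pair idCode const0))

      learner-isΨ : IsΨ learnerIndex learner
      learner-isΨ τ = run-⊢ (comp (pair run-id const0) (correct onString-computable (⌜ τ ⌝ ∷ [])))

    -- A learner sees only a string, which is padded by zeros to serve as oracle; locality makes the
    -- padding invisible.
    learner-prefix : Local f → ∀ {x} → x ∈ points 2^ℕ → ∀ n → learner (x ↾ n) ≡ f x (n ∷ [])
    learner-prefix local {x} x₂ n rewrite size-prefix x n = local (bits-prefix x₂ n)

  constantLearner : ∀ l → ∃[ e ] IsΨ e (λ _ → l)
  constantLearner l = encode (litCode l) , λ τ → run-⊢ (run-lit l)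

  constant-identifies : ∀ {l g f} → Φ l g f → Identifies (λ _ → l) g f
  constant-identifies {l} p = l , (0 , λ _ _ → refl) , p

  parameter : Code → ℕ → Code
  parameter c k = comp c (pair (litCode k) idCode)

  sectionCode : Term 2 → Code
  sectionCode t = comp (compile t) (pair left (pair right const0))

  opaque
    section : Term 2 → ℕ → ℕ
    section t k = encode (parameter (sectionCode t) k)

    Φ-section : ∀ t k g → Φ (section t k) g (λ m → eval t g (k ∷ m ∷ []))
    Φ-section t k g m = run-⊢ (comp (pair (run-lit k) run-id)
      (comp (pair left-pr (pair right-pr const0)) (run-compile t (k ∷ m ∷ []))))

  sectionIndex : Term 2 → Baire → Vec ℕ 1 → ℕ
  sectionIndex t g (k ∷ []) = section t k

  opaque
    unfolding section

    -- An instance of the s-m-n theorem: a learner must compute the index that belongs to its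
    -- current guess `k`.
    section-computable : ∀ t → Computable (sectionIndex t)
    section-computable t = by-term
      -- The code number of `parameter` spelled out, with tag 6 for `comp` and 5 for `pair`; only
      -- the numeral program depends on `k`.
      (prT (lit 6) (prT (lit (encode (sectionCode t))) (prT (lit 5) (prT litIndex (lit (encode idCode))))))
      λ { g (k ∷ []) → trans (cong (λ c → pr 6 (pr s (pr 5 (pr c i)))) (lit-index k)) (sym (unfolded k)) }
      where
      s i : ℕ
      s = encode (sectionCode t)
      i = encode idCode

      litIndex : Term 1
      litIndex = rec (lit (encode const0)) (prT (lit 6) (prT (lit (encode succ)) (var 1F))) (var 0F)

      lit-index : ∀ k → recur (encode const0) (λ _ u → pr 6 (pr (encode succ) u)) k ≡ encode (litCode k)
      lit-index zero    = refl
      lit-index (suc k) = trans (cong (λ u → pr 6 (pr (encode succ) u)) (lit-index k))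
        (sym (encode-comp succ (litCode k)))

      unfolded : ∀ k → encode (parameter (sectionCode t) k) ≡ pr 6 (pr s (pr 5 (pr (encode (litCode k)) i)))
      unfolded k = trans (encode-comp (sectionCode t) (pair (litCode k) idCode))
        (cong (λ p → pr 6 (pr s p)) (encode-pair (litCode k) idCode))

  -- Approximations to members of a closed set

  module Approximation {Q : Pred Baire 0ℓ} (Π : Π⁰ 1 2^ℕ Q) (Q-satisfiable : Satisfiable Q) where

    private
      e : ℕ
      e = proj₁ Π

      -- The value 2 means that the test has answered 1 on the string itself, which rules out a
      -- refutation at every later bound. Mere absence of a refutation so far would not. Prefixes of
      -- a member of Q show that such strings exist.
      Good : ℕ → ℕ → Set
      Good k q = ∀ j → j < suc k → E (bits (sn q)) (fs q) e (lst (j ∷ [])) ≡ 2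

      goodF : Form 2
      goodF = ∀̇< (sucT (var 1F)) (EBitsT (snT (var 1F)) (fsT (var 1F)) (lit e) (lstT (var 0F ∷ [])) ≈̇ lit 2)

      good : ∀ k → ∃[ q ] Good k q
      good k =
        let y , y∈Q = Q-satisfiable
            y₂ , h  = proj₁ (proj₂ (proj₂ Π)) y∈Q
            s , hs  = fuel y h (suc k)
        in condition y s , λ j j≤k →
          trans (cong (λ s′ → E (bits (sn (condition y s))) s′ e (lst (j ∷ []))) (length-condition y s))
            (trans (E-agree (agree-condition y₂ s) _ _) (hs j j≤k))
        where
        fuel : ∀ y → (∀ j → Holds e y (j ∷ [])) → ∀ n → ∃[ s ] ∀ j → j < n → E y s e (lst (j ∷ [])) ≡ 2
        fuel y h zero    = 0 , λ _ ()
        fuel y h (suc n) =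
          let s , hs = fuel y h n
              t , eq = run-complete (h n)
          in s ⊔ t , λ j j<1+n → case m≤n⇒m<n∨m≡n j<1+n of λ where
            (inj₁ (s≤s j<n)) → E-mono (m≤m⊔n s t) (hs j j<n)
            (inj₂ refl)      → E-mono (m≤n⊔m s t) (trans (cong (E y t e) (lst-def (n ∷ []))) eq)

      best : ∀ k → ∃[ q ] Good k q × (∀ r → r < q → ¬ Good k r)
      best k = minimal {Good k} (proj₂ (good k))

    approx : ℕ → ℕ
    approx k = sn (proj₁ (best k))

    approxAt : Baire → Vec ℕ 1 → ℕ
    approxAt g (k ∷ []) = approx k

    approx-computable : Computable approxAt
    approx-computable = computable (comp right (searchCode goodF)) λ { {g} (k ∷ []) →
      comp (run-search goodF {g} {k ∷ []} (proj₁ (proj₂ (best k))) (proj₂ (proj₂ (best k)))) right }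

    approx-unrefuted : ∀ {k j} → j ≤ k → Unrefuted e (bits (approx k)) (j ∷ [])
    approx-unrefuted {k} {j} j≤k s eq =
      1+n≢0 (E-unique (proj₁ (proj₂ (best k)) j (s≤s j≤k)) eq)

  -- Sequences of sequences

  col : ℕ → Baire → Baire
  col c z i = z (pr c i)

  colT : Term 2
  colT = query (prT (var 0F) (var 1F))

  firstOne : Baire → Vec ℕ 2 → ℕ
  firstOne z (c ∷ n ∷ []) = firstBelow (col c z) n

  firstOne-computable : Computable firstOne
  firstOne-computable = by-term (firstT (query (prT (var 1F) (var 0F))) (var 1F))
    λ { z (c ∷ n ∷ []) → eval-firstT (query (prT (var 1F) (var 0F))) (var 1F) z (c ∷ n ∷ []) }

  firstOneT : ∀ {n} → Term n → Term n → Term n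
  firstOneT c n = app firstOne-computable (c ∷ n ∷ [])

  evaluateColumn : Baire → Vec ℕ 4 → ℕ
  evaluateColumn z (c ∷ s ∷ e ∷ m ∷ []) = E (col c z) s e m

  evaluateColumn-computable : Computable evaluateColumn
  evaluateColumn-computable = by-term
    (withOracle (query (prT (var 1F) (var 0F))) (ET (var 1F) (var 2F) (var 3F))) λ { z (c ∷ s ∷ e ∷ m ∷ []) → refl }

  EColT : ∀ {n} → Term n → Term n → Term n → Term n → Term n
  EColT c s e m = app evaluateColumn-computable (c ∷ s ∷ e ∷ m ∷ [])

  -- Only the part of the column that lies in z ↾ n is inspected.
  seenOne : Baire → Vec ℕ 2 → ℕ
  seenOne z (c ∷ n ∷ []) = firstBelow (λ i → ifz n ∸ pr c i then 0 else z (pr c i)) n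

  seenOne-computable : Computable seenOne
  seenOne-computable = by-term (firstT lookAt (var 1F))
    λ { z (c ∷ n ∷ []) → eval-firstT lookAt (var 1F) z (c ∷ n ∷ []) }
    where
    lookAt : Term 3
    lookAt = ifz (var 2F ∸ᵀ prT (var 1F) (var 0F)) (lit 0) (query (prT (var 1F) (var 0F)))

  firstBelow-cong : ∀ {p q} → p ≗ q → ∀ n → firstBelow p n ≡ firstBelow q n
  firstBelow-cong eq = recur-cong 0 λ i u → cong (λ v → ifz u then (ifz v then 0 else suc i) else u) (eq i)

  seenOne-local : ∀ {c n x y} → Agree n x y → seenOne x (c ∷ n ∷ []) ≡ seenOne y (c ∷ n ∷ [])
  seenOne-local {c} {n} {x} {y} a = firstBelow-cong (λ i → lemma (pr c i) (n ∸ pr c i) refl) n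
    where
    lemma : ∀ m d → n ∸ m ≡ d → (ifz d then 0 else x m) ≡ (ifz d then 0 else y m)
    lemma m zero    _  = refl
    lemma m (suc d) eq = a m (m∸n≢0⇒n<m λ eq₀ → 1+n≢0 (trans (sym eq) eq₀))

  seenOne-none : ∀ {z c} → (∀ i → col c z i ≡ 0) → ∀ n → seenOne z (c ∷ n ∷ []) ≡ 0
  seenOne-none {z} {c} zeros n = firstBelow-none⁻¹ _ n λ i _ →
    trans (cong (ifz n ∸ pr c i then 0 else_) (zeros i)) (lemma (n ∸ pr c i))
    where
    lemma : ∀ d → (ifz d then 0 else 0) ≡ 0
    lemma zero    = refl
    lemma (suc _) = refl

  seenOne-some : ∀ {z c i} → col c z i ≢ 0 → ∀ n → pr c i < n → seenOne z (c ∷ n ∷ []) ≢ 0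
  seenOne-some {z} {c} {i} ≢0 n c,i<n eq = ≢0 (lemma (n ∸ pr c i) (m<n⇒0<n∸m c,i<n)
    (firstBelow-none _ n eq i (≤-<-trans (sn≤pr c i) c,i<n)))
    where
    lemma : ∀ d → 0 < d → (ifz d then 0 else z (pr c i)) ≡ 0 → z (pr c i) ≡ 0
    lemma (suc _) _ eq = eq

  firstOne-exact : ∀ {z c i} → col c z i ≢ 0 → (∀ j → j < i → col c z j ≡ 0) → ∀ n → i < n →
    firstOne z (c ∷ n ∷ []) ≡ suc i
  firstOne-exact ≢0 below n i<n = firstBelow-some⁻¹ _ n i<n ≢0 below

  firstOne-found : ∀ {z c n} → firstOne z (c ∷ n ∷ []) ≢ 0 → ∃[ i ] firstOne z (c ∷ n ∷ []) ≡ suc i × col c z i ≢ 0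
  firstOne-found {z} {c} {n} ≢0 = go (firstOne z (c ∷ n ∷ [])) refl ≢0
    where
    go : ∀ v → firstOne z (c ∷ n ∷ []) ≡ v → v ≢ 0 → ∃[ i ] v ≡ suc i × col c z i ≢ 0
    go zero    _  ≢0 = contradiction refl ≢0
    go (suc i) eq _  = i , refl , proj₁ (proj₂ (firstBelow-some (col c z) n eq))

  unpack₃ : Form 3 → Form 1
  unpack₃ φ = inst (decide φ) (fsT (var 0F) ∷ fsT (snT (var 0F)) ∷ snT (snT (var 0F)) ∷ []) ≈̇ lit 1

  ∀₃-intro : ∀ X (φ : Form 3) → Π⁰ 1 X (points X ∩ λ x → ∀ k j s → ⊨ φ x (k ∷ j ∷ s ∷ []))
  ∀₃-intro X φ = let e , d , ⊆φ , φ⊆ = Π-intro X (unpack₃ φ) in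
    e , d , (λ (x∈X , h) → ⊆φ (x∈X , λ n → decide-yes φ (h (fs n) (fs (sn n)) (sn (sn n))))) ,
    λ {x} h → let x∈X , h′ = φ⊆ h in x∈X , λ k j s → decide-yes⁻¹ φ {x} {k ∷ j ∷ s ∷ []}
      λ eq → 1+n≢0 (trans (sym (trans (sym (lemma x k j s)) (h′ (pr k (pr j s))))) eq)
    where
    lemma : ∀ x k j s →
      eval (decide φ) x (fs (pr k (pr j s)) ∷ fs (sn (pr k (pr j s))) ∷ sn (sn (pr k (pr j s))) ∷ []) ≡
      eval (decide φ) x (k ∷ j ∷ s ∷ [])
    lemma x k j s rewrite fs-pr k (pr j s) | sn-pr k (pr j s) | fs-pr j s | sn-pr j s = refl

  decide-cong : ∀ {n} (φ : Form n) {x y ρ} → (⊨ φ x ρ → ⊨ φ y ρ) → (⊨ φ y ρ → ⊨ φ x ρ) →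
    eval (decide φ) x ρ ≡ eval (decide φ) y ρ
  decide-cong φ {x} {y} {ρ} f g = case decide-char φ x ρ of λ where
    (inj₁ (h , eq))  → trans eq (sym (decide-yes φ (f h)))
    (inj₂ (¬h , eq)) → trans eq (sym (decide-no φ (¬h ∘ g)))

  eventually-all : ∀ {R : ℕ → ℕ → Set} k → (∀ i → i < k → ∃[ N ] ∀ n → N ≤ n → R i n) →
    ∃[ N ] ∀ i → i < k → ∀ n → N ≤ n → R i n
  eventually-all zero    h = 0 , λ _ ()
  eventually-all (suc k) h =
    let N , all  = eventually-all k λ i i<k → h i (m<n⇒m<1+n i<k)
        M , last = h k (n<1+n k)
    in N ⊔ M , λ i i<1+k n ≤n → case m≤n⇒m<n∨m≡n i<1+k of λ where
      (inj₁ (s≤s i<k)) → all i i<k n (≤-trans (m≤m⊔n N M) ≤n)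
      (inj₂ refl)      → last n (≤-trans (m≤n⊔m N M) ≤n)

  -- Σ⁰₂ sets and (1,ω)-degrees

  combine : Baire → Baire → Baire → Baire
  combine u v w m = ifz fs m then u (sn m) else ifz pred (fs m) then v (sn m) else w (sn m)

  combine-0 : ∀ u v w → col 0 (combine u v w) ≗ u
  combine-0 u v w i rewrite fs-pr 0 i | sn-pr 0 i = refl

  combine-1 : ∀ u v w → col 1 (combine u v w) ≗ v
  combine-1 u v w i rewrite fs-pr 1 i | sn-pr 1 i = refl

  combine-2 : ∀ u v w → col 2 (combine u v w) ≗ w
  combine-2 u v w i rewrite fs-pr 2 i | sn-pr 2 i = refl

  combine-binary : ∀ {u v w} → u ∈ points 2^ℕ → v ∈ points 2^ℕ → w ∈ points 2^ℕ → combine u v w ∈ points 2^ℕ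
  combine-binary {u} {v} {w} u₂ v₂ w₂ m = go (fs m)
    where
    go : ∀ c → (ifz c then u (sn m) else ifz pred c then v (sn m) else w (sn m)) < 2
    go 0             = u₂ (sn m)
    go 1             = v₂ (sn m)
    go (suc (suc _)) = w₂ (sn m)

  unrefuted-≗ : ∀ {e x y n} {ks : Vec ℕ n} → x ≗ y → Unrefuted e x ks → Unrefuted e y ks
  unrefuted-≗ eq u s r = u s (trans (E-agree (λ i _ → eq i) _ _) r)

  decide-binary : ∀ {n} (φ : Form n) g ρ → eval (decide φ) g ρ < 2
  decide-binary φ g ρ = case decide-char φ g ρ of λ where
    (inj₁ (_ , eq)) → subst (_< 2) (sym eq) (s≤s (s≤s z≤n))
    (inj₂ (_ , eq)) → subst (_< 2) (sym eq) (s≤s z≤n)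

  module _ {S Q : Pred Baire 0ℓ} (Σ-S : Σ⁰ 2 2^ℕ S) (Π-Q : Π⁰ 1 2^ℕ Q) (Q-satisfiable : Satisfiable Q) where

    private
      open Approximation {Q} Π-Q Q-satisfiable

      IS : Index ∃∀ 2 2^ℕ S
      IS = Σ-index {X = 2^ℕ} Σ-S

      IQ : Index ∀∃ 1 2^ℕ Q
      IQ = Π-index {X = 2^ℕ} Π-Q

      eS eQ : ℕ
      eS = index IS
      eQ = index IQ

      -- A point of P consists of sequences u, v, w. The first one of u, if there
      -- is one, marks the k for which w must lie in the k-th closed set of S;
      -- until it is seen, v must look like a member of Q.
      mergeF : Form 3
      mergeF =
        (firstOneT (lit 0) (var 1F) ≈̇ lit 0 ⇒̇ ¬̇ (EColT (lit 1) (var 2F) (lit eQ) (lstT (var 1F ∷ [])) ≈̇ lit 1)) ∧̇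
        (¬̇ (firstOneT (lit 0) (var 0F) ≈̇ lit 0) ⇒̇
          ¬̇ (EColT (lit 2) (var 2F) (lit eS) (lstT (predT (firstOneT (lit 0) (var 0F)) ∷ var 1F ∷ [])) ≈̇ lit 1))

      P : Pred Baire 0ℓ
      P = points 2^ℕ ∩ λ z → ∀ n j s → ⊨ mergeF z (n ∷ j ∷ s ∷ [])

      Π-P : Π⁰ 1 2^ℕ P
      Π-P = ∀₃-intro 2^ℕ mergeF

      S∪Q-ext : Extensional (S ∪ Q)
      S∪Q-ext = ∪-ext (Σ⁰-ext {2} {2^ℕ} Σ-S) (Π⁰-ext {1} {2^ℕ} Π-Q)

      -- Changes its mind at most once, from v to w, when a one of u comes into sight.
      side : Baire → Vec ℕ 1 → ℕ
      side z (n ∷ []) = ifz seenOne z (0 ∷ n ∷ []) then section colT 1 else section colT 2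

      side-computable : Computable side
      side-computable = by-term
        (ifz (app seenOne-computable (lit 0 ∷ var 0F ∷ [])) (lit (section colT 1)) (lit (section colT 2)))
        λ { z (n ∷ []) → refl }

      side-local : Local side
      side-local a = cong (ifz_then section colT 1 else section colT 2) (seenOne-local {0} a)

      from-P : (S ∪ Q) ≤[ [1,ω]-computable ] P
      from-P = reduce-by-learner S∪Q-ext (learnerIndex side-computable , learner-isΨ side-computable)
        λ {z} z∈P → go z z∈P (dec (∃[ i ] col 0 z i ≢ 0))
        where
        guesses : ∀ {z} → z ∈ P → ∀ n → learner side-computable (z ↾ n) ≡ side z (n ∷ [])
        guesses (z₂ , _) = learner-prefix side-computable side-local z₂

        Goal : Baire → Set
        Goal z = ∃[ f ] f ∈ (S ∪ Q) × Identifies (learner side-computable) z f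

        go : ∀ z → z ∈ P → Dec (∃[ i ] col 0 z i ≢ 0) → Goal z
        go z z∈P@(z₂ , h) (no ¬one) =
          col 1 z ,
          inj₂ (member IQ (λ i → z₂ (pr 1 i)) λ j s → proj₁ (h 0 j s) (firstBelow-none⁻¹ _ j λ i _ → zeros i)) ,
          section colT 1 ,
          (0 , λ n _ → trans (guesses z∈P n)
            (cong (ifz_then section colT 1 else section colT 2) (seenOne-none {z} {0} zeros n))) ,
          Φ-section colT 1 z
          where
          zeros : ∀ i → col 0 z i ≡ 0
          zeros i = dne λ ≢0 → ¬one (i , ≢0)
        go z z∈P@(z₂ , h) (yes (_ , some)) =
          let k , ≢0 , below = minimal {λ i → col 0 z i ≢ 0} some
              first≡ = firstOne-exact {z} {0} ≢0 (λ j j<k → dne (below j j<k)) (suc k) ≤-refl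
          in
          col 2 z ,
          inj₁ (member IS (λ i → z₂ (pr 2 i)) (k , λ j s →
            subst (λ f → E (col 2 z) s eS (lst (pred f ∷ j ∷ [])) ≢ 1) first≡
              (proj₂ (h (suc k) j s) λ eq → 1+n≢0 (trans (sym first≡) eq)))) ,
          section colT 2 ,
          (suc (pr 0 k) , λ n k<n → trans (guesses z∈P n)
            (choose (seenOne z (0 ∷ n ∷ [])) (seenOne-some {z} {0} {k} ≢0 n k<n))) ,
          Φ-section colT 2 z
          where
          choose : ∀ d → d ≢ 0 → (ifz d then section colT 1 else section colT 2) ≡ section colT 2
          choose zero    ≢0 = contradiction refl ≢0
          choose (suc _) _  = refl

      refutedF : Form 1
      refutedF = ∃̇< (var 0F) (ET (var 1F) (lit eQ) (lstT (var 0F ∷ [])) ≈̇ lit 1)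

      aliveF : Form 2
      aliveF = ∀̇< (var 1F) (¬̇ (ET (var 2F) (lit eS) (lstT (var 1F ∷ var 0F ∷ [])) ≈̇ lit 1))

      -- From a member x of Q the point has u zero and v equal to x; its w is arbitrary. From a
      -- member x of S with witness `k`, u marks `k`, v survives the tests of Q up to and including
      -- `k`, and w is x.
      inQT inST : Term 2
      inQT = ifz (fsT (var 1F)) (lit 0) (ifz (predT (fsT (var 1F))) (query (snT (var 1F))) (query (snT (var 1F))))
      inST = ifz (fsT (var 1F)) (decide (snT (var 1F) ≈̇ var 0F))
        (ifz (predT (fsT (var 1F)))
          (bitT (app approx-computable (var 0F ∷ [])) (snT (var 1F))) (query (snT (var 1F))))

      alive : Baire → ℕ → ℕ
      alive x n = firstBelow (λ k → eval (decide aliveF) x (k ∷ n ∷ [])) n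

      -- A member of Q is never refuted. A refuted x must lie in S, and then the least `k` not yet
      -- ruled out converges to the least `k` whose closed set contains x.
      source : Baire → Vec ℕ 1 → ℕ
      source x (n ∷ []) =
        ifz eval (decide refutedF) x (n ∷ []) then section inQT 0 else section inST (pred (alive x n))

      source-computable : Computable source
      source-computable = by-term
        (ifz (decide refutedF) (lit (section inQT 0))
          (app (section-computable inST) (predT (firstT (decide aliveF) (var 0F)) ∷ [])))
        λ { x (n ∷ []) → cong
              (λ a → ifz eval (decide refutedF) x (n ∷ []) then section inQT 0 else section inST (pred a))
              (eval-firstT (decide aliveF) (var 0F) x (n ∷ [])) }

      refuted-mono : ∀ {x y n} → Agree n x y → ⊨ refutedF x (n ∷ []) → ⊨ refutedF y (n ∷ [])
      refuted-mono a (j , j<n , eq) = j , j<n , trans (sym (E-agree a _ _)) eq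

      alive-mono : ∀ {x y n k} → Agree n x y → ⊨ aliveF x (k ∷ n ∷ []) → ⊨ aliveF y (k ∷ n ∷ [])
      alive-mono a h j j<n eq = h j j<n (trans (E-agree a _ _) eq)

      source-local : Local source
      source-local {x} {y} {n} a = cong₂ (λ r k → ifz r then section inQT 0 else section inST (pred k))
        (decide-cong refutedF {x} {y} {n ∷ []} (refuted-mono a) (refuted-mono (agree-sym a)))
        (firstBelow-cong (λ k → decide-cong aliveF {x} {y} {k ∷ n ∷ []}
          (alive-mono {k = k} a) (alive-mono {k = k} (agree-sym a))) n)

      inQ∈P : ∀ {x} → x ∈ Q → (λ m → eval inQT x (0 ∷ m ∷ [])) ∈ P
      inQ∈P {x} x∈Q = combine-binary {𝟎} {x} {x} (λ _ → s≤s z≤n) x₂ x₂ , λ n j s →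
        (λ _ → unrefuted-≗ {eQ} {ks = j ∷ []} (λ i → sym (combine-1 𝟎 x x i)) (unrefuted IQ x∈Q j) s) ,
        λ ≢0 → contradiction (firstBelow-none⁻¹ _ n λ i _ → combine-0 𝟎 x x i) ≢0
        where
        x₂ : x ∈ points 2^ℕ
        x₂ = S⊆points IQ x∈Q

      inS∈P : ∀ {x} → x ∈ points 2^ℕ → ∀ k → (∀ j → Unrefuted eS x (k ∷ j ∷ [])) →
        (λ m → eval inST x (k ∷ m ∷ [])) ∈ P
      inS∈P {x} x₂ k h = combine-binary {u} {v} {x} u₂ (bits-binary (approx k)) x₂ , λ n j s →
        (λ none → unrefuted-≗ {eQ} {ks = j ∷ []} (λ i → sym (combine-1 u v x i))
          (approx-unrefuted (≮⇒≥ λ k<j → 1+n≢0 (trans (sym (decide-yes (var 0F ≈̇ var 1F) {x} {k ∷ k ∷ []} refl))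
            (trans (sym (combine-0 u v x k)) (firstBelow-none _ j none k k<j))))) s) ,
        λ ≢0 → let i , first≡ , one = firstOne-found {combine u v x} {0} {n} ≢0
                   i≡k = decide-yes⁻¹ (var 0F ≈̇ var 1F) {x} {i ∷ k ∷ []} (λ eq → one (trans (combine-0 u v x i) eq))
               in subst (λ k → E (col 2 (combine u v x)) s eS (lst (k ∷ j ∷ [])) ≢ 1)
                    (sym (trans (cong pred first≡) i≡k))
                    (unrefuted-≗ {eS} {ks = k ∷ j ∷ []} (λ i → sym (combine-2 u v x i)) (h j) s)
        where
        u v : Baire
        u i = eval (decide (var 0F ≈̇ var 1F)) x (i ∷ k ∷ [])
        v = bits (approx k)

        u₂ : u ∈ points 2^ℕ
        u₂ i = decide-binary (var 0F ≈̇ var 1F) x (i ∷ k ∷ [])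

      to-P : P ≤[ [1,ω]-computable ] (S ∪ Q)
      to-P = reduce-by-learner (Π⁰-ext {1} {2^ℕ} Π-P) (learnerIndex source-computable , learner-isΨ source-computable)
        λ {x} x∈S∪Q → go x x∈S∪Q (dec (∃[ j ] ∃[ s ] E x s eQ (lst (j ∷ [])) ≡ 1))
        where
        S∪Q-binary : ∀ {x} → x ∈ (S ∪ Q) → x ∈ points 2^ℕ
        S∪Q-binary (inj₁ x∈S) = S⊆points IS x∈S
        S∪Q-binary (inj₂ x∈Q) = S⊆points IQ x∈Q

        guesses : ∀ {x} → x ∈ (S ∪ Q) → ∀ n → learner source-computable (x ↾ n) ≡ source x (n ∷ [])
        guesses x∈ = learner-prefix source-computable source-local (S∪Q-binary x∈)

        go : ∀ x → x ∈ (S ∪ Q) → Dec (∃[ j ] ∃[ s ] E x s eQ (lst (j ∷ [])) ≡ 1) →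
          ∃[ z ] z ∈ P × Identifies (learner source-computable) x z
        go x x∈ (no ¬refuted) =
          (λ m → eval inQT x (0 ∷ m ∷ [])) ,
          inQ∈P (member IQ (S∪Q-binary x∈) λ j s eq → ¬refuted (j , s , eq)) ,
          section inQT 0 ,
          (0 , λ n _ → trans (guesses x∈ n) (cong (ifz_then section inQT 0 else section inST (pred (alive x n)))
            (decide-no refutedF {x} {n ∷ []} λ (j , _ , eq) → ¬refuted (j , n , eq)))) ,
          Φ-section inQT 0 x
        go x (inj₂ x∈Q) (yes (j , s , eq)) = contradiction eq (unrefuted IQ x∈Q j s)
        go x x∈@(inj₁ x∈S) (yes (j , s , eq)) = settle (minimal {Member} (proj₂ (unrefuted IS x∈S)))
          where
          Member : ℕ → Set
          Member k = ∀ j → Unrefuted eS x (k ∷ j ∷ [])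

          dies : ∀ k → ¬ Member k → ∃[ N ] ∀ n → N ≤ n → eval (decide aliveF) x (k ∷ n ∷ []) ≡ 0
          dies k ¬member =
            let i , r = ¬∀⇒∃¬ ¬member
                t , ¬¬eq = ¬∀⇒∃¬ r
            in t ⊔ suc i , λ n ≤n → decide-no aliveF {x} {k ∷ n ∷ []} λ h →
              h i (≤-trans (m≤n⊔m t (suc i)) ≤n) (E-mono (≤-trans (m≤m⊔n t (suc i)) ≤n) (dne ¬¬eq))

          settle : (∃[ k ] Member k × (∀ i → i < k → ¬ Member i)) →
            ∃[ z ] z ∈ P × Identifies (learner source-computable) x z
          settle (k , member-k , below) =
            let N , dead = eventually-all {λ i n → eval (decide aliveF) x (i ∷ n ∷ []) ≡ 0} k
                             λ i i<k → dies i (below i i<k)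
                M = N ⊔ (suc k ⊔ (s ⊔ suc j))
            in
            (λ m → eval inST x (k ∷ m ∷ [])) ,
            inS∈P (S⊆points IS x∈S) k member-k ,
            section inST k ,
            (M , λ n M≤n →
              let N≤n  = ≤-trans (m≤m⊔n N _) M≤n
                  rest = ≤-trans (m≤n⊔m N _) M≤n
                  k<n  = ≤-trans (m≤m⊔n (suc k) (s ⊔ suc j)) rest
                  sj≤n = ≤-trans (m≤n⊔m (suc k) _) rest
              in trans (guesses x∈ n) (cong₂ (λ r a → ifz r then section inQT 0 else section inST (pred a))
                (decide-yes refutedF {x} {n ∷ []}
                  (j , ≤-trans (m≤n⊔m s (suc j)) sj≤n , E-mono (≤-trans (m≤m⊔n s (suc j)) sj≤n) eq))
                (firstBelow-some⁻¹ _ n k<n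
                  (λ eq₀ → 1+n≢0 (trans (sym (decide-yes aliveF {x} {k ∷ n ∷ []} λ i _ → member-k i n)) eq₀))
                  λ i i<k → dead i i<k n N≤n))) ,
            Φ-section inST k x

    closed-equivalent : ∃[ P ] Π⁰ 1 2^ℕ P × P ≡[ [1,ω]-computable ] (S ∪ Q)
    closed-equivalent = P , Π-P , to-P , from-P

  SEL-Σ₂ : SEL (Σ⁰ 2) 2^ℕ [1,ω]-computable
  SEL-Σ₂ S Q Σ-S Π-Q Q-satisfiable = closed-equivalent Σ-S Π-Q Q-satisfiable

  -- Π⁰₂ sets and (<ω,ω)-degrees

  interleave : (ℕ → Baire) → (ℕ → Baire) → Baire
  interleave u v m = ifz fs (fs m) then u (sn (fs m)) (sn m) else v (sn (fs m)) (sn m)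

  interleave-0 : ∀ u v i → col (pr 0 i) (interleave u v) ≗ u i
  interleave-0 u v i j rewrite fs-pr (pr 0 i) j | sn-pr (pr 0 i) j | fs-pr 0 i | sn-pr 0 i = refl

  interleave-1 : ∀ u v i → col (pr 1 i) (interleave u v) ≗ v i
  interleave-1 u v i j rewrite fs-pr (pr 1 i) j | sn-pr (pr 1 i) j | fs-pr 1 i | sn-pr 1 i = refl

  interleave-binary : ∀ {u v} → (∀ i → u i ∈ points 2^ℕ) → (∀ i → v i ∈ points 2^ℕ) → interleave u v ∈ points 2^ℕ
  interleave-binary {u} {v} u₂ v₂ m = go (fs (fs m))
    where
    go : ∀ c → (ifz c then u (sn (fs m)) (sn m) else v (sn (fs m)) (sn m)) < 2
    go zero    = u₂ (sn (fs m)) (sn m)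
    go (suc _) = v₂ (sn (fs m)) (sn m)

  module _ {S Q : Pred Baire 0ℓ} (Π-S : Π⁰ 2 ℕ^ℕ S) (Π-Q : Π⁰ 1 2^ℕ Q) (Q-satisfiable : Satisfiable Q) where

    private
      open Approximation {Q} Π-Q Q-satisfiable

      IS : Index ∀∃ 2 ℕ^ℕ S
      IS = Π-index {X = ℕ^ℕ} Π-S

      IQ : Index ∀∃ 1 2^ℕ Q
      IQ = Π-index {X = 2^ℕ} Π-Q

      eS eQ : ℕ
      eS = index IS
      eQ = index IQ

      decodedAt : Baire → Vec ℕ 2 → ℕ
      decodedAt z (t ∷ i ∷ []) = pred (firstOne z (pr 0 (pr 0 i) ∷ t ∷ []))

      decoded : Baire → ℕ → Baire
      decoded z t i = decodedAt z (t ∷ i ∷ [])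

      evaluateDecoded : Baire → Vec ℕ 4 → ℕ
      evaluateDecoded z (t ∷ s ∷ e ∷ m ∷ []) = E (decoded z t) s e m

      evaluateDecoded-computable : Computable evaluateDecoded
      evaluateDecoded-computable = by-term
        (withOracle (predT (firstOneT (prT (lit 0) (prT (lit 0) (var 0F))) (var 1F))) (ET (var 1F) (var 2F) (var 3F)))
        λ { z (t ∷ s ∷ e ∷ m ∷ []) → refl }

      -- The point z of P consists of sequences u i = col (pr 0 i) z and
      -- v i = col (pr 1 i) z. The position of the first one of u (pr 0 i) is the
      -- value at i of a member x of S, and that of u (pr 1 k) is a witness for
      -- the k-th instance of x ∈ S. Until the first one of u i is seen, v i must
      -- look like a member of Q.
      codedF : Form 3
      codedF =
        (firstOneT (prT (lit 0) (var 0F)) (var 1F) ≈̇ lit 0 ⇒̇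
          ¬̇ (EColT (prT (lit 1) (var 0F)) (var 2F) (lit eQ) (lstT (var 1F ∷ [])) ≈̇ lit 1)) ∧̇
        (∀̇< (var 1F) (¬̇ (firstOneT (prT (lit 0) (prT (lit 0) (var 0F))) (var 3F) ≈̇ lit 0)) ∧̇
         ¬̇ (firstOneT (prT (lit 0) (prT (lit 1) (var 0F))) (var 2F) ≈̇ lit 0) ⇒̇
          ¬̇ (app evaluateDecoded-computable (var 2F ∷ var 1F ∷ lit eS ∷
                lstT (var 0F ∷ predT (firstOneT (prT (lit 0) (prT (lit 1) (var 0F))) (var 2F)) ∷ []) ∷ []) ≈̇ lit 1))

      P : Pred Baire 0ℓ
      P = points 2^ℕ ∩ λ z → ∀ i j s → ⊨ codedF z (i ∷ j ∷ s ∷ [])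

      Π-P : Π⁰ 1 2^ℕ P
      Π-P = ∀₃-intro 2^ℕ codedF

      S∪Q-ext : Extensional (S ∪ Q)
      S∪Q-ext = ∪-ext (Π⁰-ext {2} {ℕ^ℕ} Π-S) (Π⁰-ext {1} {2^ℕ} Π-Q)

      oneAtF : Form 2
      oneAtF = ¬̇ (query (prT (prT (lit 0) (prT (lit 0) (var 1F))) (var 0F)) ≈̇ lit 0)

      decodeCode : Code
      decodeCode = comp (searchCode oneAtF) (pair idCode const0)

      decodeIndex : ℕ
      decodeIndex = encode (sealed decodeCode)

      unseen : Baire → ℕ → ℕ → ℕ
      unseen z n i = ifz seenOne z (pr 0 i ∷ n ∷ []) then 1 else 0

      -- Follows the least i for which no one of u i has been seen. If every u i has a one, these
      -- guesses need not converge; then a constant learner decodes a member of S. This is why two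
      -- learners are used.
      watch : Baire → Vec ℕ 1 → ℕ
      watch z (n ∷ []) = section colT (pr 1 (pred (firstBelow (unseen z n) n)))

      watch-computable : Computable watch
      watch-computable = by-term
        (app (section-computable colT) (prT (lit 1) (predT (firstT unseenT (var 0F))) ∷ []))
        λ { z (n ∷ []) → cong (λ k → section colT (pr 1 (pred k))) (eval-firstT unseenT (var 0F) z (n ∷ [])) }
        where
        unseenT : Term 2
        unseenT = ifz (app seenOne-computable (prT (lit 0) (var 0F) ∷ var 1F ∷ [])) (lit 1) (lit 0)

      watch-local : Local watch
      watch-local {x} {y} {n} a = cong (λ k → section colT (pr 1 (pred k)))
        (firstBelow-cong (λ i → cong (ifz_then 1 else 0) (seenOne-local {pr 0 i} {n} {x} {y} a)) n)

      module _ {z : Baire} (z∈P : z ∈ P) where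

        decodes-S : (∀ i → ∃[ j ] col (pr 0 i) z j ≢ 0) → ∃[ x ] x ∈ S × Φ decodeIndex z x
        decodes-S ones = x , member IS _ (λ k → pos (pr 1 k) , x-unrefuted k) , λ i →
            run-⊢ (run-sealed (comp (pair run-id const0)
              (run-search oneAtF {z} {i ∷ []} (pos-one (pr 0 i)) (proj₂ (proj₂ (first (pr 0 i)))))))
          where
          first : ∀ i → ∃[ j ] col (pr 0 i) z j ≢ 0 × (∀ r → r < j → ¬ col (pr 0 i) z r ≢ 0)
          first i = minimal {λ j → col (pr 0 i) z j ≢ 0} (proj₂ (ones i))

          pos : ℕ → ℕ
          pos i = proj₁ (first i)

          pos-one : ∀ i → col (pr 0 i) z (pos i) ≢ 0
          pos-one i = proj₁ (proj₂ (first i))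

          pos-exact : ∀ i n → pos i < n → firstOne z (pr 0 i ∷ n ∷ []) ≡ suc (pos i)
          pos-exact i n = firstOne-exact {z} {pr 0 i} (pos-one i) (λ r r<j → dne (proj₂ (proj₂ (first i)) r r<j)) n

          x : Baire
          x i = pos (pr 0 i)

          x-unrefuted : ∀ k → Unrefuted eS x (k ∷ pos (pr 1 k) ∷ [])
          x-unrefuted k s eq =
            -- A run with bound `s` queries `x` only below `s`, so `t` need only exceed the
            -- positions that code these values and the witness for `k`.
            let N , large = eventually-all {λ i n → x i < n} s λ i _ → suc (x i) , λ n → id
                t = N ⊔ suc (pos (pr 1 k))
                found-x i i<s = pos-exact (pr 0 i) t (large i i<s t (m≤m⊔n N _))
                found-k = pos-exact (pr 1 k) t (m≤n⊔m N _)
            in proj₂ (proj₂ z∈P k s t)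
                 ((λ i i<s eq₀ → 1+n≢0 (trans (sym (found-x i i<s)) eq₀)) , (λ eq₀ → 1+n≢0 (trans (sym found-k) eq₀)))
                 (trans (cong (λ l → E (decoded z t) s eS (lst (k ∷ pred l ∷ []))) found-k)
                   (trans (E-agree (λ i i<s → cong pred (found-x i i<s)) _ _) eq))

        watches-Q : ∀ i → (∀ j → col (pr 0 i) z j ≡ 0) → (∀ r → r < i → ¬ (∀ j → col (pr 0 r) z j ≡ 0)) →
          col (pr 1 i) z ∈ Q × Identifies (learner watch-computable) z (col (pr 1 i) z)
        watches-Q i zeros below =
          member IQ (λ m → proj₁ z∈P (pr (pr 1 i) m)) (λ j s →
            proj₁ (proj₂ z∈P i j s) (firstBelow-none⁻¹ _ j λ r _ → zeros r)) ,
          section colT (pr 1 i) ,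
          (N ⊔ suc i , λ n ≤n → trans (learner-prefix watch-computable watch-local (proj₁ z∈P) n)
            (cong (λ k → section colT (pr 1 (pred k))) (firstBelow-some⁻¹ (unseen z n) n
              (≤-trans (m≤n⊔m N (suc i)) ≤n)
              (λ eq → 1+n≢0 (trans (cong (ifz_then 1 else 0) (sym (seenOne-none {z} {pr 0 i} zeros n))) eq))
              λ r r<i → seen r r<i n (≤-trans (m≤m⊔n N (suc i)) ≤n)))) ,
          Φ-section colT (pr 1 i) z
          where
          nonzero : ∀ d → d ≢ 0 → (ifz d then 1 else 0) ≡ 0
          nonzero zero    ≢0 = contradiction refl ≢0
          nonzero (suc _) _  = refl

          sees : ∀ r → r < i → ∃[ M ] ∀ n → M ≤ n → unseen z n r ≡ 0
          sees r r<i = let j , one = ¬∀⇒∃¬ (below r r<i) in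
            suc (pr (pr 0 r) j) , λ n j<n → nonzero _ (seenOne-some {z} {pr 0 r} {j} one n j<n)

          N : ℕ
          N = proj₁ (eventually-all {λ r n → unseen z n r ≡ 0} i sees)

          seen : ∀ r → r < i → ∀ n → N ≤ n → unseen z n r ≡ 0
          seen = proj₂ (eventually-all {λ r n → unseen z n r ≡ 0} i sees)

      from-P : (S ∪ Q) ≤[ [<ω,ω]-computable ] P
      from-P = reduce-by-learners S∪Q-ext b λ {z} z∈P → go z∈P (dec (∃[ i ] ∀ j → col (pr 0 i) z j ≡ 0))
        where
        e₁ e₂ b : ℕ
        e₁ = proj₁ (constantLearner decodeIndex)
        e₂ = learnerIndex watch-computable
        b  = suc (e₁ ⊔ e₂)

        go : ∀ {z} → z ∈ P → Dec (∃[ i ] ∀ j → col (pr 0 i) z j ≡ 0) →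
          ∃[ e ] e < b × (∃[ f ] f ∈ (S ∪ Q) × IdentifiedBy e z f)
        go {z} z∈P (yes (_ , zeros)) =
          let i , zeros′ , below = minimal {λ i → ∀ j → col (pr 0 i) z j ≡ 0} zeros
              f∈Q , identifies = watches-Q z∈P i zeros′ below
          in e₂ , s≤s (m≤n⊔m e₁ e₂) , col (pr 1 i) z , inj₂ f∈Q ,
             learner watch-computable , learner-isΨ watch-computable , identifies
        go {z} z∈P (no ¬zeros) =
          let x , x∈S , Φzx = decodes-S z∈P λ i → ¬∀⇒∃¬ {P = λ j → col (pr 0 i) z j ≡ 0} λ zeros → ¬zeros (i , zeros)
          in e₁ , s≤s (m≤m⊔n e₁ e₂) , x , inj₁ x∈S , (λ _ → decodeIndex) , proj₂ (constantLearner decodeIndex) ,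
             constant-identifies Φzx

      answer : ∀ {A B : Set} → A ⊎ B → ℕ
      answer (inj₁ _) = 0
      answer (inj₂ _) = 1

      answer-binary : ∀ {A B : Set} (d : A ⊎ B) → answer d < 2
      answer-binary (inj₁ _) = s≤s z≤n
      answer-binary (inj₂ _) = s≤s (s≤s z≤n)

      decides : Decides eS ℕ^ℕ 2
      decides = proj₁ (proj₂ Π-S)

      -- As S is given on all of Baire space, its matrix is decided for every oracle and gives a
      -- total functional, which u can use to mark witnesses exactly.
      holdsAt : Baire → Vec ℕ 2 → ℕ
      holdsAt x ks = answer (decides x _ ks)

      answer-run : ∀ {e x m} (d : Run e x m 0 ⊎ Run e x m 1) → Run e x m (answer d)
      answer-run (inj₁ r) = r
      answer-run (inj₂ r) = r

      holdsAt-computable : Computable holdsAt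
      holdsAt-computable = go (index-code IS)
        where
        go : IsCode eS → Computable holdsAt
        go (c , eq) = computable (comp c (compile (lstT {2} (var 0F ∷ var 1F ∷ [])))) λ { {x} (k ∷ l ∷ []) →
          comp (run-compile (lstT {2} (var 0F ∷ var 1F ∷ [])) (k ∷ l ∷ []))
            (let s , halts = run-complete (answer-run (decides x _ (k ∷ l ∷ []))) in
             E-sound c (subst₂ (λ e m → E x s e m ≡ suc (holdsAt x (k ∷ l ∷ []))) (sym eq)
               (sym (lst-def (k ∷ l ∷ []))) halts)) }

      holdsAt⇒unrefuted : ∀ {x ks} → holdsAt x ks ≢ 0 → Unrefuted eS x ks
      holdsAt⇒unrefuted {x} {ks} ≢0 = go (decides x _ ks) ≢0
        where
        go : (d : Run eS x _ 0 ⊎ Run eS x _ 1) → answer d ≢ 0 → Unrefuted eS x ks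
        go (inj₁ _) ≢0 = contradiction refl ≢0
        go (inj₂ r) _  = holds⇒unrefuted r

      unrefuted⇒holdsAt : ∀ {x ks} → Unrefuted eS x ks → holdsAt x ks ≢ 0
      unrefuted⇒holdsAt {x} {ks} u = go (decides x _ ks)
        where
        go : (d : Run eS x _ 0 ⊎ Run eS x _ 1) → answer d ≢ 0
        go (inj₁ r) _ = let s , eq = run-complete r in u s (trans (cong (E x s eS) (lst-def ks)) eq)
        go (inj₂ _)   = λ ()

      -- Columns with a tag other than 0 and 1 code nothing. They are constantly 1, so that for a
      -- member of S every u i has a one and every v i has to pass only finitely many tests.
      uT : Term 2
      uT = ifz (fsT (var 0F)) (decide (var 1F ≈̇ query (snT (var 0F))))
        (ifz (predT (fsT (var 0F))) (app holdsAt-computable (snT (var 0F) ∷ var 1F ∷ [])) (lit 1))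

      u : Baire → ℕ → Baire
      u x i j = eval uT x (i ∷ j ∷ [])

      isValueF : Form 2
      isValueF = var 1F ≈̇ query (var 0F)

      u-0 : ∀ x i j → u x (pr 0 i) j ≡ eval (decide isValueF) x (i ∷ j ∷ [])
      u-0 x i j rewrite fs-pr 0 i | sn-pr 0 i = refl

      u-1 : ∀ x k l → u x (pr 1 k) l ≡ holdsAt x (k ∷ l ∷ [])
      u-1 x k l rewrite fs-pr 1 k | sn-pr 1 k = refl

      u-binary : ∀ x i → u x i ∈ points 2^ℕ
      u-binary x i j = go (fs i)
        where
        go : ∀ c → (ifz c then eval (decide isValueF) x (sn i ∷ j ∷ [])
                    else ifz pred c then holdsAt x (sn i ∷ j ∷ []) else 1) < 2
        go 0             = decide-binary isValueF x (sn i ∷ j ∷ [])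
        go 1             = answer-binary (decides x _ (sn i ∷ j ∷ []))
        go (suc (suc _)) = s≤s (s≤s z≤n)

      u-attained : ∀ {x} → x ∈ S → ∀ i → ∃[ j ] u x i j ≢ 0
      u-attained {x} x∈S i = go (fs i)
        where
        go : ∀ c → ∃[ j ] (ifz c then eval (decide isValueF) x (sn i ∷ j ∷ [])
                           else ifz pred c then holdsAt x (sn i ∷ j ∷ []) else 1) ≢ 0
        go 0             = x (sn i) , λ eq →
          1+n≢0 (trans (sym (decide-yes isValueF {x} {sn i ∷ x (sn i) ∷ []} refl)) eq)
        go 1             = let l , unref = unrefuted IS x∈S (sn i) in l , unrefuted⇒holdsAt {x} {sn i ∷ l ∷ []} unref
        go (suc (suc _)) = 0 , λ ()

      positionF : Form 2
      positionF = ¬̇ (inst uT (snT (fsT (var 1F)) ∷ var 0F ∷ []) ≈̇ lit 0)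

      pointT : Term 2
      pointT = ifz (fsT (fsT (var 1F))) (inst uT (snT (fsT (var 1F)) ∷ snT (var 1F) ∷ []))
        (bitT (app approx-computable (var 0F ∷ [])) (snT (var 1F)))

      pointCode : Code
      pointCode = comp (compile pointT) (pair (comp (searchCode positionF) (pair idCode const0)) (pair idCode const0))

      inQT : Term 1
      inQT = ifz (fsT (fsT (var 0F))) (lit 0) (query (snT (var 0F)))

      pointIndex inQIndex : ℕ
      pointIndex = encode (sealed pointCode)
      inQIndex   = encode (sealed (comp (compile inQT) (pair idCode const0)))

      Φ-inQ : ∀ x → Φ inQIndex x λ m → eval inQT x (m ∷ [])
      Φ-inQ x m = run-⊢ (run-sealed (comp (pair run-id const0) (run-compile inQT (m ∷ []))))

      inQ∈P : ∀ {x} → x ∈ Q → (λ m → eval inQT x (m ∷ [])) ∈ P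
      inQ∈P {x} x∈Q = binary , λ i j s →
        (λ _ → unrefuted-≗ {eQ} {ks = j ∷ []} (λ m → sym (interleave-1 zeros copies i m)) (unrefuted IQ x∈Q j) s) ,
        λ (_ , ≢0) → contradiction (firstBelow-none⁻¹ _ s λ m _ → zero-col (pr 1 i) m) ≢0
        where
        zeros copies : ℕ → Baire
        zeros  _ = 𝟎
        copies _ = x

        zero-col : ∀ i → col (pr 0 i) (interleave zeros copies) ≗ 𝟎
        zero-col = interleave-0 zeros copies

        binary : interleave zeros copies ∈ points 2^ℕ
        binary = interleave-binary {zeros} {copies} (λ _ _ → s≤s z≤n) λ _ → S⊆points IQ x∈Q

      module _ {x : Baire} (x∈S : x ∈ S) where

        first : ∀ i → ∃[ j ] u x i j ≢ 0 × (∀ r → r < j → ¬ u x i r ≢ 0)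
        first i = minimal {λ j → u x i j ≢ 0} (proj₂ (u-attained x∈S i))

        pos : ℕ → ℕ
        pos i = proj₁ (first i)

        point : Baire
        point = interleave (u x) λ i → bits (approx (pos i))

        Φ-point : Φ pointIndex x point
        Φ-point m =
          let _ , one , below = first (sn (fs m)) in
          run-⊢ (run-sealed (comp
            (pair (comp (pair run-id const0) (run-search positionF {x} {m ∷ []} one below)) (pair run-id const0))
            (run-compile pointT (pos (sn (fs m)) ∷ m ∷ []))))

        point-u : ∀ i → col (pr 0 i) point ≗ u x i
        point-u = interleave-0 (u x) λ i → bits (approx (pos i))

        point-v : ∀ i → col (pr 1 i) point ≗ bits (approx (pos i))
        point-v = interleave-1 (u x) λ i → bits (approx (pos i))

        point-binary : point ∈ points 2^ℕ
        point-binary = interleave-binary (u-binary x) λ i → bits-binary (approx (pos i))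

        decoded-point : ∀ {t s} → (∀ i → i < s → firstOne point (pr 0 (pr 0 i) ∷ t ∷ []) ≢ 0) →
          Agree s (decoded point t) x
        decoded-point {t} found i i<s =
          let r , eq , one = firstOne-found {point} {pr 0 (pr 0 i)} {t} (found i i<s) in
          trans (cong pred eq) (decide-yes⁻¹ isValueF {x} {i ∷ r ∷ []}
            λ eq₀ → one (trans (point-u (pr 0 i) r) (trans (u-0 x i r) eq₀)))

        point∈P : point ∈ P
        point∈P = point-binary , λ i j s →
          (λ none → unrefuted-≗ {eQ} {ks = j ∷ []} (λ m → sym (point-v i m)) (approx-unrefuted
            (≮⇒≥ λ pos<j → proj₁ (proj₂ (first i)) (trans (sym (point-u i (pos i)))
              (firstBelow-none _ j none (pos i) pos<j)))) s) ,
          λ (found , ≢0) eq →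
            let l , first≡ , one = firstOne-found {point} {pr 0 (pr 1 i)} {s} ≢0 in
            holdsAt⇒unrefuted {x} {i ∷ l ∷ []} (λ eq₀ → one (trans (point-u (pr 1 i) l) (trans (u-1 x i l) eq₀))) j
              (trans (sym (E-agree (decoded-point {s} found) _ _))
                (trans (cong (λ l → E (decoded point s) j eS (lst (i ∷ pred l ∷ []))) (sym first≡)) eq))

      -- Two constant learners suffice, one treating the input as a member of S and one as a member
      -- of Q; neither has to recognise which case holds.
      to-P : P ≤[ [<ω,ω]-computable ] (S ∪ Q)
      to-P = reduce-by-learners P-ext b λ where
          (inj₁ x∈S) → e₁ , s≤s (m≤m⊔n e₁ e₂) , point x∈S , point∈P x∈S , (λ _ → pointIndex) ,
            proj₂ (constantLearner pointIndex) , constant-identifies (Φ-point x∈S)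
          (inj₂ x∈Q) → e₂ , s≤s (m≤n⊔m e₁ e₂) , _ , inQ∈P x∈Q , (λ _ → inQIndex) ,
            proj₂ (constantLearner inQIndex) , constant-identifies (Φ-inQ _)
        where
        P-ext : Extensional P
        P-ext = Π⁰-ext {1} {2^ℕ} Π-P

        e₁ e₂ b : ℕ
        e₁ = proj₁ (constantLearner pointIndex)
        e₂ = proj₁ (constantLearner inQIndex)
        b  = suc (e₁ ⊔ e₂)

    closed-equivalent-<ω : ∃[ P ] Π⁰ 1 2^ℕ P × P ≡[ [<ω,ω]-computable ] (S ∪ Q)
    closed-equivalent-<ω = P , Π-P , to-P , from-P

  SEL-Π₂ : SEL (Π⁰ 2) ℕ^ℕ [<ω,ω]-computable
  SEL-Π₂ S Q Π-S Π-Q Q-satisfiable = closed-equivalent-<ω Π-S Π-Q Q-satisfiable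

theorem75 : ExcludedMiddle (lsuc 0ℓ) →
    (¬ SEL (Σ⁰ 2) 2^ℕ [<ω,1]-computable) ×
    SEL (Σ⁰ 2) 2^ℕ [1,ω]-computable ×
    (¬ SEL (Π⁰ 2) 2^ℕ [1,ω]-computable) ×
    SEL (Π⁰ 2) ℕ^ℕ [<ω,ω]-computable ×
    (¬ SEL (Σ⁰ 3) 2^ℕ [<ω,ω]-computable)
theorem75 em = not-SEL-Σ₂ em , SEL-Σ₂ em , not-SEL-Π₂ em , SEL-Π₂ em , not-SEL-Σ₃ em
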